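{- Let $p$ be an odd prime, $m\ge 3$ an odd integer, $k$ a positive integer with $\gcd(m,k)=1$, and $\pi$ a primitive element of $\mathbb{F}_{p^m}$. Let $\mathrm{Tr}$ denote the trace map from $\mathbb{F}_{p^m}$ to $\mathbb{F}_p$. For $a,b,c\in\mathbb{F}_{p^m}$ define $$\mathbf{c}_{(a,b,c)}=\Big(\mathrm{Tr}\big(a\pi^{t}+b(-\pi)^{t}+c\,\pi^{(p^{k}+1)t/2}\big)\Big)_{t=0}^{p^{m}-2}\in\mathbb{F}_p^{\,p^m-1},$$ and let $\mathcal{C}_{(p,m,k)}=\{\mathbf{c}_{(a,b,c)}: a,b,c\in\mathbb{F}_{p^m}\}$. Then $\mathcal{C}_{(p,m,k)}$ is a cyclic code over $\mathbb{F}_p$ with parameters $[p^m-1,\,3m,\,\frac{p-1}{2}p^{m-1}]$ (length, dimension, minimum distance), and as $(a,b,c)$ runs through $\mathbb{F}_{p^m}^3$, the Hamming weight of $\mathbf{c}_{(a,b,c)}$ takes the following values with the following frequencies: - $0$: $1$ time; - $\frac{p-1}{2}p^{m-1}$: $2(p^m-1)$ times; - $\frac{p-1}{2}\big(2p^{m-1}-p^{\frac{m-1}{2}}\big)$: $(p^m-1)(p^m-p^{m-1})(p^{m-1}+p^{\frac{m-1}{2}})$ times; - $\frac{p-1}{2}\big(2p^{m-1}+p^{\frac{m-1}{2}}\big)$: $(p^m-1)(p^m-p^{m-1})(p^{m-1}-p^{\frac{m-1}{2}})$ times; - $(p-1)\big(p^{m-1}-p^{\frac{m-1}{2}}\big)$: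 $\frac14(p^m-1)(p^{m-1}+p^{\frac{m-1}{2}})^2$ times; - $(p-1)\big(p^{m-1}+p^{\frac{m-1}{2}}\big)$: $\frac14(p^m-1)(p^{m-1}-p^{\frac{m-1}{2}})^2$ times; - $(p-1)p^{m-1}$: $(p^m-1)\big(p^{2m}+\frac32p^{2(m-1)}-2p^{2m-1}+p^m-\frac12p^{m-1}-1\big)$ times.
   Context: Equivalently, $\mathcal{C}_{(p,m,k)}$ is the cyclic code of length $p^m-1$ whose parity-check polynomial is $h_0(x)h_1(x)h_2(x)$, where $h_0,h_1,h_2$ are the minimal polynomials over $\mathbb{F}_p$ of $\pi^{ -1}$, $(-\pi)^{ -1}$ and $\pi^{ -(p^k+1)/2}$ respectively. The Hamming weight of a vector is its number of nonzero coordinates. -}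

module Defs where

open import Algebra.Bundles using (CommutativeRing; Semiring)
open import Algebra.Morphism.Structures using (module RingMorphisms)
open import Data.Fin.Base using (Fin; toℕ)
open import Data.Fin.Properties using () renaming (_≟_ to _≟ᶠ_)
open import Data.Integer.Base using (+_)
open import Data.List.Base as List
  using (List; []; _∷_; allFin; cartesianProduct; filter; length)
open import Data.Nat.Base using (ℕ; zero; suc; _+_; _*_; _∸_; _^_; _≤_)
open import Data.Nat.DivMod using (_/_)
open import Data.Nat.Properties using () renaming (_≟_ to _≟ⁿ_)
open import Data.Product.Base using (_×_; _,_; ∃-syntax)
import Data.Rational.Base as ℚ
open ℚ using (ℚ)
open import Data.Vec.Functional as Vector using (Vector)
open import Function.Bundles using (Inverse)
open import Function.Properties.Inverse using (Inverse⇒Injection)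
open import Level using (Level; _⊔_) renaming (suc to lsuc)
open import Relation.Binary.Definitions using (Decidable)
open import Relation.Binary.PropositionalEquality.Core using (_≡_)
open import Relation.Binary.PropositionalEquality.Properties using (setoid)
open import Relation.Nullary.Decidable using (via-injection; ¬?)
open import Relation.Nullary.Negation.Core using (¬_)
open import Relation.Unary using (Pred)
import Algebra.Definitions.RawMonoid as RawMonoidDefs
import Algebra.Definitions.RawSemiring as RawSemiringDefs

record FiniteField (c ℓ : Level) (q : ℕ) : Set (lsuc (c ⊔ ℓ)) where
  field
    commutativeRing : CommutativeRing c ℓ

  -- The ring operations are renamed so that they can be used next to those
  -- of ℕ.
  open CommutativeRing commutativeRing public
    using (Carrier; _≈_; _≉_; 0#; 1#; rawRing; semiring)
    renaming (_+_ to _⊕_; _*_ to _⊗_; -_ to ⊖_; setoid to ≈-setoid)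

  field
    0≉1         : 0# ≉ 1#
    inverse     : ∀ x → x ≉ 0# → ∃[ y ] (x ⊗ y ≈ 1#)
    enumeration : Inverse ≈-setoid (setoid (Fin q))

  open RawMonoidDefs (Semiring.+-rawMonoid semiring) public
    using (sum)
  open RawSemiringDefs (Semiring.rawSemiring semiring) public
    using () renaming (_^_ to _↑_)

  _≟_ : Decidable _≈_
  _≟_ = via-injection (Inverse⇒Injection enumeration) _≟ᶠ_

  elements : List Carrier
  elements = List.map (Inverse.from enumeration) (allFin q)

  record IsPrimitive (π : Carrier) : Set (c ⊔ ℓ) where
    field
      nonzero   : π ≉ 0#
      generates : ∀ x → x ≉ 0# → ∃[ t ] (x ≈ π ↑ t)

module _ {a b ℓ₁ ℓ₂ : Level} {q q′ : ℕ}
         (K : FiniteField a ℓ₁ q) (F : FiniteField b ℓ₂ q′) where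
  private
    module K = FiniteField K
    module F = FiniteField F

  -- A ring homomorphism between fields is automatically injective.
  IsEmbedding : (K.Carrier → F.Carrier) → Set (a ⊔ ℓ₁ ⊔ ℓ₂)
  IsEmbedding = RingMorphisms.IsRingHomomorphism K.rawRing F.rawRing

  -- With q′ = q ^ m, the trace of x is the sum of its m conjugates
  -- x ^ (q ^ i); the sum is formed in F and lies in the image of K.  Since ι is
  -- injective, this determines Tr up to the equality of K.
  IsTrace : ℕ → (K.Carrier → F.Carrier) → (F.Carrier → K.Carrier) → Set (b ⊔ ℓ₂)
  IsTrace m ι Tr = ∀ x → ι (Tr x) F.≈ F.sum {m} (λ i → x F.↑ (q ^ toℕ i))

module Coding {c ℓ : Level} {q : ℕ} (K : FiniteField c ℓ q) where
  open FiniteField K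

  Word : ℕ → Set c
  Word n = Vector Carrier n

  infix 4 _≋_
  _≋_ : ∀ {n} → Word n → Word n → Set ℓ
  u ≋ v = ∀ t → u t ≈ v t

  linearCombination : ∀ {n r} → (Fin r → Carrier) → (Fin r → Word n) → Word n
  linearCombination s g t = sum (λ i → s i ⊗ g i t)

  -- (v₀ , … , vₙ₋₁) ↦ (vₙ₋₁ , v₀ , … , vₙ₋₂)
  cyclicShift : ∀ {n} → Word n → Word n
  cyclicShift {zero}  v = v
  cyclicShift {suc n} v = Vector.last v Vector.∷ Vector.init v

  hammingWeight : ∀ {n} → Word n → ℕ
  hammingWeight {n} v = length (filter (λ t → ¬? (v t ≟ 0#)) (allFin n))

  hammingDistance : ∀ {n} → Word n → Word n → ℕ
  hammingDistance {n} u v = length (filter (λ t → ¬? (u t ≟ v t)) (allFin n))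

  module _ {n : ℕ} {ℓ′ : Level} (C : Pred (Word n) ℓ′) where

    record IsLinear : Set (c ⊔ ℓ ⊔ ℓ′) where
      field
        respects : ∀ {u v} → u ≋ v → C u → C v
        0-closed : C (λ _ → 0#)
        +-closed : ∀ {u v} → C u → C v → C (λ t → u t ⊕ v t)
        *-closed : ∀ s {v} → C v → C (λ t → s ⊗ v t)

    record IsBasis {r : ℕ} (g : Fin r → Word n) : Set (c ⊔ ℓ ⊔ ℓ′) where
      field
        contained   : ∀ i → C (g i)
        independent : ∀ s → linearCombination s g ≋ (λ _ → 0#) → ∀ i → s i ≈ 0#
        spanning    : ∀ {v} → C v → ∃[ s ] (v ≋ linearCombination s g)

    HasDimension : ℕ → Set (c ⊔ ℓ ⊔ ℓ′)
    HasDimension r = ∃[ g ] IsBasis {r} g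

    record HasMinimumDistance (d : ℕ) : Set (c ⊔ ℓ ⊔ ℓ′) where
      field
        attained   : ∃[ u ] ∃[ v ] (C u × C v × ¬ (u ≋ v) × hammingDistance u v ≡ d)
        lowerBound : ∀ {u v} → C u → C v → ¬ (u ≋ v) → d ≤ hammingDistance u v

    record IsCyclicCode (r d : ℕ) : Set (c ⊔ ℓ ⊔ ℓ′) where
      field
        isLinear        : IsLinear
        shift-closed    : ∀ {v} → C v → C (cyclicShift v)
        dimension       : HasDimension r
        minimumDistance : HasMinimumDistance d

module CyclicCode
  {a b ℓ₁ ℓ₂ : Level} (p m k : ℕ)
  (K : FiniteField a ℓ₁ p) (F : FiniteField b ℓ₂ (p ^ m))
  (Tr : FiniteField.Carrier F → FiniteField.Carrier K)
  (π : FiniteField.Carrier F) where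

  private
    module F = FiniteField F
  open F using (_⊕_; _⊗_; ⊖_; _↑_)
  open Coding K

  codeword : F.Carrier → F.Carrier → F.Carrier → Word (p ^ m ∸ 1)
  codeword x y z i =
    Tr (x ⊗ (π ↑ t) ⊕ y ⊗ ((⊖ π) ↑ t) ⊕ z ⊗ (π ↑ (((p ^ k + 1) * t) / 2)))
    where
      t : ℕ
      t = toℕ i

  code : Pred (Word (p ^ m ∸ 1)) (b ⊔ ℓ₁)
  code v = ∃[ x ] ∃[ y ] ∃[ z ] (v ≋ codeword x y z)

  weight : F.Carrier × F.Carrier × F.Carrier → ℕ
  weight (x , y , z) = hammingWeight (codeword x y z)

  frequency : ℕ → ℕ
  frequency w = length (filter (λ xyz → weight xyz ≟ⁿ w)
    (cartesianProduct F.elements (cartesianProduct F.elements F.elements)))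

fromℕ : ℕ → ℚ
fromℕ n = + n ℚ./ 1

-- The pairs (weight , frequency).  For odd p and m ≥ 1 the operations on the
-- weights are exact: p ∸ 1 is even, and p ^ ((m ∸ 1) / 2) ≤ p ^ (m ∸ 1).
weightDistribution : ℕ → ℕ → List (ℕ × ℚ)
weightDistribution p m =
    (0 , ℚ.1ℚ)
  ∷ (h * P , two ℚ.* (pᵐ ℚ.- ℚ.1ℚ))
  ∷ (h * (2 * P ∸ S) ,
      (pᵐ ℚ.- ℚ.1ℚ) ℚ.* (pᵐ ℚ.- pᵐ⁻¹) ℚ.* (pᵐ⁻¹ ℚ.+ s))
  ∷ (h * (2 * P + S) ,
      (pᵐ ℚ.- ℚ.1ℚ) ℚ.* (pᵐ ℚ.- pᵐ⁻¹) ℚ.* (pᵐ⁻¹ ℚ.- s))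
  ∷ ((p ∸ 1) * (P ∸ S) ,
      (+ 1 ℚ./ 4) ℚ.* (pᵐ ℚ.- ℚ.1ℚ) ℚ.* ((pᵐ⁻¹ ℚ.+ s) ℚ.* (pᵐ⁻¹ ℚ.+ s)))
  ∷ ((p ∸ 1) * (P + S) ,
      (+ 1 ℚ./ 4) ℚ.* (pᵐ ℚ.- ℚ.1ℚ) ℚ.* ((pᵐ⁻¹ ℚ.- s) ℚ.* (pᵐ⁻¹ ℚ.- s)))
  ∷ ((p ∸ 1) * P ,
      (pᵐ ℚ.- ℚ.1ℚ) ℚ.*
      (fromℕ (p ^ (2 * m)) ℚ.+ (+ 3 ℚ./ 2) ℚ.* fromℕ (p ^ (2 * (m ∸ 1)))
        ℚ.- two ℚ.* fromℕ (p ^ (2 * m ∸ 1)) ℚ.+ pᵐ ℚ.- ℚ.½ ℚ.* pᵐ⁻¹ ℚ.- ℚ.1ℚ))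
  ∷ []
  where
    h P S : ℕ
    h = (p ∸ 1) / 2
    P = p ^ (m ∸ 1)
    S = p ^ ((m ∸ 1) / 2)

    two pᵐ pᵐ⁻¹ s : ℚ
    two  = + 2 ℚ./ 1
    pᵐ   = fromℕ (p ^ m)
    pᵐ⁻¹ = fromℕ P
    s    = fromℕ S

{-# OPTIONS --safe #-}
module Submission where

-- Splitting the positions t into even and odd ones turns the weight of a codeword into half the number of
-- nonzero values of two quadratic forms Q(y) = Tr (u y² + c y ^ (p ^ k + 1)) on F, with (u , c) replaced by
-- (a + b , c) and ((a - b) π , c π ^ ((p ^ k + 1) / 2)). Write P = p ^ (m - 1) and S = p ^ ((m - 1) / 2).
--
-- Counting pairs with Q(y) = Q(z) gives Σ N_s² in terms of the size R of the radical. Since N_s is even for s ≠ 0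
-- (y ↦ - y) and depends only on the square class of s, the number of zeros is N₀ = P - (p - 1) E where
-- p E² + B² = R P for integers E and B. The radical is the kernel of a σ-polynomial of order two, σ = (·) ^ p ^ k,
-- and σ has fixed field K, so R ∈ {1 , p , p²} unless u = c = 0; infinite descent then leaves E ∈ {0 , S , - S}.
--
-- For c ≠ 0 the first two moments of E over u can be computed, as y² / z² ∈ K only if y / z ∈ K (m is odd):
-- Σ E = - P and Σ E² = P². So E = - S and E = S are attained (P + S) / 2 and (P - S) / 2 times, and the seven
-- frequencies follow because (a , b) ↦ (a + b , (a - b) π) is a bijection.

open import Algebra.Bundles using (CommutativeRing; RawRing)
import Algebra.Morphism.RingMonomorphism
open import Algebra.Morphism.Structures using (module RingMorphisms)
import Algebra.Properties.AbelianGroup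
import Algebra.Properties.CommutativeMonoid.Sum
import Algebra.Properties.CommutativeSemiring.Binomial
import Algebra.Properties.CommutativeSemiring.Exp
import Algebra.Properties.Ring
import Algebra.Properties.Semiring.Exp
import Algebra.Properties.Semiring.Mult
import Algebra.Properties.Semiring.Mult.TCOptimised
import Algebra.Properties.Semiring.Sum
import Algebra.Solver.Ring
import Algebra.Solver.Ring.AlmostCommutativeRing as ACR
open import Algebra.Structures using (IsCommutativeRing)
open import Data.Fin.Base
  using (Fin; zero; suc; toℕ; fromℕ<; inject₁; inject≤; punchOut; combine; remQuot; finToFun; funToFin)
  renaming (fromℕ to top)
open import Data.Fin.Patterns using (0F; 1F; 2F; 3F; 4F; 5F; 6F)
open import Data.Fin.Permutation using (Permutation; permutation)
import Data.Fin.Properties as Fin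
open import Data.Integer.Base as ℤ using (ℤ; +_; -[1+_]; 0ℤ; 1ℤ)
import Data.Integer.Properties as ℤ
import Data.Integer.Solver
open import Data.Integer.Tactic.RingSolver using () renaming (solve-∀ to ℤ-solve-∀)
open import Data.List.Base as List using (List; []; _∷_; _++_; allFin; cartesianProduct; filter; length; map)
open import Data.List.Membership.Propositional using (_∈_)
open import Data.List.Relation.Unary.All using (All; []; _∷_)
open import Data.List.Relation.Unary.Any using (here; there)
open import Data.Maybe.Base using (Maybe; just; nothing)
open import Data.Nat.Base as ℕ using (ℕ; zero; suc; _≤_; _<_; z≤n; s≤s; _^_)
open import Data.Nat.Combinatorics using (_C_; nCn≡1; nC1≡n; nCk+nC[k+1]≡[n+1]C[k+1])
open import Data.Nat.Coprimality using (Coprime; coprime-Bézout; gcd≡1⇒coprime)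
open import Data.Nat.DivMod using (_/_; _%_; m≡m%n+[m/n]*n; m%n<n; m*n/n≡m)
open import Data.Nat.Divisibility using (_∣_; divides; ∣⇒≤; ∣m+n∣m⇒∣n; m∣m*n)
open import Data.Nat.GCD as GCD using (gcd)
open import Data.Nat.Primality using (Prime; euclidsLemma; prime⇒nonTrivial; prime⇒nonZero)
import Data.Nat.Properties as ℕ
open import Data.Nat.Tactic.RingSolver using () renaming (solve-∀ to ℕ-solve-∀)
open import Data.Product.Base using (_×_; _,_; ∃; ∃₂; proj₁; proj₂)
import Data.Rational.Base as ℚ
open ℚ using (ℚ)
import Data.Rational.Properties as ℚ
import Data.Rational.Solver
import Data.Rational.Unnormalised.Base as ℚᵘ
import Data.Rational.Unnormalised.Properties as ℚᵘ
open import Data.Sum.Base as Sum using (_⊎_; inj₁; inj₂)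
open import Function.Base using (_∘_)
open import Function.Bundles using (Inverse)
open import Function.Definitions using (Injective)
open import Level using (Level; 0ℓ)
open import Relation.Binary.Definitions using (tri<; tri≈; tri>)
open import Relation.Binary.PropositionalEquality
  using (_≡_; _≢_; refl; sym; trans; cong; cong₂; subst; module ≡-Reasoning)
open import Relation.Nullary.Decidable using (Dec; yes; no; _×-dec_; decidable-stable; ¬?)
open import Relation.Nullary.Negation using (¬_; contradiction)
open import Relation.Unary using (Decidable; Pred)
open import Defs

-- Finite sums

-- All counting is done in ℤ, without characters or Gauss sums: the relation p E² + B² = R P
-- replaces the absolute value of a Gauss sum, with B half the difference between the numbers of
-- representations of a square and of a nonsquare. As P is an even power of p, the exponent of R P
-- is odd only for R = p; that is the one case in which the descent ends with E = S or E = - S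
-- rather than E = 0. The relation says nothing about the sign of E, and the sign of a single form
-- is never determined. It need not be: for fixed c the parameters u = a + b and v = (a - b) π of
-- the two forms vary independently, so only the distribution of E over u matters. It is the same
-- for every c ≠ 0, and with three possible values it is fixed by the total q and two moments. The
-- second moment is where pairs of points y, z occur: the conditions that y and z put on u are
-- independent unless z / y lies in K. Many statements about finite fields (order of π, square
-- classes, existence of a basis) are obtained by pigeonhole, which is why both fields are first
-- moved to carriers `Fin n` with propositional equality.

module Counting where
  open Algebra.Properties.Semiring.Sum ℤ.+-*-semiring public using ()
    renaming (sum to ∑; sum-cong-≗ to ∑-cong)
  private
    module Sums = Algebra.Properties.Semiring.Sum ℤ.+-*-semiring

  -- A missed value could be punched out, which would inject `Fin (suc n)` into `Fin n`.
  injective⇒surjective : ∀ {n} {f : Fin n → Fin n} → Injective _≡_ _≡_ f → ∀ y → ∃ λ x → f x ≡ y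
  injective⇒surjective {suc n} {f} inj y with Fin.any? (λ x → f x Fin.≟ y)
  ... | yes found = found
  ... | no missed = contradiction
    (Fin.injective⇒≤ {f = λ x → punchOut (λ y≡fx → missed (x , sym y≡fx))}
      (λ {x} {x′} eq → inj (Fin.punchOut-injective (λ e → missed (x , sym e)) (λ e → missed (x′ , sym e)) eq)))
    ℕ.1+n≰n

  -- A section of f is injective, hence onto by the previous lemma, hence a two-sided inverse.
  surjective⇒injective : ∀ {n} {f : Fin n → Fin n} → (∀ y → ∃ λ x → f x ≡ y) → Injective _≡_ _≡_ f
  surjective⇒injective {f = f} surj {x} {x′} eq =
    trans (sym (left x)) (trans (cong g eq) (left x′))
    where
    g = λ y → proj₁ (surj y)
    g-inj : Injective _≡_ _≡_ g
    g-inj {y} {y′} e = trans (sym (proj₂ (surj y))) (trans (cong f e) (proj₂ (surj y′)))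
    left : ∀ x → g (f x) ≡ x
    left x with injective⇒surjective g-inj x
    ... | y , refl = cong g (proj₂ (surj y))

  -- The two sizes may agree only propositionally, as q and 1 + 2 H do for the enumeration of F by 𝟘
  -- and the powers of π.
  ∑-reindex : ∀ {m n} → m ≡ n → {f : Fin m → Fin n} → Injective _≡_ _≡_ f →
              ∀ g → ∑ g ≡ ∑ (g ∘ f)
  ∑-reindex refl {f} inj g =
    Sums.sum-permute g (permutation f f⁻¹ right (λ x → inj (right (f x))))
    where
    f⁻¹ = λ y → proj₁ (injective⇒surjective inj y)
    right : ∀ y → f (f⁻¹ y) ≡ y
    right y = proj₂ (injective⇒surjective inj y)

  ∑-+ : ∀ {n} (f g : Fin n → ℤ) → ∑ (λ x → f x ℤ.+ g x) ≡ ∑ f ℤ.+ ∑ g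
  ∑-+ = Sums.∑-distrib-+

  ∑-*ˡ : ∀ {n} c (f : Fin n → ℤ) → ∑ (λ x → c ℤ.* f x) ≡ c ℤ.* ∑ f
  ∑-*ˡ c f = sym (Sums.*-distribˡ-sum c f)

  ∑-*ʳ : ∀ {n} c (f : Fin n → ℤ) → ∑ (λ x → f x ℤ.* c) ≡ ∑ f ℤ.* c
  ∑-*ʳ c f = sym (Sums.*-distribʳ-sum c f)

  ∑-neg : ∀ {n} (f : Fin n → ℤ) → ∑ (λ x → ℤ.- f x) ≡ ℤ.- ∑ f
  ∑-neg f = trans (∑-cong (λ x → sym (ℤ.-1*i≡-i (f x)))) (trans (∑-*ˡ ℤ.-1ℤ f) (ℤ.-1*i≡-i (∑ f)))

  ∑-comm : ∀ {m n} (f : Fin m → Fin n → ℤ) → ∑ (λ x → ∑ (f x)) ≡ ∑ (λ y → ∑ (λ x → f x y))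
  ∑-comm = Sums.∑-comm

  ∑-const : ∀ n c → ∑ {n} (λ _ → c) ≡ + n ℤ.* c
  ∑-const zero c = refl
  ∑-const (suc n) c = trans (cong (ℤ._+_ c) (∑-const n c)) (sym (ℤ.suc-* (+ n) c))

  ∑-zero : ∀ {n} {f : Fin n → ℤ} → (∀ x → f x ≡ 0ℤ) → ∑ f ≡ 0ℤ
  ∑-zero {n} eq = trans (∑-cong eq) (trans (∑-const n 0ℤ) (ℤ.*-zeroʳ (+ n)))

  𝟏 : ∀ {ℓ} {A : Set ℓ} → Dec A → ℤ
  𝟏 (yes _) = 1ℤ
  𝟏 (no _)  = 0ℤ

  𝟏-true : ∀ {ℓ} {A : Set ℓ} (A? : Dec A) → A → 𝟏 A? ≡ 1ℤ
  𝟏-true (yes _) _ = refl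
  𝟏-true (no ¬a) a = contradiction a ¬a

  𝟏-false : ∀ {ℓ} {A : Set ℓ} (A? : Dec A) → ¬ A → 𝟏 A? ≡ 0ℤ
  𝟏-false (yes a) ¬a = contradiction a ¬a
  𝟏-false (no _) _ = refl

  𝟏-cong : ∀ {ℓ ℓ′} {A : Set ℓ} {B : Set ℓ′} (A? : Dec A) (B? : Dec B) →
           (A → B) → (B → A) → 𝟏 A? ≡ 𝟏 B?
  𝟏-cong (yes a) B? to from = sym (𝟏-true B? (to a))
  𝟏-cong (no ¬a) B? to from = sym (𝟏-false B? (¬a ∘ from))

  ∑-delta : ∀ {n} (a : Fin n) (f : Fin n → ℤ) → ∑ (λ x → 𝟏 (a Fin.≟ x) ℤ.* f x) ≡ f a
  ∑-delta zero f = trans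
    (cong₂ ℤ._+_ (ℤ.*-identityˡ (f zero)) (∑-zero (λ x → ℤ.*-zeroˡ (f (suc x)))))
    (ℤ.+-identityʳ (f zero))
  ∑-delta (suc a) f = trans
    (cong₂ ℤ._+_ (ℤ.*-zeroˡ (f zero))
      (trans (∑-cong (λ x → cong (ℤ._* f (suc x)) (suc≟ x))) (∑-delta a (f ∘ suc))))
    (ℤ.+-identityˡ (f (suc a)))
    where
    suc≟ : ∀ x → 𝟏 (suc a Fin.≟ suc x) ≡ 𝟏 (a Fin.≟ x)
    suc≟ x = 𝟏-cong (suc a Fin.≟ suc x) (a Fin.≟ x) Fin.suc-injective (cong suc)

  ∑-singleton : ∀ {n} (a : Fin n) → ∑ (λ x → 𝟏 (a Fin.≟ x)) ≡ 1ℤ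
  ∑-singleton a = trans (∑-cong (λ x → sym (ℤ.*-identityʳ (𝟏 (a Fin.≟ x))))) (∑-delta a (λ _ → 1ℤ))

  ∑-fibres : ∀ {n r} (g : Fin n → Fin r) (f : Fin r → ℤ) →
             ∑ (f ∘ g) ≡ ∑ (λ s → ∑ (λ x → 𝟏 (g x Fin.≟ s)) ℤ.* f s)
  ∑-fibres g f = begin
    ∑ (f ∘ g)                                        ≡⟨ ∑-cong (λ x → ∑-delta (g x) f) ⟨
    ∑ (λ x → ∑ (λ s → 𝟏 (g x Fin.≟ s) ℤ.* f s))      ≡⟨ ∑-comm (λ x s → 𝟏 (g x Fin.≟ s) ℤ.* f s) ⟩
    ∑ (λ s → ∑ (λ x → 𝟏 (g x Fin.≟ s) ℤ.* f s))      ≡⟨ ∑-cong (λ s → ∑-*ʳ (f s) (λ x → 𝟏 (g x Fin.≟ s))) ⟩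
    ∑ (λ s → ∑ (λ x → 𝟏 (g x Fin.≟ s)) ℤ.* f s)      ∎
    where open ≡-Reasoning

  ∑-mono : ∀ {n} {f g : Fin n → ℤ} → (∀ x → f x ℤ.≤ g x) → ∑ f ℤ.≤ ∑ g
  ∑-mono {zero} f≤g = ℤ.≤-refl
  ∑-mono {suc n} f≤g = ℤ.+-mono-≤ (f≤g zero) (∑-mono (f≤g ∘ suc))

  -- Turns an upper bound at every index into an exact value once the totals are known; this is how
  -- the square classes are counted.
  ∑-tight : ∀ {n} {f g : Fin n → ℤ} → (∀ x → f x ℤ.≤ g x) → ∑ f ≡ ∑ g → ∀ x → f x ≡ g x
  ∑-tight {suc n} {f} {g} f≤g eq x = ℤ.≤-antisym (f≤g x) (go x)
    where
    rest : ∑ (g ∘ suc) ℤ.≤ ∑ (f ∘ suc)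
    rest = ℤ.≮⇒≥ λ lt → ℤ.<⇒≢ (ℤ.+-mono-≤-< (f≤g zero) lt) eq
    head : g zero ℤ.≤ f zero
    head = ℤ.≮⇒≥ λ lt → ℤ.<⇒≢ (ℤ.+-mono-<-≤ lt (∑-mono (f≤g ∘ suc))) eq
    go : ∀ x → g x ℤ.≤ f x
    go zero = head
    go (suc x) = ℤ.≤-reflexive (sym (∑-tight (f≤g ∘ suc)
      (ℤ.≤-antisym (∑-mono (f≤g ∘ suc)) rest) x))

  ∑-pairs : ∀ H (f : ℕ → ℤ) →
            ∑ {H ℕ.* 2} (f ∘ toℕ) ≡ ∑ {H} (λ s → f (toℕ s ℕ.* 2) ℤ.+ f (suc (toℕ s ℕ.* 2)))
  ∑-pairs zero f = refl
  ∑-pairs (suc H) f = trans (sym (ℤ.+-assoc (f 0) (f 1) _))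
    (cong (ℤ._+_ (f 0 ℤ.+ f 1)) (∑-pairs H (λ t → f (2 ℕ.+ t))))

  ∑-halves : ∀ a b (f : ℕ → ℤ) →
             ∑ {a ℕ.+ b} (f ∘ toℕ) ≡ ∑ {a} (f ∘ toℕ) ℤ.+ ∑ {b} (λ s → f (a ℕ.+ toℕ s))
  ∑-halves zero b f = sym (ℤ.+-identityˡ _)
  ∑-halves (suc a) b f = trans (cong (ℤ._+_ (f 0)) (∑-halves a b (f ∘ suc))) (sym (ℤ.+-assoc (f 0) _ _))

open Counting

-- A ring solver with coefficients in ℤ, where equality is decidable, for an arbitrary commutative
-- ring. The chosen multiple makes `⟦ 1ℤ ⟧` reduce to `1#`, so `con 1ℤ` matches the unit of the ring
-- definitionally.
module IntegerSolver {c ℓ} (R : CommutativeRing c ℓ) where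
  open CommutativeRing R renaming (refl to ≈-refl; sym to ≈-sym; trans to ≈-trans)
  open Algebra.Properties.Ring ring
  open Algebra.Properties.Semiring.Mult.TCOptimised semiring
    using (×-homo-+; ×1-homo-*; 1+×) renaming (_×_ to _·_)
  open import Relation.Binary.Reasoning.Setoid setoid

  private
    ⟦_⟧ : ℤ → Carrier
    ⟦ + n ⟧      = n · 1#
    ⟦ -[1+ n ] ⟧ = - (suc n · 1#)

    cancel : ∀ a x y → (a + x) - (a + y) ≈ x - y
    cancel a x y = begin
      (a + x) - (a + y)      ≈⟨ +-congˡ (-‿+-comm a y) ⟨
      (a + x) + (- a + - y)  ≈⟨ +-congʳ (+-comm a x) ⟩
      (x + a) + (- a + - y)  ≈⟨ +-assoc x a _ ⟩
      x + (a + (- a + - y))  ≈⟨ +-congˡ (+-assoc a (- a) (- y)) ⟨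
      x + ((a - a) + - y)    ≈⟨ +-congˡ (+-congʳ (-‿inverseʳ a)) ⟩
      x + (0# + - y)         ≈⟨ +-congˡ (+-identityˡ (- y)) ⟩
      x - y                  ∎

    ⊖-homo : ∀ m n → ⟦ m ℤ.⊖ n ⟧ ≈ m · 1# - n · 1#
    ⊖-homo m zero = ≈-sym (≈-trans (+-congˡ -0#≈0#) (+-identityʳ _))
    ⊖-homo zero (suc n) = ≈-sym (+-identityˡ _)
    ⊖-homo (suc m) (suc n) = begin
      ⟦ suc m ℤ.⊖ suc n ⟧        ≡⟨ cong ⟦_⟧ (ℤ.[1+m]⊖[1+n]≡m⊖n m n) ⟩
      ⟦ m ℤ.⊖ n ⟧                ≈⟨ ⊖-homo m n ⟩
      m · 1# - n · 1#            ≈⟨ cancel 1# (m · 1#) (n · 1#) ⟨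
      (1# + m · 1#) - (1# + n · 1#)
        ≈⟨ +-cong (1+× m 1#) (-‿cong (1+× n 1#)) ⟨
      suc m · 1# - suc n · 1#    ∎

    neg-homo : ∀ i → ⟦ ℤ.- i ⟧ ≈ - ⟦ i ⟧
    neg-homo (+ zero) = ≈-sym -0#≈0#
    neg-homo (+ suc n) = ≈-refl
    neg-homo -[1+ n ] = ≈-sym (-‿involutive _)

    +-homo : ∀ i j → ⟦ i ℤ.+ j ⟧ ≈ ⟦ i ⟧ + ⟦ j ⟧
    +-homo (+ m) (+ n) = ×-homo-+ 1# m n
    +-homo (+ m) -[1+ n ] = ⊖-homo m (suc n)
    +-homo -[1+ m ] (+ n) = ≈-trans (⊖-homo n (suc m)) (+-comm _ _)
    +-homo -[1+ m ] -[1+ n ] = begin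
      - (suc (suc (m ℕ.+ n)) · 1#)       ≡⟨ cong (λ t → - (suc t · 1#)) (ℕ.+-suc m n) ⟨
      - ((suc m ℕ.+ suc n) · 1#)         ≈⟨ -‿cong (×-homo-+ 1# (suc m) (suc n)) ⟩
      - (suc m · 1# + suc n · 1#)        ≈⟨ -‿+-comm _ _ ⟨
      - (suc m · 1#) + - (suc n · 1#)    ∎

    pos-* : ∀ m n → ⟦ + m ℤ.* + n ⟧ ≈ ⟦ + m ⟧ * ⟦ + n ⟧
    pos-* m n = ≈-trans (reflexive (cong ⟦_⟧ (sym (ℤ.pos-* m n)))) (×1-homo-* m n)

    *-homo : ∀ i j → ⟦ i ℤ.* j ⟧ ≈ ⟦ i ⟧ * ⟦ j ⟧
    *-homo (+ m) (+ n) = pos-* m n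
    *-homo (+ m) -[1+ n ] = begin
      ⟦ + m ℤ.* (ℤ.- + suc n) ⟧    ≡⟨ cong ⟦_⟧ (ℤ.neg-distribʳ-* (+ m) (+ suc n)) ⟨
      ⟦ ℤ.- (+ m ℤ.* + suc n) ⟧    ≈⟨ neg-homo (+ m ℤ.* + suc n) ⟩
      - ⟦ + m ℤ.* + suc n ⟧        ≈⟨ -‿cong (pos-* m (suc n)) ⟩
      - (⟦ + m ⟧ * ⟦ + suc n ⟧)    ≈⟨ -‿distribʳ-* _ _ ⟩
      ⟦ + m ⟧ * - ⟦ + suc n ⟧      ∎
    *-homo -[1+ m ] (+ n) = begin
      ⟦ (ℤ.- + suc m) ℤ.* + n ⟧    ≡⟨ cong ⟦_⟧ (ℤ.neg-distribˡ-* (+ suc m) (+ n)) ⟨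
      ⟦ ℤ.- (+ suc m ℤ.* + n) ⟧    ≈⟨ neg-homo (+ suc m ℤ.* + n) ⟩
      - ⟦ + suc m ℤ.* + n ⟧        ≈⟨ -‿cong (pos-* (suc m) n) ⟩
      - (⟦ + suc m ⟧ * ⟦ + n ⟧)    ≈⟨ -‿distribˡ-* _ _ ⟩
      - ⟦ + suc m ⟧ * ⟦ + n ⟧      ∎
    *-homo -[1+ m ] -[1+ n ] = begin
      ⟦ + suc m ℤ.* + suc n ⟧        ≈⟨ pos-* (suc m) (suc n) ⟩
      ⟦ + suc m ⟧ * ⟦ + suc n ⟧      ≈⟨ -‿involutive _ ⟨
      - - (⟦ + suc m ⟧ * ⟦ + suc n ⟧) ≈⟨ -‿cong (-‿distribˡ-* _ _) ⟩
      - (- ⟦ + suc m ⟧ * ⟦ + suc n ⟧) ≈⟨ -‿distribʳ-* _ _ ⟩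
      - ⟦ + suc m ⟧ * - ⟦ + suc n ⟧  ∎

    ℤ-rawRing : RawRing 0ℓ 0ℓ
    ℤ-rawRing = CommutativeRing.rawRing ℤ.+-*-commutativeRing

    ℤ⟶R : ℤ-rawRing ACR.-Raw-AlmostCommutative⟶ ACR.fromCommutativeRing R
    ℤ⟶R = record
      { ⟦_⟧ = ⟦_⟧ ; +-homo = +-homo ; *-homo = *-homo ; -‿homo = neg-homo
      ; 0-homo = ≈-refl ; 1-homo = ≈-refl }

    _≟ᶜ_ : ∀ i j → Maybe (⟦ i ⟧ ≈ ⟦ j ⟧)
    i ≟ᶜ j with i ℤ.≟ j
    ... | yes i≡j = just (reflexive (cong ⟦_⟧ i≡j))
    ... | no _ = nothing

  open Algebra.Solver.Ring ℤ-rawRing (ACR.fromCommutativeRing R) ℤ⟶R _≟ᶜ_ public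
    using (solve; con; _:+_; _:*_; _:-_; :-_; _:^_; _:=_; Polynomial)

-- Fields carried by Fin n

record FinField (n : ℕ) : Set where
  infixl 6 _⊕_
  infixl 7 _⊗_
  infix 8 ⊖_
  field
    _⊕_ _⊗_ : Fin n → Fin n → Fin n
    ⊖_ : Fin n → Fin n
    𝟘 𝟙 : Fin n
    isCommutativeRing : IsCommutativeRing _≡_ _⊕_ _⊗_ ⊖_ 𝟘 𝟙
    𝟘≢𝟙 : 𝟘 ≢ 𝟙
    inverse : ∀ x → x ≢ 𝟘 → ∃ λ y → x ⊗ y ≡ 𝟙

  commutativeRing : CommutativeRing 0ℓ 0ℓ
  commutativeRing = record { isCommutativeRing = isCommutativeRing }

  open CommutativeRing commutativeRing public
    using (ring; semiring; commutativeSemiring; +-assoc; +-comm; +-identityˡ; +-identityʳ;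
           *-assoc; *-comm; *-identityˡ; *-identityʳ; distribˡ; distribʳ; zeroˡ; zeroʳ;
           -‿inverseˡ; -‿inverseʳ)
  open Algebra.Properties.Semiring.Exp semiring public
    using (^-homo-*; ^-assocʳ) renaming (_^_ to _↑_)
  open Algebra.Properties.CommutativeSemiring.Exp commutativeSemiring public
    using (^-distrib-*)
  open Algebra.Properties.Ring ring public
    using (-0#≈0#; -‿involutive; -‿injective; +-cancelˡ; +-cancelʳ; x∙y⁻¹≈ε⇒x≈y; +-inverseˡ-unique)
  open IntegerSolver commutativeRing public

  open ≡-Reasoning

  *-cancelˡ : ∀ x {y z} → x ≢ 𝟘 → x ⊗ y ≡ x ⊗ z → y ≡ z
  *-cancelˡ x {y} {z} x≢𝟘 eq with inverse x x≢𝟘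
  ... | x⁻¹ , inv = begin
    y                 ≡⟨ undo y ⟨
    x⁻¹ ⊗ (x ⊗ y)     ≡⟨ cong (x⁻¹ ⊗_) eq ⟩
    x⁻¹ ⊗ (x ⊗ z)     ≡⟨ undo z ⟩
    z                 ∎
    where
    undo : ∀ w → x⁻¹ ⊗ (x ⊗ w) ≡ w
    undo w = trans (sym (*-assoc x⁻¹ x w))
      (trans (cong (_⊗ w) (trans (*-comm x⁻¹ x) inv)) (*-identityˡ w))

  *-cancelʳ : ∀ x {y z} → x ≢ 𝟘 → y ⊗ x ≡ z ⊗ x → y ≡ z
  *-cancelʳ x {y} {z} x≢𝟘 eq = *-cancelˡ x x≢𝟘 (trans (*-comm x y) (trans eq (*-comm z x)))

  integral : ∀ x y → x ⊗ y ≡ 𝟘 → x ≡ 𝟘 ⊎ y ≡ 𝟘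
  integral x y xy≡𝟘 with x Fin.≟ 𝟘
  ... | yes x≡𝟘 = inj₁ x≡𝟘
  ... | no x≢𝟘 = inj₂ (*-cancelˡ x x≢𝟘 (trans xy≡𝟘 (sym (zeroʳ x))))

  *-nonzero : ∀ {x y} → x ≢ 𝟘 → y ≢ 𝟘 → x ⊗ y ≢ 𝟘
  *-nonzero {x} {y} x≢𝟘 y≢𝟘 eq with integral x y eq
  ... | inj₁ x≡𝟘 = x≢𝟘 x≡𝟘
  ... | inj₂ y≡𝟘 = y≢𝟘 y≡𝟘

  ↑-nonzero : ∀ {x} n → x ≢ 𝟘 → x ↑ n ≢ 𝟘
  ↑-nonzero zero x≢𝟘 eq = 𝟘≢𝟙 (sym eq)
  ↑-nonzero (suc n) x≢𝟘 = *-nonzero x≢𝟘 (↑-nonzero n x≢𝟘)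

  𝟙↑ : ∀ n → 𝟙 ↑ n ≡ 𝟙
  𝟙↑ zero = refl
  𝟙↑ (suc n) = trans (*-identityˡ _) (𝟙↑ n)

  𝟘↑ : ∀ n → .{{ℕ.NonZero n}} → 𝟘 ↑ n ≡ 𝟘
  𝟘↑ (suc n) = zeroˡ _

  ↑-one : ∀ x → x ↑ 1 ≡ x
  ↑-one = *-identityʳ

  neg-nonzero : ∀ {x} → x ≢ 𝟘 → ⊖ x ≢ 𝟘
  neg-nonzero {x} x≢𝟘 eq = x≢𝟘 (-‿injective (trans eq (sym -0#≈0#)))

  sub≡𝟘⇒≡ : ∀ {x y} → x ⊕ ⊖ y ≡ 𝟘 → x ≡ y
  sub≡𝟘⇒≡ {x} {y} = x∙y⁻¹≈ε⇒x≈y x y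

  squares-equal : ∀ {x y} → x ⊗ x ≡ y ⊗ y → x ≡ y ⊎ x ≡ ⊖ y
  squares-equal {x} {y} eq with integral (x ⊕ ⊖ y) (x ⊕ y)
    (trans (solve 2 (λ x y → (x :+ (:- y)) :* (x :+ y) := x :* x :+ (:- (y :* y))) refl x y)
      (trans (cong (_⊕ ⊖ (y ⊗ y)) eq) (-‿inverseʳ (y ⊗ y))))
  ... | inj₁ x-y≡𝟘 = inj₁ (sub≡𝟘⇒≡ x-y≡𝟘)
  ... | inj₂ x+y≡𝟘 = inj₂ (+-inverseˡ-unique x y x+y≡𝟘)

-- Binomial coefficients modulo a prime, and elementary theory of finite fields

module Binomials where
  open ≡-Reasoning

  -- The absorption identity, by induction through Pascal's rule.
  [1+k]*[1+n]C[1+k] : ∀ n k → suc k ℕ.* (suc n C suc k) ≡ suc n ℕ.* (n C k)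
  [1+k]*[1+n]C[1+k] zero zero = refl
  [1+k]*[1+n]C[1+k] zero (suc k) = ℕ.*-zeroʳ k
  [1+k]*[1+n]C[1+k] (suc n) zero = trans (ℕ.*-identityˡ (suc (suc n) C 1))
    (trans (nC1≡n (suc (suc n))) (sym (ℕ.*-identityʳ (suc (suc n)))))
  [1+k]*[1+n]C[1+k] (suc n) (suc k) = begin
    (2 ℕ.+ k) ℕ.* (suc (suc n) C suc (suc k))
      ≡⟨ cong (ℕ._*_ (2 ℕ.+ k)) (nCk+nC[k+1]≡[n+1]C[k+1] (suc n) (suc k)) ⟨
    (2 ℕ.+ k) ℕ.* (x ℕ.+ (suc n C suc (suc k)))
      ≡⟨ ℕ.*-distribˡ-+ (2 ℕ.+ k) x (suc n C suc (suc k)) ⟩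
    (2 ℕ.+ k) ℕ.* x ℕ.+ (2 ℕ.+ k) ℕ.* (suc n C suc (suc k))
      ≡⟨ cong₂ ℕ._+_ (cong (ℕ._+_ x) ([1+k]*[1+n]C[1+k] n k)) ([1+k]*[1+n]C[1+k] n (suc k)) ⟩
    x ℕ.+ suc n ℕ.* (n C k) ℕ.+ suc n ℕ.* (n C suc k)
      ≡⟨ ℕ.+-assoc x _ _ ⟩
    x ℕ.+ (suc n ℕ.* (n C k) ℕ.+ suc n ℕ.* (n C suc k))
      ≡⟨ cong (ℕ._+_ x) (ℕ.*-distribˡ-+ (suc n) (n C k) (n C suc k)) ⟨
    x ℕ.+ suc n ℕ.* ((n C k) ℕ.+ (n C suc k))
      ≡⟨ cong (λ z → x ℕ.+ suc n ℕ.* z) (nCk+nC[k+1]≡[n+1]C[k+1] n k) ⟩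
    x ℕ.+ suc n ℕ.* x ∎
    where x = suc n C suc k

  -- By absorption p divides the product of k + 1 and the binomial coefficient, and k + 1 < p is too
  -- small to be divisible by p.
  prime∣binomial : ∀ {p} → Prime p → ∀ k → suc k < p → p ∣ (p C suc k)
  prime∣binomial {suc n} p-prime k k<p
    with euclidsLemma (suc k) (suc n C suc k) p-prime
           (divides (n C k) (trans ([1+k]*[1+n]C[1+k] n k) (ℕ.*-comm (suc n) (n C k))))
  ... | inj₁ p∣k = contradiction (∣⇒≤ p∣k) (ℕ.<⇒≱ k<p)
  ... | inj₂ p∣C = p∣C

module FieldTheory {n} (F : FinField n) where
  open FinField F
  open ≡-Reasoning
  open Algebra.Properties.Semiring.Mult semiring public
    using (×-assocˡ) renaming (_×_ to _·_)
  private
    module Sums = Algebra.Properties.Semiring.Sum semiring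
    module Prod = Algebra.Properties.CommutativeMonoid.Sum
      (CommutativeRing.*-commutativeMonoid commutativeRing)
    Sum Prod : (Fin n → Fin n) → Fin n
    Sum = Sums.sum
    Prod = Prod.sum

  -- Translating the summation variable of Σ x by a shows n a = 0.
  order-annihilates : ∀ a → n · a ≡ 𝟘
  order-annihilates a = +-cancelˡ (Sum λ x → x) (n · a) 𝟘 (begin
    Sum (λ x → x) ⊕ n · a               ≡⟨ cong (Sum (λ x → x) ⊕_) (Sums.sum-replicate n) ⟨
    Sum (λ x → x) ⊕ Sum (λ _ → a)       ≡⟨ Sums.∑-distrib-+ (λ x → x) (λ _ → a) ⟨
    Sum (λ x → x ⊕ a)                   ≡⟨ Sums.sum-permute (λ x → x) translation ⟨
    Sum (λ x → x)                       ≡⟨ +-identityʳ _ ⟨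
    Sum (λ x → x) ⊕ 𝟘                   ∎)
    where
    translation : Permutation n n
    translation = permutation (_⊕ a) (_⊕ ⊖ a)
      (λ x → solve 2 (λ x a → (x :+ (:- a)) :+ a := x) refl x a)
      (λ x → solve 2 (λ x a → (x :+ a) :+ (:- a) := x) refl x a)

  -- Replacing the factor at 𝟘 by 𝟙 lets a product over the nonzero elements run over all of
  -- `Fin n`.
  nonzeroPart : Fin n → Fin n → Fin n
  nonzeroPart c y with y Fin.≟ 𝟘
  ... | yes _ = 𝟙
  ... | no _ = c

  private
    pick : ∀ {r} → Fin r → Fin n → Fin r → Fin n
    pick zero c zero = 𝟙
    pick zero c (suc j) = c
    pick (suc i) c zero = c
    pick (suc i) c (suc j) = pick i c j

    pick-≡ : ∀ {r} (i : Fin r) c → pick i c i ≡ 𝟙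
    pick-≡ zero c = refl
    pick-≡ (suc i) c = pick-≡ i c

    pick-≢ : ∀ {r} (i j : Fin r) c → j ≢ i → pick i c j ≡ c
    pick-≢ zero zero c j≢i = contradiction refl j≢i
    pick-≢ zero (suc j) c j≢i = refl
    pick-≢ (suc i) zero c j≢i = refl
    pick-≢ (suc i) (suc j) c j≢i = pick-≢ i j c (j≢i ∘ cong suc)

    -- The extra factor c on the left makes up for the one entry that is 𝟙, so the exponent is r and
    -- no predecessor has to be formed.
    prod-pick : ∀ {r} (i : Fin r) c → c ⊗ Prod.sum (pick i c) ≡ c ↑ r
    prod-pick {suc r} zero c = cong (c ⊗_) (trans (*-identityˡ _) (Prod.sum-replicate r))
    prod-pick (suc i) c = cong (c ⊗_) (prod-pick i c)

    nonzeroPart≡pick : ∀ c y → nonzeroPart c y ≡ pick 𝟘 c y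
    nonzeroPart≡pick c y with y Fin.≟ 𝟘
    ... | yes refl = sym (pick-≡ 𝟘 c)
    ... | no y≢𝟘 = sym (pick-≢ 𝟘 y c y≢𝟘)

    nonzeroPart-* : ∀ {x} → x ≢ 𝟘 → ∀ y → nonzeroPart (x ⊗ y) (x ⊗ y) ≡ nonzeroPart x y ⊗ nonzeroPart y y
    nonzeroPart-* {x} x≢𝟘 y with y Fin.≟ 𝟘 | (x ⊗ y) Fin.≟ 𝟘
    ... | yes _ | yes _ = sym (*-identityˡ 𝟙)
    ... | yes refl | no xy≢𝟘 = contradiction (zeroʳ x) xy≢𝟘
    ... | no y≢𝟘 | yes xy≡𝟘 = contradiction xy≡𝟘 (*-nonzero x≢𝟘 y≢𝟘)
    ... | no _ | no _ = refl

    Prod-nonzero : ∀ {r} {f : Fin r → Fin n} → (∀ i → f i ≢ 𝟘) → Prod.sum f ≢ 𝟘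
    Prod-nonzero {zero} f≢𝟘 eq = 𝟘≢𝟙 (sym eq)
    Prod-nonzero {suc r} f≢𝟘 = *-nonzero (f≢𝟘 zero) (Prod-nonzero (f≢𝟘 ∘ suc))

    nonzeroPart-nonzero : ∀ y → nonzeroPart y y ≢ 𝟘
    nonzeroPart-nonzero y with y Fin.≟ 𝟘
    ... | yes _ = 𝟘≢𝟙 ∘ sym
    ... | no y≢𝟘 = y≢𝟘

  -- Multiplying the variable of the product of all nonzero elements by x gives x ^ (n - 1) = 1.
  fermat : ∀ x → x ↑ n ≡ x
  fermat x with x Fin.≟ 𝟘
  ... | yes refl = 𝟘↑ n {{ℕ.>-nonZero (ℕ.≤-<-trans z≤n (Fin.toℕ<n 𝟘))}}
  ... | no x≢𝟘 = begin
    x ↑ n                            ≡⟨ prod-pick 𝟘 x ⟨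
    x ⊗ Prod (pick 𝟘 x)              ≡⟨ cong (x ⊗_) (Prod.sum-cong-≗ (nonzeroPart≡pick x)) ⟨
    x ⊗ Prod (nonzeroPart x)         ≡⟨ cong (x ⊗_) units ⟩
    x ⊗ 𝟙                            ≡⟨ *-identityʳ x ⟩
    x                                ∎
    where
    all = Prod (λ y → nonzeroPart y y)
    x⁻¹ = proj₁ (inverse x x≢𝟘)
    inv : x ⊗ x⁻¹ ≡ 𝟙
    inv = proj₂ (inverse x x≢𝟘)
    scaling : Permutation n n
    scaling = permutation (x ⊗_) (x⁻¹ ⊗_)
      (λ y → trans (sym (*-assoc x x⁻¹ y)) (trans (cong (_⊗ y) inv) (*-identityˡ y)))
      (λ y → trans (sym (*-assoc x⁻¹ x y)) (trans (cong (_⊗ y) (trans (*-comm x⁻¹ x) inv)) (*-identityˡ y)))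
    units : Prod (nonzeroPart x) ≡ 𝟙
    units = *-cancelʳ all (Prod-nonzero nonzeroPart-nonzero) (begin
      Prod (nonzeroPart x) ⊗ all                              ≡⟨ Prod.∑-distrib-+ (nonzeroPart x) (λ y → nonzeroPart y y) ⟨
      Prod (λ y → nonzeroPart x y ⊗ nonzeroPart y y)          ≡⟨ Prod.sum-cong-≗ (nonzeroPart-* x≢𝟘) ⟨
      Prod (λ y → nonzeroPart (x ⊗ y) (x ⊗ y))                ≡⟨ Prod.sum-permute (λ y → nonzeroPart y y) scaling ⟨
      all                                                     ≡⟨ *-identityˡ all ⟨
      𝟙 ⊗ all                                                 ∎)

  freshman : ∀ {p} → Prime p → (∀ x → p · x ≡ 𝟘) → ∀ x y → (x ⊕ y) ↑ p ≡ x ↑ p ⊕ y ↑ p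
  freshman {zero} p-prime char x y = contradiction refl (ℕ.≢-nonZero⁻¹ 0 {{prime⇒nonZero p-prime}})
  freshman {suc r} p-prime char x y = begin
    (x ⊕ y) ↑ suc r                                  ≡⟨ Binomial.theorem (suc r) x y ⟩
    term zero ⊕ Sums.sum {suc r} (term ∘ suc)         ≡⟨ cong₂ _⊕_ first (trans (Sums.sum-init-last {r} (term ∘ suc)) (cong₂ _⊕_ middle last)) ⟩
    y ↑ suc r ⊕ (𝟘 ⊕ x ↑ suc r)                      ≡⟨ solve 2 (λ x y → y :+ (con ℤ.0ℤ :+ x) := x :+ y) refl (x ↑ suc r) (y ↑ suc r) ⟩
    x ↑ suc r ⊕ y ↑ suc r                            ∎
    where

    module Binomial = Algebra.Properties.CommutativeSemiring.Binomial commutativeSemiring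
    term = Binomial.binomialTerm x y (suc r)
    first : term zero ≡ y ↑ suc r
    first = trans (+-identityʳ _) (*-identityˡ _)
    last : term (suc (top r)) ≡ x ↑ suc r
    last = begin
      (suc r C suc (toℕ (top r))) · (x ↑ suc (toℕ (top r)) ⊗ y ↑ (suc r ℕ.∸ suc (toℕ (top r))))
        ≡⟨ cong (λ t → (suc r C suc t) · (x ↑ suc t ⊗ y ↑ (suc r ℕ.∸ suc t))) (Fin.toℕ-fromℕ r) ⟩
      (suc r C suc r) · (x ↑ suc r ⊗ y ↑ (r ℕ.∸ r))
        ≡⟨ cong₂ (λ a b → a · (x ↑ suc r ⊗ y ↑ b)) (nCn≡1 (suc r)) (ℕ.n∸n≡0 r) ⟩
      (x ↑ suc r ⊗ 𝟙) ⊕ 𝟘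
        ≡⟨ trans (+-identityʳ _) (*-identityʳ _) ⟩
      x ↑ suc r ∎
    vanish : ∀ {c} → suc r ∣ c → ∀ z → c · z ≡ 𝟘
    vanish (divides j refl) z = trans (cong (_· z) (ℕ.*-comm j (suc r)))
      (trans (sym (×-assocˡ z (suc r) j)) (char (j · z)))
    middle : Sums.sum {r} (λ i → term (suc (inject₁ i))) ≡ 𝟘
    middle = trans (Sums.sum-cong-≗ λ i → vanish (Binomials.prime∣binomial p-prime (toℕ (inject₁ i))
        (s≤s (subst (_< r) (sym (Fin.toℕ-inject₁ i)) (Fin.toℕ<n i)))) _)
      (Sums.sum-replicate-zero r)

  -- A polynomial function with formal degree d and leading coefficient a, in Horner form.
  data Poly : ℕ → Fin n → (Fin n → Fin n) → Set where
    constant : ∀ {a f} → (∀ x → f x ≡ a) → Poly 0 a f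
    horner   : ∀ {d a f g} c → Poly d a g → (∀ x → f x ≡ x ⊗ g x ⊕ c) → Poly (suc d) a f

  private
    z0 = ℤ.0ℤ

  Poly-cong : ∀ {d a b f g} → a ≡ b → (∀ x → f x ≡ g x) → Poly d a f → Poly d b g
  Poly-cong refl eq (constant e) = constant (λ x → trans (sym (eq x)) (e x))
  Poly-cong refl eq (horner c G e) = horner c G (λ x → trans (sym (eq x)) (e x))

  Poly-+ : ∀ {d a b f g} → Poly d a f → Poly d b g → Poly d (a ⊕ b) (λ x → f x ⊕ g x)
  Poly-+ (constant e) (constant e′) = constant (λ x → cong₂ _⊕_ (e x) (e′ x))
  Poly-+ (horner {g = g} c G e) (horner {g = h} c′ H e′) = horner (c ⊕ c′) (Poly-+ G H) λ x →
    trans (cong₂ _⊕_ (e x) (e′ x))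
      (solve 5 (λ x g h c c′ → (x :* g :+ c) :+ (x :* h :+ c′) := x :* (g :+ h) :+ (c :+ c′))
        refl x (g x) (h x) c c′)

  Poly-* : ∀ {d a f} r → Poly d a f → Poly d (r ⊗ a) (λ x → r ⊗ f x)
  Poly-* r (constant e) = constant (λ x → cong (r ⊗_) (e x))
  Poly-* r (horner {g = g} c G e) = horner (r ⊗ c) (Poly-* r G) λ x →
    trans (cong (r ⊗_) (e x))
      (solve 4 (λ r x g c → r :* (x :* g :+ c) := x :* (r :* g) :+ r :* c) refl r x (g x) c)

  -- The leading coefficient is formal and may be 𝟘; padding in this way allows polynomials of
  -- different degrees to be added.
  Poly-lift₁ : ∀ {d a f} → Poly d a f → Poly (suc d) 𝟘 f
  Poly-lift₁ {a = a} (constant e) = horner a (constant (λ _ → refl)) λ x →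
    trans (e x) (solve 2 (λ x a → a := x :* con z0 :+ a) refl x a)
  Poly-lift₁ (horner c G e) = horner c (Poly-lift₁ G) e

  Poly-lift : ∀ {d e a f} → d < e → Poly d a f → Poly e 𝟘 f
  Poly-lift {d} {suc e} (s≤s d≤e) p with ℕ.m≤n⇒m<n∨m≡n d≤e
  ... | inj₁ d<e = Poly-lift₁ (Poly-lift d<e p)
  ... | inj₂ refl = Poly-lift₁ p

  Poly-↑ : ∀ d → Poly d 𝟙 (_↑ d)
  Poly-↑ zero = constant (λ _ → refl)
  Poly-↑ (suc d) = horner 𝟘 (Poly-↑ d) (λ x → sym (+-identityʳ _))

  -- Synthetic division: for f x = x g x + c the difference f x - f r is (x - r) g x + r (g x - g
  -- r), and the second term is handled by induction. The quotient keeps the leading coefficient.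
  factor : ∀ {d a f} → Poly (suc d) a f → ∀ r →
           ∃ λ h → Poly d a h × (∀ x → f x ⊕ ⊖ f r ≡ (x ⊕ ⊖ r) ⊗ h x)
  factor {zero} {a} {f} (horner {g = g} c (constant e) e′) r =
    (λ _ → a) , constant (λ _ → refl) , λ x → begin
      f x ⊕ ⊖ f r                        ≡⟨ cong₂ (λ u v → u ⊕ ⊖ v) (e′ x) (e′ r) ⟩
      (x ⊗ g x ⊕ c) ⊕ ⊖ (r ⊗ g r ⊕ c)    ≡⟨ cong₂ (λ u v → (x ⊗ u ⊕ c) ⊕ ⊖ (r ⊗ v ⊕ c)) (e x) (e r) ⟩
      (x ⊗ a ⊕ c) ⊕ ⊖ (r ⊗ a ⊕ c)
        ≡⟨ solve 4 (λ x r a c → (x :* a :+ c) :+ (:- (r :* a :+ c)) := (x :+ (:- r)) :* a) refl x r a c ⟩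
      (x ⊕ ⊖ r) ⊗ a ∎
  factor {suc d} {a} {f} (horner {g = g} c G e′) r with factor G r
  ... | h , H , eq = (λ x → g x ⊕ r ⊗ h x) , Poly-cong a≡ (λ _ → refl) (Poly-+ G (Poly-lift₁ (Poly-* r H))) , λ x → begin
      f x ⊕ ⊖ f r                        ≡⟨ cong₂ (λ u v → u ⊕ ⊖ v) (e′ x) (e′ r) ⟩
      (x ⊗ g x ⊕ c) ⊕ ⊖ (r ⊗ g r ⊕ c)
        ≡⟨ solve 5 (λ x r u v c → (x :* u :+ c) :+ (:- (r :* v :+ c)) := (x :+ (:- r)) :* u :+ r :* (u :+ (:- v)))
             refl x r (g x) (g r) c ⟩
      (x ⊕ ⊖ r) ⊗ g x ⊕ r ⊗ (g x ⊕ ⊖ g r)    ≡⟨ cong (λ t → (x ⊕ ⊖ r) ⊗ g x ⊕ r ⊗ t) (eq x) ⟩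
      (x ⊕ ⊖ r) ⊗ g x ⊕ r ⊗ ((x ⊕ ⊖ r) ⊗ h x)
        ≡⟨ solve 4 (λ y r u w → y :* u :+ r :* (y :* w) := y :* (u :+ r :* w)) refl (x ⊕ ⊖ r) r (g x) (h x) ⟩
      (x ⊕ ⊖ r) ⊗ (g x ⊕ r ⊗ h x) ∎
    where
    a≡ : a ⊕ 𝟘 ≡ a
    a≡ = +-identityʳ a

  -- Dividing by the first root leaves the others as roots of the quotient. Knowing that a vanishes
  -- is enough, because the lemma is applied to monic polynomials only, where it is a contradiction.
  root-bound : ∀ {d a f} → Poly d a f → (r : Fin (suc d) → Fin n) → Injective _≡_ _≡_ r →
               (∀ i → f (r i) ≡ 𝟘) → a ≡ 𝟘
  root-bound (constant e) r inj roots = trans (sym (e (r zero))) (roots zero)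
  root-bound {suc d} {f = f} p r inj roots with factor p (r zero)
  ... | h , H , eq = root-bound H (r ∘ suc) (Fin.suc-injective ∘ inj) roots′
    where
    roots′ : ∀ i → h (r (suc i)) ≡ 𝟘
    roots′ i with integral (r (suc i) ⊕ ⊖ r zero) (h (r (suc i)))
      (trans (sym (eq (r (suc i)))) (trans (cong₂ (λ u v → u ⊕ ⊖ v) (roots (suc i)) (roots zero)) (-‿inverseʳ 𝟘)))
    ... | inj₁ e = contradiction (inj (sub≡𝟘⇒≡ e)) λ ()
    ... | inj₂ e = e

  -- If 2 were 𝟘 then 2 h + 1 copies of 𝟙 would add up to 𝟙.
  odd-characteristic : ∀ {h} → suc (h ℕ.+ h) · 𝟙 ≡ 𝟘 → 𝟙 ⊕ 𝟙 ≢ 𝟘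
  odd-characteristic {h} char 2≡𝟘 = 𝟘≢𝟙 (sym (begin
    𝟙                          ≡⟨ +-identityʳ 𝟙 ⟨
    𝟙 ⊕ 𝟘                      ≡⟨ cong (𝟙 ⊕_) (double h) ⟨
    suc (h ℕ.+ h) · 𝟙          ≡⟨ char ⟩
    𝟘                          ∎))
    where
    double : ∀ h → (h ℕ.+ h) · 𝟙 ≡ 𝟘
    double zero = refl
    double (suc h) = trans (cong (λ t → 𝟙 ⊕ t · 𝟙) (ℕ.+-suc h h))
      (trans (sym (+-assoc 𝟙 𝟙 _)) (trans (cong₂ _⊕_ 2≡𝟘 (double h)) (+-identityʳ 𝟘)))

  module OddCharacteristic (2≢𝟘 : 𝟙 ⊕ 𝟙 ≢ 𝟘) where
    double≡𝟘⇒≡𝟘 : ∀ {x} → x ⊕ x ≡ 𝟘 → x ≡ 𝟘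
    double≡𝟘⇒≡𝟘 {x} eq = *-cancelˡ (𝟙 ⊕ 𝟙) 2≢𝟘
      (trans (trans (distribʳ x 𝟙 𝟙) (cong₂ _⊕_ (*-identityˡ x) (*-identityˡ x))) (trans eq (sym (zeroʳ _))))

    self-negative : ∀ {x} → x ≡ ⊖ x → x ≡ 𝟘
    self-negative {x} eq = double≡𝟘⇒≡𝟘 (trans (cong (x ⊕_) eq) (-‿inverseʳ x))

-- The hypotheses of the theorem with m = 2 r + 1, p = 2 h + 1 and both fields carried by Fin, so that ≈ becomes ≡.
record Setting (p h r k : ℕ) : Set where
  field
    p-prime : Prime p
    p-odd : p ≡ suc (h ℕ.+ h)
    1≤r : 1 ≤ r
    coprime : Coprime (suc (r ℕ.+ r)) k
    K : FinField p
    F : FinField (p ^ suc (r ℕ.+ r))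
  module K = FinField K
  open FinField F public
  field
    ι : Fin p → Fin (p ^ suc (r ℕ.+ r))
    ι-+ : ∀ s t → ι (s K.⊕ t) ≡ ι s ⊕ ι t
    ι-* : ∀ s t → ι (s K.⊗ t) ≡ ι s ⊗ ι t
    ι-𝟙 : ι K.𝟙 ≡ 𝟙
    Tr : Fin (p ^ suc (r ℕ.+ r)) → Fin p
    Tr-conjugates : ∀ x → ι (Tr x) ≡
      Algebra.Properties.Semiring.Sum.sum semiring {suc (r ℕ.+ r)} (λ i → x ↑ (p ^ toℕ i))
    π : Fin (p ^ suc (r ℕ.+ r))
    π-nonzero : π ≢ 𝟘
    π-generates : ∀ x → x ≢ 𝟘 → ∃ λ t → x ≡ π ↑ t

-- In p a² + b² = pⁿ with n > 0, p divides b; dividing by p exchanges the roles of a and b.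
module Descent {p : ℕ} (p-prime : Prime p) where
  private
    instance
      p-nonZero : ℕ.NonZero p
      p-nonZero = prime⇒nonZero p-prime

  square-injective : ∀ a b → a ℕ.* a ≡ b ℕ.* b → a ≡ b
  square-injective a b eq with ℕ.<-cmp a b
  ... | tri< a<b _ _ = contradiction eq (ℕ.<⇒≢ (ℕ.*-mono-< a<b a<b))
  ... | tri≈ _ a≡b _ = a≡b
  ... | tri> _ _ b<a = contradiction (sym eq) (ℕ.<⇒≢ (ℕ.*-mono-< b<a b<a))

  private
    step : ∀ a b n → p ℕ.* (a ℕ.* a) ℕ.+ b ℕ.* b ≡ p ℕ.* n →
           ∃ λ b₁ → p ℕ.* (b₁ ℕ.* b₁) ℕ.+ a ℕ.* a ≡ n
    step a b n eq with p∣b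
      where
      p∣b² : p ∣ b ℕ.* b
      p∣b² = ∣m+n∣m⇒∣n (subst (p ∣_) (sym eq) (m∣m*n n)) (m∣m*n (a ℕ.* a))
      p∣b : p ∣ b
      p∣b with euclidsLemma b b p-prime p∣b²
      ... | inj₁ d = d
      ... | inj₂ d = d
    ... | divides b₁ refl = b₁ , ℕ.*-cancelˡ-≡ _ _ p
      (trans (rearrange p a b₁) eq)
      where
      rearrange : ∀ p a b₁ → p ℕ.* (p ℕ.* (b₁ ℕ.* b₁) ℕ.+ a ℕ.* a)
                           ≡ p ℕ.* (a ℕ.* a) ℕ.+ b₁ ℕ.* p ℕ.* (b₁ ℕ.* p)
      rearrange = ℕ-solve-∀

  -- Every step lowers the exponent by one and swaps the two unknowns, so the parity of the exponent
  -- decides whether the weight p ends up on the unknown that survives. The two statements therefore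
  -- call each other.
  descent-even : ∀ j a b → p ℕ.* (a ℕ.* a) ℕ.+ b ℕ.* b ≡ p ^ (j ℕ.+ j) → a ≡ 0
  descent-odd : ∀ j a b → p ℕ.* (a ℕ.* a) ℕ.+ b ℕ.* b ≡ p ^ suc (j ℕ.+ j) → a ≡ p ^ j

  descent-even zero zero b eq = refl
  descent-even zero (suc a) b eq = contradiction
    (ℕ.≤-trans (ℕ.≤-trans (ℕ.nonTrivial⇒n>1 p {{prime⇒nonTrivial p-prime}})
      (ℕ.m≤m*n p (suc a ℕ.* suc a))) (ℕ.m≤m+n _ (b ℕ.* b)))
    (ℕ.<⇒≱ (s≤s (ℕ.≤-reflexive eq)))
  descent-even (suc j) a b eq with step a b _ (trans eq (cong (λ n → p ^ suc n) (ℕ.+-suc j j)))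
  ... | b₁ , eq₁ with descent-odd j b₁ a eq₁
  ...   | refl = square-zero a (ℕ.+-cancelˡ-≡ (p ℕ.* (p ^ j ℕ.* p ^ j)) _ _
    (trans eq₁ (trans (cong (ℕ._*_ p) (ℕ.^-distribˡ-+-* p j j)) (sym (ℕ.+-identityʳ _)))))
    where
    square-zero : ∀ a → a ℕ.* a ≡ 0 → a ≡ 0
    square-zero zero _ = refl
  descent-odd j a b eq with step a b _ eq
  ... | b₁ , eq₁ with descent-even j b₁ a eq₁
  ...   | refl = square-injective a (p ^ j)
    (trans (cong (ℕ._+ a ℕ.* a) (sym (ℕ.*-zeroʳ p))) (trans eq₁ (ℕ.^-distribˡ-+-* p j j)))

module CountingImages where
  count-image : ∀ {N n ℓ} {A : Fin n → Set ℓ} (A? : ∀ x → Dec (A x)) (f : Fin N → Fin n) →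
                Injective _≡_ _≡_ f → (∀ i → A (f i)) → (∀ x → A x → ∃ λ i → f i ≡ x) →
                ∑ (λ x → 𝟏 (A? x)) ≡ + N
  count-image {N} A? f inj sound complete = begin
    ∑ (λ x → 𝟏 (A? x))                          ≡⟨ ∑-cong pointwise ⟩
    ∑ (λ x → ∑ (λ i → 𝟏 (f i Fin.≟ x)))         ≡⟨ ∑-comm (λ i x → 𝟏 (f i Fin.≟ x)) ⟨
    ∑ (λ i → ∑ (λ x → 𝟏 (f i Fin.≟ x)))         ≡⟨ ∑-cong (λ i → ∑-singleton (f i)) ⟩
    ∑ {N} (λ _ → 1ℤ)                            ≡⟨ ∑-const N 1ℤ ⟩
    + N ℤ.* 1ℤ                                  ≡⟨ ℤ.*-identityʳ (+ N) ⟩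
    + N                                         ∎
    where
    open ≡-Reasoning
    pointwise : ∀ x → 𝟏 (A? x) ≡ ∑ (λ i → 𝟏 (f i Fin.≟ x))
    pointwise x with A? x
    ... | no ¬Ax = sym (∑-zero λ i → 𝟏-false (f i Fin.≟ x) λ { refl → ¬Ax (sound i) })
    ... | yes Ax with complete x Ax
    ...   | i₀ , refl = sym (trans (∑-cong λ i → 𝟏-cong (f i Fin.≟ f i₀) (i₀ Fin.≟ i) (sym ∘ inj) (cong f ∘ sym))
                          (∑-singleton i₀))

-- Square classes in a field of odd characteristic

module Squares {n : ℕ} (F : FinField n) (2≢𝟘 : FinField._⊕_ F (FinField.𝟙 F) (FinField.𝟙 F) ≢ FinField.𝟘 F) where
  open FinField F
  open FieldTheory F using (module OddCharacteristic)
  open OddCharacteristic 2≢𝟘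
  open ≡-Reasoning

  -- Squaring identifies 1 and - 1, so it is not onto.
  nonsquare : ∃ λ g → ∀ x → x ⊗ x ≢ g
  nonsquare with Fin.any? (λ g → ¬? (Fin.any? (λ x → (x ⊗ x) Fin.≟ g)))
  ... | yes (g , nonsq) = g , λ x eq → nonsq (x , eq)
  ... | no all-squares = contradiction
    (self-negative (surjective⇒injective {f = λ x → x ⊗ x} surj
      (solve 1 (λ x → x :* x := (:- x) :* (:- x)) refl 𝟙)))
    (𝟘≢𝟙 ∘ sym)
    where
    surj : ∀ y → ∃ λ x → x ⊗ x ≡ y
    surj y with Fin.any? (λ x → (x ⊗ x) Fin.≟ y)
    ... | yes found = found
    ... | no missed = contradiction (y , missed) all-squares

  private
    square≡𝟘 : ∀ {x} → x ⊗ x ≡ 𝟘 → x ≡ 𝟘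
    square≡𝟘 {x} eq with integral x x eq
    ... | inj₁ e = e
    ... | inj₂ e = e

  g : Fin n
  g = proj₁ nonsquare

  g-nonzero : g ≢ 𝟘
  g-nonzero g≡𝟘 = proj₂ nonsquare 𝟘 (trans (zeroˡ 𝟘) (sym g≡𝟘))

  private
    roots : Fin n → Fin n → ℤ
    roots a s = ∑ (λ x → 𝟏 ((a ⊗ (x ⊗ x)) Fin.≟ s))

    roots-≤2 : ∀ {a} → a ≢ 𝟘 → ∀ s x₀ → a ⊗ (x₀ ⊗ x₀) ≡ s → roots a s ℤ.≤ + 2
    roots-≤2 {a} a≢𝟘 s x₀ eq₀ = ℤ.≤-trans (∑-mono bound) (ℤ.≤-reflexive (trans
      (∑-+ (λ x → 𝟏 (x₀ Fin.≟ x)) (λ x → 𝟏 ((⊖ x₀) Fin.≟ x)))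
      (cong₂ ℤ._+_ (∑-singleton x₀) (∑-singleton (⊖ x₀)))))
      where
      bound : ∀ x → 𝟏 ((a ⊗ (x ⊗ x)) Fin.≟ s) ℤ.≤ 𝟏 (x₀ Fin.≟ x) ℤ.+ 𝟏 ((⊖ x₀) Fin.≟ x)
      bound x with (a ⊗ (x ⊗ x)) Fin.≟ s | x₀ Fin.≟ x | (⊖ x₀) Fin.≟ x
      ... | no _ | yes _ | yes _ = ℤ.+≤+ z≤n
      ... | no _ | yes _ | no _ = ℤ.+≤+ z≤n
      ... | no _ | no _ | yes _ = ℤ.+≤+ z≤n
      ... | no _ | no _ | no _ = ℤ.+≤+ z≤n
      ... | yes _ | yes _ | yes _ = ℤ.+≤+ (s≤s z≤n)
      ... | yes _ | yes _ | no _ = ℤ.+≤+ (s≤s z≤n)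
      ... | yes _ | no _ | yes _ = ℤ.+≤+ (s≤s z≤n)
      ... | yes eq | no x₀≢x | no -x₀≢x with squares-equal {x} {x₀} (*-cancelˡ a a≢𝟘 (trans eq (sym eq₀)))
      ...   | inj₁ x≡x₀ = contradiction (sym x≡x₀) x₀≢x
      ...   | inj₂ x≡-x₀ = contradiction (sym x≡-x₀) -x₀≢x

    roots-𝟘 : ∀ {a} → a ≢ 𝟘 → roots a 𝟘 ≡ 1ℤ
    roots-𝟘 {a} a≢𝟘 = trans (∑-cong λ x → 𝟏-cong ((a ⊗ (x ⊗ x)) Fin.≟ 𝟘) (𝟘 Fin.≟ x) to from) (∑-singleton 𝟘)
      where
      to : ∀ {x} → a ⊗ (x ⊗ x) ≡ 𝟘 → 𝟘 ≡ x
      to eq = sym (square≡𝟘 (*-cancelˡ a a≢𝟘 (trans eq (sym (zeroʳ a)))))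
      from : ∀ {x} → 𝟘 ≡ x → a ⊗ (x ⊗ x) ≡ 𝟘
      from refl = trans (cong (a ⊗_) (zeroˡ 𝟘)) (zeroʳ a)

    roots-none : ∀ a s → (∀ x → a ⊗ (x ⊗ x) ≢ s) → roots a s ≡ 0ℤ
    roots-none a s none = ∑-zero λ x → 𝟏-false ((a ⊗ (x ⊗ x)) Fin.≟ s) (none x)

    𝟙≢𝟘 : 𝟙 ≢ 𝟘
    𝟙≢𝟘 = 𝟘≢𝟙 ∘ sym

    -- A nonzero s cannot be both x² and g y², since then g = (x / y)² would be a square; so at most
    -- one of the two counts is nonzero, and it is at most 2. At 𝟘 both counts are 1.
    coset-≤2 : ∀ s → roots 𝟙 s ℤ.+ roots g s ℤ.≤ + 2
    coset-≤2 s with s Fin.≟ 𝟘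
    ... | yes refl = ℤ.≤-reflexive (cong₂ ℤ._+_ (roots-𝟘 𝟙≢𝟘) (roots-𝟘 g-nonzero))
    ... | no s≢𝟘 with Fin.any? (λ x → (𝟙 ⊗ (x ⊗ x)) Fin.≟ s)
    ...   | yes (x₀ , eq₀) = ℤ.≤-trans
      (ℤ.≤-reflexive (trans (cong (ℤ._+_ (roots 𝟙 s)) (roots-none g s disjoint)) (ℤ.+-identityʳ _)))
      (roots-≤2 𝟙≢𝟘 s x₀ eq₀)
      where
      disjoint : ∀ y → g ⊗ (y ⊗ y) ≢ s
      disjoint y eq with y Fin.≟ 𝟘
      ... | yes refl = s≢𝟘 (trans (sym eq) (trans (cong (g ⊗_) (zeroˡ 𝟘)) (zeroʳ g)))
      ... | no y≢𝟘 with inverse y y≢𝟘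
      ...   | z , yz≡𝟙 = proj₂ nonsquare (x₀ ⊗ z) (begin
        (x₀ ⊗ z) ⊗ (x₀ ⊗ z)        ≡⟨ solve 2 (λ x z → (x :* z) :* (x :* z) := (con 1ℤ :* (x :* x)) :* (z :* z)) refl x₀ z ⟩
        (𝟙 ⊗ (x₀ ⊗ x₀)) ⊗ (z ⊗ z)  ≡⟨ cong (_⊗ (z ⊗ z)) (trans eq₀ (sym eq)) ⟩
        (g ⊗ (y ⊗ y)) ⊗ (z ⊗ z)    ≡⟨ solve 3 (λ g y z → (g :* (y :* y)) :* (z :* z) := g :* ((y :* z) :* (y :* z))) refl g y z ⟩
        g ⊗ ((y ⊗ z) ⊗ (y ⊗ z))    ≡⟨ cong (λ t → g ⊗ (t ⊗ t)) yz≡𝟙 ⟩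
        g ⊗ (𝟙 ⊗ 𝟙)                ≡⟨ solve 1 (λ g → g :* (con 1ℤ :* con 1ℤ) := g) refl g ⟩
        g                          ∎)
    ...   | no none with Fin.any? (λ x → (g ⊗ (x ⊗ x)) Fin.≟ s)
    ...     | yes (x₀ , eq₀) = ℤ.≤-trans
      (ℤ.≤-reflexive (trans (cong (ℤ._+ roots g s) (roots-none 𝟙 s (λ x e → none (x , e)))) (ℤ.+-identityˡ _)))
      (roots-≤2 g-nonzero s x₀ eq₀)
    ...     | no none′ = ℤ.≤-trans
      (ℤ.≤-reflexive (cong₂ ℤ._+_ (roots-none 𝟙 s (λ x e → none (x , e))) (roots-none g s (λ x e → none′ (x , e)))))
      (ℤ.+≤+ z≤n)

    ∑-roots : ∀ a → ∑ (roots a) ≡ + n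
    ∑-roots a = trans (∑-comm (λ s x → 𝟏 ((a ⊗ (x ⊗ x)) Fin.≟ s)))
      (trans (∑-cong (λ x → ∑-singleton (a ⊗ (x ⊗ x)))) (trans (∑-const n 1ℤ) (ℤ.*-identityʳ (+ n))))

    -- That every nonsquare is g times a square comes out of the totals: each of the two maps x ↦ x²
    -- and x ↦ g x² has n arguments, so the counts add up to 2 n and the bound 2 is attained at all
    -- n elements.
    coset-≡2 : ∀ s → roots 𝟙 s ℤ.+ roots g s ≡ + 2
    coset-≡2 = ∑-tight coset-≤2 (begin
      ∑ (λ s → roots 𝟙 s ℤ.+ roots g s)    ≡⟨ ∑-+ (roots 𝟙) (roots g) ⟩
      ∑ (roots 𝟙) ℤ.+ ∑ (roots g)          ≡⟨ cong₂ ℤ._+_ (∑-roots 𝟙) (∑-roots g) ⟩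
      + n ℤ.+ + n                          ≡⟨ double (+ n) ⟩
      + n ℤ.* + 2                          ≡⟨ ∑-const n (+ 2) ⟨
      ∑ {n} (λ _ → + 2)                    ∎)
      where
      double : ∀ x → x ℤ.+ x ≡ x ℤ.* + 2
      double = ℤ-solve-∀

  -- The values x² and g x² together cover every s exactly twice; away from x = 𝟘, f is constantly f
  -- 𝟙 on the former and f g on the latter.
  ∑-square-classes : (f : Fin n → ℤ) → (∀ {x} → x ≢ 𝟘 → ∀ s → f ((x ⊗ x) ⊗ s) ≡ f s) →
    + 2 ℤ.* ∑ f ≡ + 2 ℤ.* f 𝟘 ℤ.+ (+ n ℤ.- 1ℤ) ℤ.* (f 𝟙 ℤ.+ f g)
  ∑-square-classes f invariant = begin
    + 2 ℤ.* ∑ f                                            ≡⟨ ∑-*ˡ (+ 2) f ⟨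
    ∑ (λ s → + 2 ℤ.* f s)                                  ≡⟨ ∑-cong (λ s → cong (ℤ._* f s) (coset-≡2 s)) ⟨
    ∑ (λ s → (roots 𝟙 s ℤ.+ roots g s) ℤ.* f s)            ≡⟨ ∑-cong (λ s → ℤ.*-distribʳ-+ (f s) (roots 𝟙 s) (roots g s)) ⟩
    ∑ (λ s → roots 𝟙 s ℤ.* f s ℤ.+ roots g s ℤ.* f s)      ≡⟨ ∑-+ (λ s → roots 𝟙 s ℤ.* f s) (λ s → roots g s ℤ.* f s) ⟩
    ∑ (λ s → roots 𝟙 s ℤ.* f s) ℤ.+ ∑ (λ s → roots g s ℤ.* f s)
      ≡⟨ cong₂ ℤ._+_ (class 𝟙) (class g) ⟩
    (f 𝟘 ℤ.+ (+ n ℤ.- 1ℤ) ℤ.* f 𝟙) ℤ.+ (f 𝟘 ℤ.+ (+ n ℤ.- 1ℤ) ℤ.* f g)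
      ≡⟨ collect (f 𝟘) (+ n) (f 𝟙) (f g) ⟩
    + 2 ℤ.* f 𝟘 ℤ.+ (+ n ℤ.- 1ℤ) ℤ.* (f 𝟙 ℤ.+ f g) ∎
    where
    collect : ∀ z n a b → (z ℤ.+ (n ℤ.- 1ℤ) ℤ.* a) ℤ.+ (z ℤ.+ (n ℤ.- 1ℤ) ℤ.* b)
                        ≡ + 2 ℤ.* z ℤ.+ (n ℤ.- 1ℤ) ℤ.* (a ℤ.+ b)
    collect = ℤ-solve-∀
    class : ∀ a → ∑ (λ s → roots a s ℤ.* f s) ≡ f 𝟘 ℤ.+ (+ n ℤ.- 1ℤ) ℤ.* f a
    class a = begin
      ∑ (λ s → roots a s ℤ.* f s)          ≡⟨ ∑-fibres (λ x → a ⊗ (x ⊗ x)) f ⟨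
      ∑ (λ x → f (a ⊗ (x ⊗ x)))            ≡⟨ ∑-cong value ⟩
      ∑ (λ x → f a ℤ.+ 𝟏 (𝟘 Fin.≟ x) ℤ.* (f 𝟘 ℤ.- f a))
        ≡⟨ ∑-+ (λ _ → f a) (λ x → 𝟏 (𝟘 Fin.≟ x) ℤ.* (f 𝟘 ℤ.- f a)) ⟩
      ∑ {n} (λ _ → f a) ℤ.+ ∑ (λ x → 𝟏 (𝟘 Fin.≟ x) ℤ.* (f 𝟘 ℤ.- f a))
        ≡⟨ cong₂ ℤ._+_ (∑-const n (f a)) (∑-delta 𝟘 (λ _ → f 𝟘 ℤ.- f a)) ⟩
      + n ℤ.* f a ℤ.+ (f 𝟘 ℤ.- f a)        ≡⟨ arrange (+ n) (f a) (f 𝟘) ⟩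
      f 𝟘 ℤ.+ (+ n ℤ.- 1ℤ) ℤ.* f a         ∎
      where
      arrange : ∀ n a z → n ℤ.* a ℤ.+ (z ℤ.- a) ≡ z ℤ.+ (n ℤ.- 1ℤ) ℤ.* a
      arrange = ℤ-solve-∀
      cancel : ∀ a z → z ≡ a ℤ.+ 1ℤ ℤ.* (z ℤ.- a)
      cancel = ℤ-solve-∀
      value : ∀ x → f (a ⊗ (x ⊗ x)) ≡ f a ℤ.+ 𝟏 (𝟘 Fin.≟ x) ℤ.* (f 𝟘 ℤ.- f a)
      value x with 𝟘 Fin.≟ x
      ... | yes refl = trans (cong f (trans (cong (a ⊗_) (zeroˡ 𝟘)) (zeroʳ a))) (cancel (f a) (f 𝟘))
      ... | no 𝟘≢x = trans (cong f (*-comm a (x ⊗ x))) (trans (invariant (𝟘≢x ∘ sym) a)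
                       (sym (ℤ.+-identityʳ (f a))))

odd-power : ∀ {p h} → p ≡ suc (h ℕ.+ h) → ∀ n → ∃ λ H → p ^ n ≡ suc (H ℕ.+ H)
odd-power p-odd zero = 0 , refl
odd-power {p} {h} p-odd (suc n) with odd-power {h = h} p-odd n
... | H , eq = h ℕ.+ H ℕ.+ 2 ℕ.* (h ℕ.* H) , trans (cong₂ ℕ._*_ p-odd eq) (product h H)
  where
  product : ∀ h H → suc (h ℕ.+ h) ℕ.* suc (H ℕ.+ H) ≡
    suc ((h ℕ.+ H ℕ.+ 2 ℕ.* (h ℕ.* H)) ℕ.+ (h ℕ.+ H ℕ.+ 2 ℕ.* (h ℕ.* H)))
  product = ℕ-solve-∀

-- N₀ is the number of zeros of a quadratic form, 2 a₁ and 2 a₂ its numbers of representations of a nonzero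
-- square and a nonsquare; the hypotheses are Σ N_s = p P and Σ N_s² = p P² + (p - 1) P R, doubled.
module Excess (p P R N₀ a₁ a₂ : ℤ) .{{_ : ℤ.NonZero (p ℤ.- 1ℤ)}}
  (total : + 2 ℤ.* (p ℤ.* P) ≡ + 2 ℤ.* N₀ ℤ.+ (p ℤ.- 1ℤ) ℤ.* (+ 2 ℤ.* a₁ ℤ.+ + 2 ℤ.* a₂))
  (squares : + 2 ℤ.* (p ℤ.* P ℤ.* P ℤ.+ (p ℤ.* P ℤ.- P) ℤ.* R) ≡
    + 2 ℤ.* (N₀ ℤ.* N₀) ℤ.+ (p ℤ.- 1ℤ) ℤ.* ((+ 2 ℤ.* a₁) ℤ.* (+ 2 ℤ.* a₁) ℤ.+ (+ 2 ℤ.* a₂) ℤ.* (+ 2 ℤ.* a₂)))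
  where
  open ≡-Reasoning

  -- These become E and B of the overview: `a` measures how far the two halved counts together
  -- deviate from P, `b` how far they differ from each other.
  a b : ℤ
  a = a₁ ℤ.+ a₂ ℤ.- P
  b = a₁ ℤ.- a₂

  linear : N₀ ≡ P ℤ.- (p ℤ.- 1ℤ) ℤ.* a
  linear = ℤ.*-cancelˡ-≡ (+ 2) N₀ (P ℤ.- (p ℤ.- 1ℤ) ℤ.* a) (begin
    + 2 ℤ.* N₀                                  ≡⟨ isolate (+ 2 ℤ.* N₀) Y ⟩
    (+ 2 ℤ.* N₀ ℤ.+ Y) ℤ.- Y                    ≡⟨ cong (ℤ._- Y) total ⟨
    + 2 ℤ.* (p ℤ.* P) ℤ.- Y                     ≡⟨ arrange p P a₁ a₂ ⟩
    + 2 ℤ.* (P ℤ.- (p ℤ.- 1ℤ) ℤ.* a)            ∎)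
    where
    Y = (p ℤ.- 1ℤ) ℤ.* (+ 2 ℤ.* a₁ ℤ.+ + 2 ℤ.* a₂)
    isolate : ∀ x y → x ≡ (x ℤ.+ y) ℤ.- y
    isolate = ℤ-solve-∀
    arrange : ∀ p P a b → + 2 ℤ.* (p ℤ.* P) ℤ.- (p ℤ.- 1ℤ) ℤ.* (+ 2 ℤ.* a ℤ.+ + 2 ℤ.* b) ≡
                          + 2 ℤ.* (P ℤ.- (p ℤ.- 1ℤ) ℤ.* (a ℤ.+ b ℤ.- P))
    arrange = ℤ-solve-∀

  -- Inserting `linear` for N₀ in `squares` makes the constant terms cancel and leaves a common
  -- factor 2 (p - 1).
  quadratic : p ℤ.* (a ℤ.* a) ℤ.+ b ℤ.* b ≡ R ℤ.* P
  quadratic = ℤ.*-cancelˡ-≡ (p ℤ.- 1ℤ) (p ℤ.* (a ℤ.* a) ℤ.+ b ℤ.* b) (R ℤ.* P)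
    (ℤ.*-cancelˡ-≡ (+ 2) ((p ℤ.- 1ℤ) ℤ.* (p ℤ.* (a ℤ.* a) ℤ.+ b ℤ.* b)) ((p ℤ.- 1ℤ) ℤ.* (R ℤ.* P)) (begin
      + 2 ℤ.* ((p ℤ.- 1ℤ) ℤ.* (p ℤ.* (a ℤ.* a) ℤ.+ b ℤ.* b))  ≡⟨ expand p P a₁ a₂ ⟩
      (+ 2 ℤ.* (N′ ℤ.* N′) ℤ.+ Y) ℤ.- Z                       ≡⟨ cong (λ x → (+ 2 ℤ.* (x ℤ.* x) ℤ.+ Y) ℤ.- Z) linear ⟨
      (+ 2 ℤ.* (N₀ ℤ.* N₀) ℤ.+ Y) ℤ.- Z                       ≡⟨ cong (ℤ._- Z) squares ⟨
      + 2 ℤ.* (p ℤ.* P ℤ.* P ℤ.+ (p ℤ.* P ℤ.- P) ℤ.* R) ℤ.- Z ≡⟨ contract p P R ⟩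
      + 2 ℤ.* ((p ℤ.- 1ℤ) ℤ.* (R ℤ.* P))                      ∎))
    where
    N′ = P ℤ.- (p ℤ.- 1ℤ) ℤ.* a
    Y = (p ℤ.- 1ℤ) ℤ.* ((+ 2 ℤ.* a₁) ℤ.* (+ 2 ℤ.* a₁) ℤ.+ (+ 2 ℤ.* a₂) ℤ.* (+ 2 ℤ.* a₂))
    Z = + 2 ℤ.* (p ℤ.* P ℤ.* P)
    contract : ∀ p P R → + 2 ℤ.* (p ℤ.* P ℤ.* P ℤ.+ (p ℤ.* P ℤ.- P) ℤ.* R) ℤ.- + 2 ℤ.* (p ℤ.* P ℤ.* P)
                       ≡ + 2 ℤ.* ((p ℤ.- 1ℤ) ℤ.* (R ℤ.* P))
    contract = ℤ-solve-∀
    expand : ∀ p P a b →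
      + 2 ℤ.* ((p ℤ.- 1ℤ) ℤ.* (p ℤ.* ((a ℤ.+ b ℤ.- P) ℤ.* (a ℤ.+ b ℤ.- P)) ℤ.+ (a ℤ.- b) ℤ.* (a ℤ.- b))) ≡
      (+ 2 ℤ.* ((P ℤ.- (p ℤ.- 1ℤ) ℤ.* (a ℤ.+ b ℤ.- P)) ℤ.* (P ℤ.- (p ℤ.- 1ℤ) ℤ.* (a ℤ.+ b ℤ.- P)))
        ℤ.+ (p ℤ.- 1ℤ) ℤ.* ((+ 2 ℤ.* a) ℤ.* (+ 2 ℤ.* a) ℤ.+ (+ 2 ℤ.* b) ℤ.* (+ 2 ℤ.* b)))
      ℤ.- + 2 ℤ.* (p ℤ.* P ℤ.* P)
    expand = ℤ-solve-∀

-- Counting ratios, evaluating moments, and three-valued functions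

module Ratios {n : ℕ} (F : FinField n) where
  open FinField F
  open ≡-Reasoning

  -- The point (f : g) of the projective line, with (0 : 0) counted on every line.
  count-ratios : ∀ f g → ∑ (λ s → 𝟏 (f Fin.≟ (s ⊗ g))) ℤ.+ 𝟏 (g Fin.≟ 𝟘) ≡
                         1ℤ ℤ.+ + n ℤ.* (𝟏 (g Fin.≟ 𝟘) ℤ.* 𝟏 (f Fin.≟ 𝟘))
  count-ratios f g = cases (g Fin.≟ 𝟘) (f Fin.≟ 𝟘)
    where
    cases : (g? : Dec (g ≡ 𝟘)) (f? : Dec (f ≡ 𝟘)) →
      ∑ (λ s → 𝟏 (f Fin.≟ (s ⊗ g))) ℤ.+ 𝟏 g? ≡ 1ℤ ℤ.+ + n ℤ.* (𝟏 g? ℤ.* 𝟏 f?)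
    cases (yes refl) (yes refl) = trans
      (cong (ℤ._+ 1ℤ) (trans (∑-cong λ s → 𝟏-true (𝟘 Fin.≟ (s ⊗ 𝟘)) (sym (zeroʳ s))) (∑-const n 1ℤ)))
      (ℤ.+-comm (+ n ℤ.* 1ℤ) 1ℤ)
    cases (yes refl) (no f≢𝟘) = trans
      (cong (ℤ._+ 1ℤ) (∑-zero λ s → 𝟏-false (f Fin.≟ (s ⊗ 𝟘)) (λ e → f≢𝟘 (trans e (zeroʳ s)))))
      (cong (ℤ._+_ 1ℤ) (sym (ℤ.*-zeroʳ (+ n))))
    cases (no g≢𝟘) f? = trans (ℤ.+-identityʳ _) (trans
      (trans (∑-cong λ s → 𝟏-cong (f Fin.≟ (s ⊗ g)) ((f ⊗ g⁻¹) Fin.≟ s) (to s) (from s)) (∑-singleton (f ⊗ g⁻¹)))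
      (cong (ℤ._+_ 1ℤ) (sym (trans (cong (ℤ._*_ (+ n)) (ℤ.*-zeroˡ (𝟏 f?))) (ℤ.*-zeroʳ (+ n))))))
      where
      g⁻¹ = proj₁ (inverse g g≢𝟘)
      inv : g ⊗ g⁻¹ ≡ 𝟙
      inv = proj₂ (inverse g g≢𝟘)
      to : ∀ s → f ≡ s ⊗ g → f ⊗ g⁻¹ ≡ s
      to s refl = trans (*-assoc s g g⁻¹) (trans (cong (s ⊗_) inv) (*-identityʳ s))
      from : ∀ s → f ⊗ g⁻¹ ≡ s → f ≡ s ⊗ g
      from s refl = sym (trans (*-assoc f g⁻¹ g) (trans (cong (f ⊗_) (trans (*-comm g⁻¹ g) inv)) (*-identityʳ f)))

-- S₁ and S₂ stand for the sums of E and E² over u. The hypotheses of `first` and `second` are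
-- double counts of N₀ and N₀² with N₀ = P - (p - 1) E inserted. The second one is multiplied by p,
-- because a generic pair of points contributes P / p to it.
module MomentAlgebra (p P q S₁ S₂ : ℤ) .{{_ : ℤ.NonZero (p ℤ.- 1ℤ)}} .{{_ : ℤ.NonZero p}}
  (q≡pP : q ≡ p ℤ.* P) where
  open ≡-Reasoning

  first : q ℤ.* P ℤ.- (p ℤ.- 1ℤ) ℤ.* S₁ ≡ q ℤ.* P ℤ.+ (q ℤ.- P) → S₁ ≡ ℤ.- P
  first eq = ℤ.*-cancelˡ-≡ (p ℤ.- 1ℤ) S₁ (ℤ.- P) (begin
    (p ℤ.- 1ℤ) ℤ.* S₁                                              ≡⟨ isolate (q ℤ.* P) ((p ℤ.- 1ℤ) ℤ.* S₁) ⟩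
    q ℤ.* P ℤ.- (q ℤ.* P ℤ.- (p ℤ.- 1ℤ) ℤ.* S₁)                    ≡⟨ cong (ℤ._-_ (q ℤ.* P)) eq ⟩
    q ℤ.* P ℤ.- (q ℤ.* P ℤ.+ (q ℤ.- P))                            ≡⟨ cong (λ q → q ℤ.* P ℤ.- (q ℤ.* P ℤ.+ (q ℤ.- P))) q≡pP ⟩
    p ℤ.* P ℤ.* P ℤ.- (p ℤ.* P ℤ.* P ℤ.+ (p ℤ.* P ℤ.- P))          ≡⟨ collect p P ⟩
    (p ℤ.- 1ℤ) ℤ.* (ℤ.- P)                                         ∎)
    where
    isolate : ∀ x y → y ≡ x ℤ.- (x ℤ.- y)
    isolate = ℤ-solve-∀
    collect : ∀ p P → p ℤ.* P ℤ.* P ℤ.- (p ℤ.* P ℤ.* P ℤ.+ (p ℤ.* P ℤ.- P)) ≡ (p ℤ.- 1ℤ) ℤ.* (ℤ.- P)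
    collect = ℤ-solve-∀

  second : S₁ ≡ ℤ.- P → let X = q ℤ.* P ℤ.+ (q ℤ.- P) ℤ.* p; Y = p ℤ.* (q ℤ.* P ℤ.+ (q ℤ.- P)) in
    p ℤ.* (q ℤ.* (P ℤ.* P) ℤ.+ (ℤ.- (+ 2 ℤ.* ((p ℤ.- 1ℤ) ℤ.* P)) ℤ.* S₁ ℤ.+ ((p ℤ.- 1ℤ) ℤ.* (p ℤ.- 1ℤ)) ℤ.* S₂))
      ≡ q ℤ.* X ℤ.+ (Y ℤ.- X) →
    S₂ ≡ P ℤ.* P
  second S₁≡ eq = ℤ.*-cancelˡ-≡ (p ℤ.- 1ℤ) S₂ (P ℤ.* P) (ℤ.*-cancelˡ-≡ (p ℤ.- 1ℤ) _ ((p ℤ.- 1ℤ) ℤ.* (P ℤ.* P))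
    (ℤ.*-cancelˡ-≡ p _ ((p ℤ.- 1ℤ) ℤ.* ((p ℤ.- 1ℤ) ℤ.* (P ℤ.* P))) (begin
      p ℤ.* ((p ℤ.- 1ℤ) ℤ.* ((p ℤ.- 1ℤ) ℤ.* S₂))     ≡⟨ isolate p P q S₂ ⟩
      p ℤ.* (q ℤ.* (P ℤ.* P) ℤ.+ (ℤ.- (+ 2 ℤ.* ((p ℤ.- 1ℤ) ℤ.* P)) ℤ.* (ℤ.- P) ℤ.+ ((p ℤ.- 1ℤ) ℤ.* (p ℤ.- 1ℤ)) ℤ.* S₂))
        ℤ.- Z q                                      ≡⟨ cong (ℤ._- Z q) (trans (cong
          (λ s → p ℤ.* (q ℤ.* (P ℤ.* P) ℤ.+ (ℤ.- (+ 2 ℤ.* ((p ℤ.- 1ℤ) ℤ.* P)) ℤ.* s ℤ.+ ((p ℤ.- 1ℤ) ℤ.* (p ℤ.- 1ℤ)) ℤ.* S₂)))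
          (sym S₁≡)) eq) ⟩
      W q ℤ.- Z q                                    ≡⟨ cong (λ q → W q ℤ.- Z q) q≡pP ⟩
      W (p ℤ.* P) ℤ.- Z (p ℤ.* P)                    ≡⟨ collect p P ⟩
      p ℤ.* ((p ℤ.- 1ℤ) ℤ.* ((p ℤ.- 1ℤ) ℤ.* (P ℤ.* P))) ∎)))
    where
    W Z : ℤ → ℤ
    W q = q ℤ.* (q ℤ.* P ℤ.+ (q ℤ.- P) ℤ.* p) ℤ.+ (p ℤ.* (q ℤ.* P ℤ.+ (q ℤ.- P)) ℤ.- (q ℤ.* P ℤ.+ (q ℤ.- P) ℤ.* p))
    Z q = p ℤ.* (q ℤ.* (P ℤ.* P) ℤ.+ ℤ.- (+ 2 ℤ.* ((p ℤ.- 1ℤ) ℤ.* P)) ℤ.* (ℤ.- P))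
    isolate : ∀ p P q x → p ℤ.* ((p ℤ.- 1ℤ) ℤ.* ((p ℤ.- 1ℤ) ℤ.* x)) ≡
      p ℤ.* (q ℤ.* (P ℤ.* P) ℤ.+ (ℤ.- (+ 2 ℤ.* ((p ℤ.- 1ℤ) ℤ.* P)) ℤ.* (ℤ.- P) ℤ.+ ((p ℤ.- 1ℤ) ℤ.* (p ℤ.- 1ℤ)) ℤ.* x))
        ℤ.- p ℤ.* (q ℤ.* (P ℤ.* P) ℤ.+ ℤ.- (+ 2 ℤ.* ((p ℤ.- 1ℤ) ℤ.* P)) ℤ.* (ℤ.- P))
    isolate = ℤ-solve-∀
    collect : ∀ p P →
      (p ℤ.* P ℤ.* (p ℤ.* P ℤ.* P ℤ.+ (p ℤ.* P ℤ.- P) ℤ.* p) ℤ.+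
        (p ℤ.* (p ℤ.* P ℤ.* P ℤ.+ (p ℤ.* P ℤ.- P)) ℤ.- (p ℤ.* P ℤ.* P ℤ.+ (p ℤ.* P ℤ.- P) ℤ.* p)))
        ℤ.- p ℤ.* (p ℤ.* P ℤ.* (P ℤ.* P) ℤ.+ ℤ.- (+ 2 ℤ.* ((p ℤ.- 1ℤ) ℤ.* P)) ℤ.* (ℤ.- P))
      ≡ p ℤ.* ((p ℤ.- 1ℤ) ℤ.* ((p ℤ.- 1ℤ) ℤ.* (P ℤ.* P)))
    collect = ℤ-solve-∀

module ThreeValues {n : ℕ} (e : Fin n → ℤ) (S : ℕ) .{{_ : ℕ.NonZero S}}
  (values : ∀ u → e u ≡ 0ℤ ⊎ e u ≡ + S ⊎ e u ≡ ℤ.- + S) where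
  open ≡-Reasoning

  count : ℤ → ℤ
  count v = ∑ (λ u → 𝟏 (e u ℤ.≟ v))

  private
    S≢0 : + S ≢ 0ℤ
    S≢0 eq = ℕ.≢-nonZero⁻¹ S (ℤ.+-injective eq)
    -S≢0 : ℤ.- + S ≢ 0ℤ
    -S≢0 eq = S≢0 (ℤ.neg-injective eq)
    distinct : ∀ n → + n ≢ 0ℤ → + n ≢ ℤ.- + n
    distinct zero ≢0 = λ _ → ≢0 refl
    distinct (suc _) _ = λ ()
    S≢-S : + S ≢ ℤ.- + S
    S≢-S = distinct S S≢0

    pick₀ : ∀ a b c → a ≡ 1ℤ ℤ.* a ℤ.+ (0ℤ ℤ.* b ℤ.+ 0ℤ ℤ.* c)
    pick₀ = ℤ-solve-∀
    pick₁ : ∀ a b c → b ≡ 0ℤ ℤ.* a ℤ.+ (1ℤ ℤ.* b ℤ.+ 0ℤ ℤ.* c)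
    pick₁ = ℤ-solve-∀
    pick₂ : ∀ a b c → c ≡ 0ℤ ℤ.* a ℤ.+ (0ℤ ℤ.* b ℤ.+ 1ℤ ℤ.* c)
    pick₂ = ℤ-solve-∀

    pointwise : ∀ (g : ℤ → ℤ) {v} → v ≡ 0ℤ ⊎ v ≡ + S ⊎ v ≡ ℤ.- + S → g v ≡
      𝟏 (v ℤ.≟ 0ℤ) ℤ.* g 0ℤ ℤ.+ (𝟏 (v ℤ.≟ + S) ℤ.* g (+ S) ℤ.+ 𝟏 (v ℤ.≟ (ℤ.- + S)) ℤ.* g (ℤ.- + S))
    pointwise g (inj₁ refl) = trans (pick₀ (g 0ℤ) (g (+ S)) (g (ℤ.- + S))) (sym (cong (ℤ._+_ (1ℤ ℤ.* g 0ℤ))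
      (cong₂ (λ x y → x ℤ.* g (+ S) ℤ.+ y ℤ.* g (ℤ.- + S)) (𝟏-false (0ℤ ℤ.≟ + S) (S≢0 ∘ sym))
        (𝟏-false (0ℤ ℤ.≟ (ℤ.- + S)) (-S≢0 ∘ sym)))))
    pointwise g (inj₂ (inj₁ refl)) = trans (pick₁ (g 0ℤ) (g (+ S)) (g (ℤ.- + S))) (sym
      (cong₂ (λ x y → x ℤ.* g 0ℤ ℤ.+ y) (𝟏-false (+ S ℤ.≟ 0ℤ) S≢0)
        (cong₂ (λ x y → x ℤ.* g (+ S) ℤ.+ y ℤ.* g (ℤ.- + S)) (𝟏-true (+ S ℤ.≟ + S) refl)
          (𝟏-false (+ S ℤ.≟ (ℤ.- + S)) S≢-S))))
    pointwise g (inj₂ (inj₂ refl)) = trans (pick₂ (g 0ℤ) (g (+ S)) (g (ℤ.- + S))) (sym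
      (cong₂ (λ x y → x ℤ.* g 0ℤ ℤ.+ y) (𝟏-false ((ℤ.- + S) ℤ.≟ 0ℤ) -S≢0)
        (cong₂ (λ x y → x ℤ.* g (+ S) ℤ.+ y ℤ.* g (ℤ.- + S)) (𝟏-false ((ℤ.- + S) ℤ.≟ + S) (S≢-S ∘ sym))
          (𝟏-true ((ℤ.- + S) ℤ.≟ (ℤ.- + S)) refl))))

  -- Taking 1, x and x² for g gives the linear system for the three counts; an arbitrary g is needed
  -- afterwards to sum functions of the weight.
  distribution : ∀ (g : ℤ → ℤ) → ∑ (g ∘ e) ≡
    count 0ℤ ℤ.* g 0ℤ ℤ.+ (count (+ S) ℤ.* g (+ S) ℤ.+ count (ℤ.- + S) ℤ.* g (ℤ.- + S))
  distribution g = begin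
    ∑ (g ∘ e)                                       ≡⟨ ∑-cong (λ u → pointwise g (values u)) ⟩
    ∑ (λ u → a u ℤ.+ (b u ℤ.+ c u))                 ≡⟨ ∑-+ a (λ u → b u ℤ.+ c u) ⟩
    ∑ a ℤ.+ ∑ (λ u → b u ℤ.+ c u)                   ≡⟨ cong (ℤ._+_ (∑ a)) (∑-+ b c) ⟩
    ∑ a ℤ.+ (∑ b ℤ.+ ∑ c)                           ≡⟨ cong₂ ℤ._+_ (∑-*ʳ (g 0ℤ) (λ u → 𝟏 (e u ℤ.≟ 0ℤ)))
                                                         (cong₂ ℤ._+_ (∑-*ʳ (g (+ S)) (λ u → 𝟏 (e u ℤ.≟ + S)))
                                                           (∑-*ʳ (g (ℤ.- + S)) (λ u → 𝟏 (e u ℤ.≟ (ℤ.- + S))))) ⟩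
    count 0ℤ ℤ.* g 0ℤ ℤ.+ (count (+ S) ℤ.* g (+ S) ℤ.+ count (ℤ.- + S) ℤ.* g (ℤ.- + S)) ∎
    where
    a b c : Fin n → ℤ
    a u = 𝟏 (e u ℤ.≟ 0ℤ) ℤ.* g 0ℤ
    b u = 𝟏 (e u ℤ.≟ + S) ℤ.* g (+ S)
    c u = 𝟏 (e u ℤ.≟ (ℤ.- + S)) ℤ.* g (ℤ.- + S)

increasing⇒injective : ∀ {n} (f : Fin (suc n) → ℤ) → (∀ i → f (inject₁ i) ℤ.< f (suc i)) → Injective _≡_ _≡_ f
increasing⇒injective f inc {zero} {zero} eq = refl
increasing⇒injective f inc {zero} {suc j} eq = contradiction eq (ℤ.<⇒≢ (below f inc j))
  where
  below : ∀ {n} (f : Fin (suc n) → ℤ) → (∀ i → f (inject₁ i) ℤ.< f (suc i)) → ∀ j → f zero ℤ.< f (suc j)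
  below f inc zero = inc zero
  below f inc (suc j) = ℤ.<-trans (inc zero) (below (f ∘ suc) (inc ∘ suc) j)
increasing⇒injective f inc {suc i} {zero} eq = sym (increasing⇒injective f inc (sym eq))
increasing⇒injective {suc n} f inc {suc i} {suc j} eq =
  cong suc (increasing⇒injective (f ∘ suc) (inc ∘ suc) eq)

-- Here q = p ^ m, P = p ^ (m - 1), a = (P + S) / 2 and b = (P - S) / 2, and δ is the indicator function of one
-- of the seven weights, numbered increasingly.
module FrequencyPolynomial where
  open import Data.Integer.Solver using (module +-*-Solver)
  open +-*-Solver

  value : ℤ → ℤ → ℤ → ℤ → Fin 7 → ℤ
  value q P a b 0F = 1ℤ
  value q P a b 1F = + 2 ℤ.* (q ℤ.- 1ℤ)
  value q P a b 2F = (q ℤ.- 1ℤ) ℤ.* (a ℤ.* a)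
  value q P a b 3F = (q ℤ.- 1ℤ) ℤ.* (q ℤ.- P) ℤ.* (+ 2 ℤ.* a)
  value q P a b 4F = (q ℤ.- 1ℤ) ℤ.* ((q ℤ.- P) ℤ.* (q ℤ.- P) ℤ.+ + 2 ℤ.* (a ℤ.* b) ℤ.+ (q ℤ.- 1ℤ))
  value q P a b 5F = (q ℤ.- 1ℤ) ℤ.* (q ℤ.- P) ℤ.* (+ 2 ℤ.* b)
  value q P a b 6F = (q ℤ.- 1ℤ) ℤ.* (b ℤ.* b)

  -- `twofold` is the contribution of one c ≠ 0: E takes the values 0, S, - S with multiplicities q
  -- - P, b, a, and S or - S moves the index of the weight up or down by one from 4. `twofold₀` is
  -- that of c = 0, where E is - P at one point and 0 elsewhere. The unexpanded shape follows that
  -- of `D` and `D₀` below.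
  twofold twofold₀ total : ℤ → ℤ → ℤ → ℤ → (Fin 7 → ℤ) → ℤ
  twofold q P a b δ = (q ℤ.- P) ℤ.* ((q ℤ.- P) ℤ.* δ 4F ℤ.+ (b ℤ.* δ 5F ℤ.+ a ℤ.* δ 3F)) ℤ.+
    (b ℤ.* ((q ℤ.- P) ℤ.* δ 5F ℤ.+ (b ℤ.* δ 6F ℤ.+ a ℤ.* δ 4F)) ℤ.+
     a ℤ.* ((q ℤ.- P) ℤ.* δ 3F ℤ.+ (b ℤ.* δ 4F ℤ.+ a ℤ.* δ 2F)))
  twofold₀ q P a b δ = q ℤ.* (q ℤ.* δ 4F ℤ.+ (δ 1F ℤ.- δ 4F)) ℤ.+
    ((q ℤ.* δ 1F ℤ.+ (δ 0F ℤ.- δ 1F)) ℤ.- (q ℤ.* δ 4F ℤ.+ (δ 1F ℤ.- δ 4F)))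
  total q P a b δ = q ℤ.* twofold q P a b δ ℤ.+ (twofold₀ q P a b δ ℤ.- twofold q P a b δ)

  δ : Fin 7 → Fin 7 → ℤ
  δ j i = 𝟏 (i Fin.≟ j)

  private
    twofoldᵖ twofold₀ᵖ totalᵖ : (q P a b : Polynomial 4) → (Fin 7 → Polynomial 4) → Polynomial 4
    twofoldᵖ q P a b δ = (q :- P) :* ((q :- P) :* δ 4F :+ (b :* δ 5F :+ a :* δ 3F)) :+
      (b :* ((q :- P) :* δ 5F :+ (b :* δ 6F :+ a :* δ 4F)) :+
       a :* ((q :- P) :* δ 3F :+ (b :* δ 4F :+ a :* δ 2F)))
    twofold₀ᵖ q P a b δ = q :* (q :* δ 4F :+ (δ 1F :- δ 4F)) :+
      ((q :* δ 1F :+ (δ 0F :- δ 1F)) :- (q :* δ 4F :+ (δ 1F :- δ 4F)))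
    totalᵖ q P a b δ = q :* twofoldᵖ q P a b δ :+ (twofold₀ᵖ q P a b δ :- twofoldᵖ q P a b δ)

    δᵖ : Fin 7 → Fin 7 → Polynomial 4
    δᵖ j i = con (δ j i)

  total≡value : ∀ q P a b j → total q P a b (δ j) ≡ value q P a b j
  total≡value q P a b 0F = solve 4 (λ q P a b → totalᵖ q P a b (δᵖ 0F) := con 1ℤ) refl q P a b
  total≡value q P a b 1F = solve 4 (λ q P a b → totalᵖ q P a b (δᵖ 1F) := con (+ 2) :* (q :- con 1ℤ)) refl q P a b
  total≡value q P a b 2F = solve 4 (λ q P a b → totalᵖ q P a b (δᵖ 2F) := (q :- con 1ℤ) :* (a :* a)) refl q P a b
  total≡value q P a b 3F = solve 4 (λ q P a b → totalᵖ q P a b (δᵖ 3F) :=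
    (q :- con 1ℤ) :* (q :- P) :* (con (+ 2) :* a)) refl q P a b
  total≡value q P a b 4F = solve 4 (λ q P a b → totalᵖ q P a b (δᵖ 4F) :=
    (q :- con 1ℤ) :* ((q :- P) :* (q :- P) :+ con (+ 2) :* (a :* b) :+ (q :- con 1ℤ))) refl q P a b
  total≡value q P a b 5F = solve 4 (λ q P a b → totalᵖ q P a b (δᵖ 5F) :=
    (q :- con 1ℤ) :* (q :- P) :* (con (+ 2) :* b)) refl q P a b
  total≡value q P a b 6F = solve 4 (λ q P a b → totalᵖ q P a b (δᵖ 6F) := (q :- con 1ℤ) :* (b :* b)) refl q P a b

-- Bases of finite vector spaces

record FiniteVectorSpace {p : ℕ} (K : FinField p) (N : ℕ) : Set₁ where
  open FinField K
  infixl 6 _+ᵥ_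
  infixr 7 _∙_
  field
    V : Set
    _+ᵥ_ : V → V → V
    0ᵥ : V
    _∙_ : Fin p → V → V
    +ᵥ-assoc : ∀ x y z → (x +ᵥ y) +ᵥ z ≡ x +ᵥ (y +ᵥ z)
    +ᵥ-comm : ∀ x y → x +ᵥ y ≡ y +ᵥ x
    +ᵥ-identityˡ : ∀ x → 0ᵥ +ᵥ x ≡ x
    ∙-distribˡ : ∀ s x y → s ∙ (x +ᵥ y) ≡ s ∙ x +ᵥ s ∙ y
    ∙-distribʳ : ∀ s t x → (s ⊕ t) ∙ x ≡ s ∙ x +ᵥ t ∙ x
    ∙-assoc : ∀ s t x → (s ⊗ t) ∙ x ≡ s ∙ t ∙ x
    ∙-identity : ∀ x → 𝟙 ∙ x ≡ x
    ∙-zeroˡ : ∀ x → 𝟘 ∙ x ≡ 0ᵥ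
    ∙-zeroʳ : ∀ s → s ∙ 0ᵥ ≡ 0ᵥ
    encode : V → Fin N
    decode : Fin N → V
    encode-decode : ∀ i → encode (decode i) ≡ i
    decode-encode : ∀ v → decode (encode v) ≡ v

module Bases {p N : ℕ} {K : FinField p} (space : FiniteVectorSpace K N) where
  open FinField K
  open FiniteVectorSpace space
  open ≡-Reasoning

  combination : ∀ {r} → (Fin r → Fin p) → (Fin r → V) → V
  combination {zero} s g = 0ᵥ
  combination {suc r} s g = s zero ∙ g zero +ᵥ combination (s ∘ suc) (g ∘ suc)

  combination-cong : ∀ {r s t} (g : Fin r → V) → (∀ i → s i ≡ t i) → combination s g ≡ combination t g
  combination-cong {zero} g s≗t = refl
  combination-cong {suc r} g s≗t =
    cong₂ (λ a x → a ∙ g zero +ᵥ x) (s≗t zero) (combination-cong (g ∘ suc) (s≗t ∘ suc))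

  combination-+ : ∀ {r} s t (g : Fin r → V) → combination (λ i → s i ⊕ t i) g ≡ combination s g +ᵥ combination t g
  combination-+ {zero} s t g = sym (+ᵥ-identityˡ 0ᵥ)
  combination-+ {suc r} s t g = begin
    (s zero ⊕ t zero) ∙ g zero +ᵥ combination (λ i → s (suc i) ⊕ t (suc i)) (g ∘ suc)
      ≡⟨ cong₂ _+ᵥ_ (∙-distribʳ (s zero) (t zero) (g zero)) (combination-+ (s ∘ suc) (t ∘ suc) (g ∘ suc)) ⟩
    (a +ᵥ b) +ᵥ (x +ᵥ y)     ≡⟨ +ᵥ-assoc a b (x +ᵥ y) ⟩
    a +ᵥ (b +ᵥ (x +ᵥ y))     ≡⟨ cong (a +ᵥ_) (+ᵥ-assoc b x y) ⟨
    a +ᵥ ((b +ᵥ x) +ᵥ y)     ≡⟨ cong (λ z → a +ᵥ (z +ᵥ y)) (+ᵥ-comm b x) ⟩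
    a +ᵥ ((x +ᵥ b) +ᵥ y)     ≡⟨ cong (a +ᵥ_) (+ᵥ-assoc x b y) ⟩
    a +ᵥ (x +ᵥ (b +ᵥ y))     ≡⟨ +ᵥ-assoc a x (b +ᵥ y) ⟨
    (a +ᵥ x) +ᵥ (b +ᵥ y)     ∎
    where
    a = s zero ∙ g zero
    b = t zero ∙ g zero
    x = combination (s ∘ suc) (g ∘ suc)
    y = combination (t ∘ suc) (g ∘ suc)

  combination-∙ : ∀ {r} a s (g : Fin r → V) → combination (λ i → a ⊗ s i) g ≡ a ∙ combination s g
  combination-∙ {zero} a s g = sym (∙-zeroʳ a)
  combination-∙ {suc r} a s g = trans
    (cong₂ _+ᵥ_ (∙-assoc a (s zero) (g zero)) (combination-∙ a (s ∘ suc) (g ∘ suc)))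
    (sym (∙-distribˡ a _ _))

  Independent : ∀ {r} → (Fin r → V) → Set
  Independent g = ∀ s → combination s g ≡ 0ᵥ → ∀ i → s i ≡ 𝟘

  private
    negative : ∀ a x → a ∙ x +ᵥ (⊖ a) ∙ x ≡ 0ᵥ
    negative a x = trans (sym (∙-distribʳ a (⊖ a) x)) (trans (cong (_∙ x) (-‿inverseʳ a)) (∙-zeroˡ x))

  combination-injective : ∀ {r} {g : Fin r → V} → Independent g →
                          ∀ {s t} → combination s g ≡ combination t g → ∀ i → s i ≡ t i
  combination-injective {g = g} indep {s} {t} eq i = sub≡𝟘⇒≡ (trans
    (cong (s i ⊕_) (solve 1 (λ x → :- x := (:- con 1ℤ) :* x) refl (t i)))
    (indep (λ i → s i ⊕ ⊖ 𝟙 ⊗ t i) (begin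
      combination (λ i → s i ⊕ ⊖ 𝟙 ⊗ t i) g                ≡⟨ combination-+ s (λ i → ⊖ 𝟙 ⊗ t i) g ⟩
      combination s g +ᵥ combination (λ i → ⊖ 𝟙 ⊗ t i) g    ≡⟨ cong₂ _+ᵥ_ (trans eq (sym (∙-identity _))) (combination-∙ (⊖ 𝟙) t g) ⟩
      𝟙 ∙ combination t g +ᵥ (⊖ 𝟙) ∙ combination t g        ≡⟨ negative 𝟙 _ ⟩
      0ᵥ                                                    ∎) i))

  private
    funToFin-cong : ∀ {m n} {f g : Fin m → Fin n} → (∀ i → f i ≡ g i) → funToFin f ≡ funToFin g
    funToFin-cong {zero} f≗g = refl
    funToFin-cong {suc m} f≗g = cong₂ combine (f≗g zero) (funToFin-cong (f≗g ∘ suc))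

    span : ∀ {r} → (Fin r → V) → Fin (p ^ r) → Fin N
    span g i = encode (combination (finToFun i) g)

    encode-injective : ∀ {v w} → encode v ≡ encode w → v ≡ w
    encode-injective {v} {w} eq = trans (sym (decode-encode v)) (trans (cong decode eq) (decode-encode w))

  -- The p ^ r coefficient vectors give distinct combinations among N vectors.
  independent⇒≤ : ∀ {r} {g : Fin r → V} → Independent g → p ^ r ≤ N
  independent⇒≤ {r} {g} indep = Fin.injective⇒≤ {f = span g} λ {i} {j} eq →
    trans (sym (Fin.funToFin-finToFin {r} i))
      (trans (funToFin-cong (combination-injective indep (encode-injective eq))) (Fin.funToFin-finToFin {r} j))

  Spanned : ∀ {r} → (Fin r → V) → V → Set
  Spanned g v = ∃ λ s → combination s g ≡ v

  spanned? : ∀ {r} (g : Fin r → V) v → Dec (Spanned g v)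
  spanned? {r} g v = decide (Fin.any? (λ i → span g i Fin.≟ encode v))
    where
    decide : Dec (∃ λ i → span g i ≡ encode v) → Dec (Spanned g v)
    decide (yes (i , eq)) = yes (finToFun i , encode-injective eq)
    decide (no none) = no λ (s , eq) → none (funToFin s ,
      cong encode (trans (combination-cong g (Fin.finToFun-funToFin s)) eq))

  adjoin : ∀ {r} → V → (Fin r → V) → Fin (suc r) → V
  adjoin v g zero = v
  adjoin v g (suc i) = g i

  -- In a relation with nonzero coefficient at v one could solve for v, which is not in the span.
  adjoin-independent : ∀ {r v} {g : Fin r → V} → Independent g → ¬ Spanned g v → Independent (adjoin v g)
  adjoin-independent {v = v} {g} indep unspanned s eq = cases (s zero Fin.≟ 𝟘)
    where
    rest = combination (s ∘ suc) g
    cases : Dec (s zero ≡ 𝟘) → ∀ i → s i ≡ 𝟘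
    cases (yes s₀≡𝟘) zero = s₀≡𝟘
    cases (yes s₀≡𝟘) (suc i) = indep (s ∘ suc) (begin
      rest                    ≡⟨ +ᵥ-identityˡ rest ⟨
      0ᵥ +ᵥ rest              ≡⟨ cong (_+ᵥ rest) (trans (cong (_∙ v) s₀≡𝟘) (∙-zeroˡ v)) ⟨
      s zero ∙ v +ᵥ rest      ≡⟨ eq ⟩
      0ᵥ                      ∎) i
    -- With t the inverse of the coefficient at v, multiplying the relation by t expresses v with
    -- coefficients - t s (suc i).
    cases (no s₀≢𝟘) = contradiction ((λ i → ⊖ t ⊗ s (suc i)) , (begin
      combination (λ i → ⊖ t ⊗ s (suc i)) g        ≡⟨ combination-∙ (⊖ t) (s ∘ suc) g ⟩
      (⊖ t) ∙ rest                                 ≡⟨ +ᵥ-identityˡ _ ⟨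
      0ᵥ +ᵥ (⊖ t) ∙ rest                           ≡⟨ cong (_+ᵥ (⊖ t) ∙ rest) (trans (cong (t ∙_) eq) (∙-zeroʳ t)) ⟨
      t ∙ (s zero ∙ v +ᵥ rest) +ᵥ (⊖ t) ∙ rest     ≡⟨ cong (_+ᵥ (⊖ t) ∙ rest) (∙-distribˡ t (s zero ∙ v) rest) ⟩
      (t ∙ s zero ∙ v +ᵥ t ∙ rest) +ᵥ (⊖ t) ∙ rest ≡⟨ +ᵥ-assoc _ _ _ ⟩
      t ∙ s zero ∙ v +ᵥ (t ∙ rest +ᵥ (⊖ t) ∙ rest) ≡⟨ cong₂ _+ᵥ_ (sym (∙-assoc t (s zero) v)) (negative t rest) ⟩
      (t ⊗ s zero) ∙ v +ᵥ 0ᵥ                       ≡⟨ cong (λ a → a ∙ v +ᵥ 0ᵥ) (trans (*-comm t (s zero)) (proj₂ (inverse (s zero) s₀≢𝟘))) ⟩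
      𝟙 ∙ v +ᵥ 0ᵥ                                  ≡⟨ cong (_+ᵥ 0ᵥ) (∙-identity v) ⟩
      v +ᵥ 0ᵥ                                      ≡⟨ trans (+ᵥ-comm v 0ᵥ) (+ᵥ-identityˡ v) ⟩
      v                                            ∎)) unspanned
      where t = proj₁ (inverse (s zero) s₀≢𝟘)

  private
    -- If every vector were spanned, choosing coordinates would inject `Fin N` into `Fin (p ^ r)`.
    unspanned-vector : ∀ {r} → p ^ r < N → (g : Fin r → V) → ∃ λ v → ¬ Spanned g v
    unspanned-vector {r} p^r<N g = decide (Fin.any? (λ j → ¬? (spanned? g (decode j))))
      where
      decide : Dec (∃ λ j → ¬ Spanned g (decode j)) → ∃ λ v → ¬ Spanned g v
      decide (yes (j , unspanned)) = decode j , unspanned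
      decide (no none) = contradiction (Fin.injective⇒≤ {f = preimage} preimage-injective) (ℕ.<⇒≱ p^r<N)
        where
        coordinates : ∀ j → Spanned g (decode j)
        coordinates j = decidable-stable (spanned? g (decode j)) (λ unspanned → none (j , unspanned))
        preimage : Fin N → Fin (p ^ r)
        preimage j = funToFin (proj₁ (coordinates j))
        span-preimage : ∀ j → span g (preimage j) ≡ j
        span-preimage j = trans (cong encode (trans (combination-cong g (Fin.finToFun-funToFin (proj₁ (coordinates j))))
          (proj₂ (coordinates j)))) (encode-decode j)
        preimage-injective : Injective _≡_ _≡_ preimage
        preimage-injective {i} {j} eq = trans (sym (span-preimage i)) (trans (cong (span g) eq) (span-preimage j))

    independent-family : 1 < p → ∀ r → p ^ r ≤ N → ∃ λ (g : Fin r → V) → Independent g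
    independent-family p>1 zero _ = (λ ()) , λ _ _ ()
    independent-family p>1 (suc r) p^[1+r]≤N = adjoin v g , adjoin-independent {v = v} {g} indep (proj₂ missed)
      where
      p^r<N = ℕ.<-≤-trans (ℕ.^-monoʳ-< p p>1 (ℕ.n<1+n r)) p^[1+r]≤N
      family = independent-family p>1 r (ℕ.<⇒≤ p^r<N)
      g = proj₁ family
      indep = proj₂ family
      missed = unspanned-vector p^r<N g
      v = proj₁ missed

  -- Independent families grow as long as p ^ r < N. At p ^ d = N a vector outside the span would
  -- extend the family to one with p ^ (d + 1) > N combinations.
  basis : 1 < p → ∀ d → p ^ d ≡ N → ∃ λ (g : Fin d → V) → Independent g × (∀ v → Spanned g v)
  basis p>1 d p^d≡N = g , indep , λ v → decidable-stable (spanned? g v) λ unspanned →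
    ℕ.<⇒≱ (ℕ.^-monoʳ-< p p>1 (ℕ.n<1+n d))
      (subst (p ^ suc d ≤_) (sym p^d≡N) (independent⇒≤ {g = adjoin v g} (adjoin-independent {v = v} {g} indep unspanned)))
    where
    family = independent-family p>1 d (ℕ.≤-reflexive p^d≡N)
    g = proj₁ family
    indep = proj₂ family

-- Counts over lists as sums of indicators

module ListCounting where
  count : ∀ {a ℓ} {A : Set a} {P : Pred A ℓ} → Decidable P → List A → ℤ
  count P? xs = + length (filter P? xs)

  count-∷ : ∀ {a ℓ} {A : Set a} {P : Pred A ℓ} (P? : Decidable P) x xs →
            count P? (x ∷ xs) ≡ 𝟏 (P? x) ℤ.+ count P? xs
  count-∷ P? x xs with P? x
  ... | yes _ = refl
  ... | no _ = refl

  count-++ : ∀ {a ℓ} {A : Set a} {P : Pred A ℓ} (P? : Decidable P) xs ys →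
             count P? (xs ++ ys) ≡ count P? xs ℤ.+ count P? ys
  count-++ P? [] ys = refl
  count-++ P? (x ∷ xs) ys = begin
    count P? (x ∷ xs ++ ys)                            ≡⟨ count-∷ P? x (xs ++ ys) ⟩
    𝟏 (P? x) ℤ.+ count P? (xs ++ ys)                   ≡⟨ cong (ℤ._+_ (𝟏 (P? x))) (count-++ P? xs ys) ⟩
    𝟏 (P? x) ℤ.+ (count P? xs ℤ.+ count P? ys)         ≡⟨ ℤ.+-assoc (𝟏 (P? x)) (count P? xs) (count P? ys) ⟨
    (𝟏 (P? x) ℤ.+ count P? xs) ℤ.+ count P? ys         ≡⟨ cong (ℤ._+ count P? ys) (count-∷ P? x xs) ⟨
    count P? (x ∷ xs) ℤ.+ count P? ys                  ∎
    where open ≡-Reasoning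

  count-map : ∀ {a b ℓ} {A : Set a} {B : Set b} {P : Pred B ℓ} (P? : Decidable P) (f : A → B) xs →
              count P? (map f xs) ≡ count (λ x → P? (f x)) xs
  count-map P? f [] = refl
  count-map P? f (x ∷ xs) = trans (count-∷ P? (f x) (map f xs))
    (trans (cong (ℤ._+_ (𝟏 (P? (f x)))) (count-map P? f xs)) (sym (count-∷ (λ x → P? (f x)) x xs)))

  count-tabulate : ∀ {n a ℓ} {A : Set a} {P : Pred A ℓ} (P? : Decidable P) (f : Fin n → A) →
                   count P? (List.tabulate f) ≡ ∑ (λ i → 𝟏 (P? (f i)))
  count-tabulate {zero} P? f = refl
  count-tabulate {suc n} P? f = trans (count-∷ P? (f zero) (List.tabulate (f ∘ suc)))
    (cong (ℤ._+_ (𝟏 (P? (f zero)))) (count-tabulate P? (f ∘ suc)))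

  count-cartesianProduct : ∀ {n a b ℓ} {I : Set} {A : Set a} {B : Set b} {P : Pred (A × B) ℓ} (P? : Decidable P)
    (f : I → A) (g : Fin n → I) ys →
    count P? (cartesianProduct (map f (List.tabulate g)) ys) ≡ ∑ (λ i → count (λ y → P? (f (g i) , y)) ys)
  count-cartesianProduct {zero} P? f g ys = refl
  count-cartesianProduct {suc n} P? f g ys = trans
    (count-++ P? (map (f (g zero) ,_) ys) (cartesianProduct (map f (List.tabulate (g ∘ suc))) ys))
    (cong₂ ℤ._+_ (count-map P? (f (g zero) ,_) ys) (count-cartesianProduct P? f (g ∘ suc) ys))

-- Transport from setoids to propositional equality

module Transfer {c ℓ : Level} {n : ℕ} (A : FiniteField c ℓ n) where
  private
    module A = FiniteField A
    module R = CommutativeRing A.commutativeRing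
  open Inverse A.enumeration public using () renaming (to to encode; from to decode; to-cong to encode-cong)
  private
    module I = Inverse A.enumeration

  decode-encode : ∀ x → decode (encode x) A.≈ x
  decode-encode = I.strictlyInverseʳ

  encode-decode : ∀ i → encode (decode i) ≡ i
  encode-decode = I.strictlyInverseˡ

  encode-injective : ∀ {x y} → encode x ≡ encode y → x A.≈ y
  encode-injective {x} {y} eq = R.trans (R.sym (decode-encode x)) (R.trans (I.from-cong eq) (decode-encode y))

  private
    rawRing : RawRing 0ℓ 0ℓ
    rawRing = record
      { Carrier = Fin n ; _≈_ = _≡_
      ; _+_ = λ i j → encode (decode i A.⊕ decode j)
      ; _*_ = λ i j → encode (decode i A.⊗ decode j)
      ; -_ = λ i → encode (A.⊖ decode i)
      ; 0# = encode A.0# ; 1# = encode A.1# }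

    open RingMorphisms rawRing A.rawRing using (IsRingMonomorphism)

    decode-isRingMonomorphism : IsRingMonomorphism decode
    decode-isRingMonomorphism = record
      { isRingHomomorphism = record
        { isSemiringHomomorphism = record
          { isNearSemiringHomomorphism = record
            { +-isMonoidHomomorphism = record
              { isMagmaHomomorphism = record
                { isRelHomomorphism = record { cong = I.from-cong }
                ; homo = λ _ _ → decode-encode _ }
              ; ε-homo = decode-encode _ }
            ; *-homo = λ _ _ → decode-encode _ }
          ; 1#-homo = decode-encode _ }
        ; -‿homo = λ _ → decode-encode _ }
      ; injective = λ {i} {j} eq → trans (sym (encode-decode i)) (trans (encode-cong eq) (encode-decode j)) }

  -- The operations are transported along the enumeration, which makes `decode` an injective ring
  -- homomorphism; the ring laws are reflected along it.
  model : FinField n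
  model = record
    { isCommutativeRing = Algebra.Morphism.RingMonomorphism.isCommutativeRing decode-isRingMonomorphism R.isCommutativeRing
    ; 𝟘≢𝟙 = λ eq → A.0≉1 (encode-injective eq)
    ; inverse = λ i i≢𝟘 →
        let y , eq = A.inverse (decode i) (λ e → i≢𝟘 (trans (sym (encode-decode i)) (encode-cong e)))
        in encode y , encode-cong (R.trans (R.*-congˡ (decode-encode y)) eq)
    }

  open FinField model
  private module Sums = Algebra.Properties.Semiring.Sum semiring

  encode-⊕ : ∀ x y → encode (x A.⊕ y) ≡ encode x ⊕ encode y
  encode-⊕ x y = encode-cong (R.+-cong (R.sym (decode-encode x)) (R.sym (decode-encode y)))

  encode-⊗ : ∀ x y → encode (x A.⊗ y) ≡ encode x ⊗ encode y
  encode-⊗ x y = encode-cong (R.*-cong (R.sym (decode-encode x)) (R.sym (decode-encode y)))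

  encode-⊖ : ∀ x → encode (A.⊖ x) ≡ ⊖ encode x
  encode-⊖ x = encode-cong (R.-‿cong (R.sym (decode-encode x)))

  encode-↑ : ∀ x n → encode (x A.↑ n) ≡ encode x ↑ n
  encode-↑ x zero = refl
  encode-↑ x (suc n) = trans (encode-⊗ x (x A.↑ n)) (cong (encode x ⊗_) (encode-↑ x n))

  encode-sum : ∀ {r} (f : Fin r → A.Carrier) → encode (A.sum f) ≡ Sums.sum (λ i → encode (f i))
  encode-sum {zero} f = refl
  encode-sum {suc r} f = trans (encode-⊕ (f zero) (A.sum (f ∘ suc))) (cong (encode (f zero) ⊕_) (encode-sum (f ∘ suc)))

-- The frequencies as rational numbers

module Rationals where
  open Data.Rational.Solver.+-*-Solver
  open ≡-Reasoning

  -- On `+ n` this agrees definitionally with `fromℕ n`.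
  ψ : ℤ → ℚ
  ψ i = i ℚ./ 1

  private
    toℚᵘ-ψ : ∀ i → ℚ.toℚᵘ (ψ i) ℚᵘ.≃ ℚᵘ.mkℚᵘ i 0
    toℚᵘ-ψ i = ℚ.toℚᵘ-fromℚᵘ (ℚᵘ.mkℚᵘ i 0)

  -- Sums of normalised fractions do not compute on variables, so the identity is checked on
  -- unnormalised fractions with denominator 1.
  ψ-+ : ∀ i j → ψ (i ℤ.+ j) ≡ ψ i ℚ.+ ψ j
  ψ-+ i j = ℚ.toℚᵘ-injective (ℚᵘ.≃-trans (toℚᵘ-ψ (i ℤ.+ j)) (ℚᵘ.≃-sym (ℚᵘ.≃-trans (ℚ.toℚᵘ-homo-+ (ψ i) (ψ j))
    (ℚᵘ.≃-trans (ℚᵘ.+-cong (toℚᵘ-ψ i) (toℚᵘ-ψ j)) (ℚᵘ.*≡* (identity i j))))))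
    where
    identity : ∀ i j → (i ℤ.* 1ℤ ℤ.+ j ℤ.* 1ℤ) ℤ.* 1ℤ ≡ (i ℤ.+ j) ℤ.* 1ℤ
    identity = ℤ-solve-∀

  ψ-* : ∀ i j → ψ (i ℤ.* j) ≡ ψ i ℚ.* ψ j
  ψ-* i j = ℚ.toℚᵘ-injective (ℚᵘ.≃-trans (toℚᵘ-ψ (i ℤ.* j)) (ℚᵘ.≃-sym (ℚᵘ.≃-trans (ℚ.toℚᵘ-homo-* (ψ i) (ψ j))
    (ℚᵘ.≃-trans (ℚᵘ.*-cong (toℚᵘ-ψ i) (toℚᵘ-ψ j)) (ℚᵘ.*≡* refl)))))

  ψ-neg : ∀ i → ψ (ℤ.- i) ≡ ℚ.- ψ i
  ψ-neg i = ℚ.toℚᵘ-injective (ℚᵘ.≃-trans (toℚᵘ-ψ (ℤ.- i)) (ℚᵘ.≃-sym (ℚᵘ.≃-trans (ℚ.toℚᵘ-homo‿- (ψ i))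
    (ℚᵘ.-‿cong (toℚᵘ-ψ i)))))

  ψ-minus : ∀ i j → ψ (i ℤ.- j) ≡ ψ i ℚ.- ψ j
  ψ-minus i j = trans (ψ-+ i (ℤ.- j)) (cong (ψ i ℚ.+_) (ψ-neg j))

  two : ℚ
  two = + 2 ℚ./ 1

  -- The integers a and b are (P + S) / 2 and (P - S) / 2, given by their doubles; the factors 1/4
  -- in the stated frequencies come from their squares.
  module Frequency (q P S a b : ℤ) (P≡S² : P ≡ S ℤ.* S) (2a : + 2 ℤ.* a ≡ P ℤ.+ S) (2b : + 2 ℤ.* b ≡ P ℤ.- S) where
    open FrequencyPolynomial using (value)

    private
      2aℚ : two ℚ.* ψ a ≡ ψ P ℚ.+ ψ S
      2aℚ = trans (sym (ψ-* (+ 2) a)) (trans (cong ψ 2a) (ψ-+ P S))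
      2bℚ : two ℚ.* ψ b ≡ ψ P ℚ.- ψ S
      2bℚ = trans (sym (ψ-* (+ 2) b)) (trans (cong ψ 2b) (ψ-minus P S))
      q-1 : ψ (q ℤ.- 1ℤ) ≡ ψ q ℚ.- ℚ.1ℚ
      q-1 = ψ-minus q 1ℤ
      product : ∀ x y z → ψ (x ℤ.* y ℤ.* z) ≡ ψ x ℚ.* ψ y ℚ.* ψ z
      product x y z = trans (ψ-* (x ℤ.* y) z) (cong (ℚ._* ψ z) (ψ-* x y))

    value₁ : ψ (value q P a b 1F) ≡ two ℚ.* (ψ q ℚ.- ℚ.1ℚ)
    value₁ = trans (ψ-* (+ 2) (q ℤ.- 1ℤ)) (cong (two ℚ.*_) q-1)

    private
      quarter-square : ∀ x y z → two ℚ.* y ≡ z → x ℚ.* (y ℚ.* y) ≡ (+ 1 ℚ./ 4) ℚ.* x ℚ.* (z ℚ.* z)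
      quarter-square x y z refl = solve 2 (λ x y → x :* (y :* y) :=
        con (+ 1 ℚ./ 4) :* x :* ((con two :* y) :* (con two :* y))) refl x y

    value₂ : ψ (value q P a b 2F) ≡ (+ 1 ℚ./ 4) ℚ.* (ψ q ℚ.- ℚ.1ℚ) ℚ.* ((ψ P ℚ.+ ψ S) ℚ.* (ψ P ℚ.+ ψ S))
    value₂ = trans (trans (ψ-* (q ℤ.- 1ℤ) (a ℤ.* a)) (cong₂ ℚ._*_ q-1 (ψ-* a a))) (quarter-square (ψ q ℚ.- ℚ.1ℚ) (ψ a) (ψ P ℚ.+ ψ S) 2aℚ)

    value₃ : ψ (value q P a b 3F) ≡ (ψ q ℚ.- ℚ.1ℚ) ℚ.* (ψ q ℚ.- ψ P) ℚ.* (ψ P ℚ.+ ψ S)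
    value₃ = trans (product (q ℤ.- 1ℤ) (q ℤ.- P) (+ 2 ℤ.* a))
      (cong₂ ℚ._*_ (cong₂ ℚ._*_ q-1 (ψ-minus q P)) (trans (ψ-* (+ 2) a) 2aℚ))

    value₅ : ψ (value q P a b 5F) ≡ (ψ q ℚ.- ℚ.1ℚ) ℚ.* (ψ q ℚ.- ψ P) ℚ.* (ψ P ℚ.- ψ S)
    value₅ = trans (product (q ℤ.- 1ℤ) (q ℤ.- P) (+ 2 ℤ.* b))
      (cong₂ ℚ._*_ (cong₂ ℚ._*_ q-1 (ψ-minus q P)) (trans (ψ-* (+ 2) b) 2bℚ))

    value₆ : ψ (value q P a b 6F) ≡ (+ 1 ℚ./ 4) ℚ.* (ψ q ℚ.- ℚ.1ℚ) ℚ.* ((ψ P ℚ.- ψ S) ℚ.* (ψ P ℚ.- ψ S))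
    value₆ = trans (trans (ψ-* (q ℤ.- 1ℤ) (b ℤ.* b)) (cong₂ ℚ._*_ q-1 (ψ-* b b))) (quarter-square (ψ q ℚ.- ℚ.1ℚ) (ψ b) (ψ P ℚ.- ψ S) 2bℚ)

    -- Here 2 a b = (P² - S²) / 2 = (P² - P) / 2. Together with the P² from (q - P)² this produces
    -- the coefficients 3/2 and - 1/2.
    value₄ : ψ (value q P a b 4F) ≡ (ψ q ℚ.- ℚ.1ℚ) ℚ.*
      (ψ (q ℤ.* q) ℚ.+ (+ 3 ℚ./ 2) ℚ.* ψ (P ℤ.* P) ℚ.- two ℚ.* ψ (q ℤ.* P) ℚ.+ ψ q ℚ.- ℚ.½ ℚ.* ψ P ℚ.- ℚ.1ℚ)
    value₄ = begin
      ψ ((q ℤ.- 1ℤ) ℤ.* ((q ℤ.- P) ℤ.* (q ℤ.- P) ℤ.+ + 2 ℤ.* (a ℤ.* b) ℤ.+ (q ℤ.- 1ℤ)))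
        ≡⟨ trans (ψ-* (q ℤ.- 1ℤ) _) (cong₂ ℚ._*_ q-1 (trans (ψ-+ ((q ℤ.- P) ℤ.* (q ℤ.- P) ℤ.+ + 2 ℤ.* (a ℤ.* b)) (q ℤ.- 1ℤ))
             (cong₂ ℚ._+_ (trans (ψ-+ ((q ℤ.- P) ℤ.* (q ℤ.- P)) (+ 2 ℤ.* (a ℤ.* b)))
               (cong₂ ℚ._+_ (trans (ψ-* (q ℤ.- P) (q ℤ.- P)) (cong₂ ℚ._*_ (ψ-minus q P) (ψ-minus q P)))
                 (trans (ψ-* (+ 2) (a ℤ.* b)) (cong (two ℚ.*_) (ψ-* a b))))) q-1))) ⟩
      (ψ q ℚ.- ℚ.1ℚ) ℚ.* ((ψ q ℚ.- ψ P) ℚ.* (ψ q ℚ.- ψ P) ℚ.+ two ℚ.* (ψ a ℚ.* ψ b) ℚ.+ (ψ q ℚ.- ℚ.1ℚ))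
        ≡⟨ cong (λ x → (ψ q ℚ.- ℚ.1ℚ) ℚ.* ((ψ q ℚ.- ψ P) ℚ.* (ψ q ℚ.- ψ P) ℚ.+ x ℚ.+ (ψ q ℚ.- ℚ.1ℚ))) cross ⟩
      (ψ q ℚ.- ℚ.1ℚ) ℚ.* ((ψ q ℚ.- ψ P) ℚ.* (ψ q ℚ.- ψ P) ℚ.+ ℚ.½ ℚ.* (ψ P ℚ.* ψ P ℚ.- ψ P) ℚ.+ (ψ q ℚ.- ℚ.1ℚ))
        ≡⟨ solve 2 (λ q P → (q :- con ℚ.1ℚ) :* ((q :- P) :* (q :- P) :+ con ℚ.½ :* (P :* P :- P) :+ (q :- con ℚ.1ℚ)) :=
             (q :- con ℚ.1ℚ) :* (q :* q :+ con (+ 3 ℚ./ 2) :* (P :* P) :- con two :* (q :* P) :+ q :- con ℚ.½ :* P :- con ℚ.1ℚ))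
             refl (ψ q) (ψ P) ⟩
      (ψ q ℚ.- ℚ.1ℚ) ℚ.* (ψ q ℚ.* ψ q ℚ.+ (+ 3 ℚ./ 2) ℚ.* (ψ P ℚ.* ψ P) ℚ.- two ℚ.* (ψ q ℚ.* ψ P) ℚ.+ ψ q ℚ.- ℚ.½ ℚ.* ψ P ℚ.- ℚ.1ℚ)
        ≡⟨ cong₂ (λ x y → (ψ q ℚ.- ℚ.1ℚ) ℚ.* (x ℚ.+ (+ 3 ℚ./ 2) ℚ.* y ℚ.- two ℚ.* (ψ q ℚ.* ψ P) ℚ.+ ψ q ℚ.- ℚ.½ ℚ.* ψ P ℚ.- ℚ.1ℚ))
             (sym (ψ-* q q)) (sym (ψ-* P P)) ⟩
      (ψ q ℚ.- ℚ.1ℚ) ℚ.* (ψ (q ℤ.* q) ℚ.+ (+ 3 ℚ./ 2) ℚ.* ψ (P ℤ.* P) ℚ.- two ℚ.* (ψ q ℚ.* ψ P) ℚ.+ ψ q ℚ.- ℚ.½ ℚ.* ψ P ℚ.- ℚ.1ℚ)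
        ≡⟨ cong (λ x → (ψ q ℚ.- ℚ.1ℚ) ℚ.* (ψ (q ℤ.* q) ℚ.+ (+ 3 ℚ./ 2) ℚ.* ψ (P ℤ.* P) ℚ.- two ℚ.* x ℚ.+ ψ q ℚ.- ℚ.½ ℚ.* ψ P ℚ.- ℚ.1ℚ))
             (sym (ψ-* q P)) ⟩
      (ψ q ℚ.- ℚ.1ℚ) ℚ.* (ψ (q ℤ.* q) ℚ.+ (+ 3 ℚ./ 2) ℚ.* ψ (P ℤ.* P) ℚ.- two ℚ.* ψ (q ℤ.* P) ℚ.+ ψ q ℚ.- ℚ.½ ℚ.* ψ P ℚ.- ℚ.1ℚ) ∎
      where
      cross : two ℚ.* (ψ a ℚ.* ψ b) ≡ ℚ.½ ℚ.* (ψ P ℚ.* ψ P ℚ.- ψ P)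
      cross = begin
        two ℚ.* (ψ a ℚ.* ψ b)
          ≡⟨ solve 2 (λ a b → con two :* (a :* b) := con ℚ.½ :* ((con two :* a) :* (con two :* b))) refl (ψ a) (ψ b) ⟩
        ℚ.½ ℚ.* ((two ℚ.* ψ a) ℚ.* (two ℚ.* ψ b))
          ≡⟨ cong₂ (λ x y → ℚ.½ ℚ.* (x ℚ.* y)) 2aℚ 2bℚ ⟩
        ℚ.½ ℚ.* ((ψ P ℚ.+ ψ S) ℚ.* (ψ P ℚ.- ψ S))
          ≡⟨ solve 2 (λ P S → con ℚ.½ :* ((P :+ S) :* (P :- S)) := con ℚ.½ :* (P :* P :- S :* S)) refl (ψ P) (ψ S) ⟩
        ℚ.½ ℚ.* (ψ P ℚ.* ψ P ℚ.- ψ S ℚ.* ψ S)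
          ≡⟨ cong (λ x → ℚ.½ ℚ.* (ψ P ℚ.* ψ P ℚ.- x)) (trans (sym (ψ-* S S)) (cong ψ (sym P≡S²))) ⟩
        ℚ.½ ℚ.* (ψ P ℚ.* ψ P ℚ.- ψ P) ∎

odd-form : ∀ n → ¬ (2 ∣ n) → ∃ λ r → n ≡ suc (r ℕ.+ r)
odd-form zero odd = contradiction (divides 0 refl) odd
odd-form (suc zero) odd = 0 , refl
odd-form (suc (suc n)) odd with odd-form n (λ { (divides c eq) → odd (divides (suc c) (cong (2 ℕ.+_) eq)) })
... | r , refl = suc r , cong (2 ℕ.+_) (sym (ℕ.+-suc r r))

[n+n]/2≡n : ∀ n → (n ℕ.+ n) / 2 ≡ n
[n+n]/2≡n n = trans (cong (_/ 2) (identity n)) (m*n/n≡m n 2)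
  where
  identity : ∀ n → n ℕ.+ n ≡ n ℕ.* 2
  identity = ℕ-solve-∀

-- The quadratic forms of a codeword

module Theory {p h r k : ℕ} (setting : Setting p h r k) where
  open Setting setting public
  open FieldTheory F public
  module KT = FieldTheory K
  open ≡-Reasoning
  private module Sums = Algebra.Properties.Semiring.Sum semiring

  m q P S : ℕ
  m = suc (r ℕ.+ r)
  q = p ^ m
  P = p ^ (r ℕ.+ r)
  S = p ^ r

  p>1 : 1 < p
  p>1 = ℕ.nonTrivial⇒n>1 p {{prime⇒nonTrivial p-prime}}

  instance
    p-nonZero : ℕ.NonZero p
    p-nonZero = prime⇒nonZero p-prime

  ι-𝟘 : ι K.𝟘 ≡ 𝟘
  ι-𝟘 = +-cancelˡ (ι K.𝟘) (ι K.𝟘) 𝟘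
    (trans (sym (ι-+ K.𝟘 K.𝟘)) (trans (cong ι (K.+-identityˡ K.𝟘)) (sym (+-identityʳ _))))

  ι-neg : ∀ s → ι (K.⊖ s) ≡ ⊖ ι s
  ι-neg s = +-inverseˡ-unique (ι (K.⊖ s)) (ι s)
    (trans (sym (ι-+ (K.⊖ s) s)) (trans (cong ι (K.-‿inverseˡ s)) ι-𝟘))

  ι-nonzero : ∀ {s} → s ≢ K.𝟘 → ι s ≢ 𝟘
  ι-nonzero {s} s≢𝟘 eq with K.inverse s s≢𝟘
  ... | s⁻¹ , inv = 𝟘≢𝟙 (begin
    𝟘               ≡⟨ zeroˡ (ι s⁻¹) ⟨
    𝟘 ⊗ ι s⁻¹       ≡⟨ cong (_⊗ ι s⁻¹) eq ⟨
    ι s ⊗ ι s⁻¹     ≡⟨ ι-* s s⁻¹ ⟨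
    ι (s K.⊗ s⁻¹)   ≡⟨ cong ι inv ⟩
    ι K.𝟙           ≡⟨ ι-𝟙 ⟩
    𝟙               ∎)

  ι-injective : Injective _≡_ _≡_ ι
  ι-injective {s} {t} eq with (s K.⊕ K.⊖ t) Fin.≟ K.𝟘
  ... | yes s-t≡𝟘 = K.sub≡𝟘⇒≡ s-t≡𝟘
  ... | no s-t≢𝟘 = contradiction
    (trans (ι-+ s (K.⊖ t)) (trans (cong₂ _⊕_ eq (ι-neg t)) (-‿inverseʳ (ι t)))) (ι-nonzero s-t≢𝟘)

  ι-↑ : ∀ s n → ι (s K.↑ n) ≡ ι s ↑ n
  ι-↑ s zero = ι-𝟙
  ι-↑ s (suc n) = trans (ι-* s (s K.↑ n)) (cong (ι s ⊗_) (ι-↑ s n))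

  ι-· : ∀ n s → ι (n KT.· s) ≡ n · ι s
  ι-· zero s = ι-𝟘
  ι-· (suc n) s = trans (ι-+ s (n KT.· s)) (cong (ι s ⊕_) (ι-· n s))

  ·≡* : ∀ n x → n · x ≡ (n · 𝟙) ⊗ x
  ·≡* zero x = sym (zeroˡ x)
  ·≡* (suc n) x = trans (cong₂ _⊕_ (sym (*-identityˡ x)) (·≡* n x)) (sym (distribʳ x 𝟙 (n · 𝟙)))

  p·𝟙 : p · 𝟙 ≡ 𝟘
  p·𝟙 = trans (cong (p ·_) (sym ι-𝟙))
    (trans (sym (ι-· p K.𝟙)) (trans (cong ι (KT.order-annihilates K.𝟙)) ι-𝟘))

  characteristic : ∀ x → p · x ≡ 𝟘
  characteristic x = trans (·≡* p x) (trans (cong (_⊗ x) p·𝟙) (zeroˡ x))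

  open OddCharacteristic (odd-characteristic {h} (subst (λ n → n · 𝟙 ≡ 𝟘) p-odd p·𝟙)) public
  module KO = KT.OddCharacteristic
    (KT.odd-characteristic {h} (subst (λ n → n KT.· K.𝟙 ≡ K.𝟘) p-odd (KT.order-annihilates K.𝟙)))

  -- Powers of the Frobenius map and their fixed field

  φ : ℕ → Fin q → Fin q
  φ j x = x ↑ (p ^ j)

  φ-+ : ∀ j x y → φ j (x ⊕ y) ≡ φ j x ⊕ φ j y
  φ-+ zero x y = trans (↑-one _) (sym (cong₂ _⊕_ (↑-one x) (↑-one y)))
  φ-+ (suc j) x y = begin
    (x ⊕ y) ↑ (p ℕ.* p ^ j)            ≡⟨ ^-assocʳ (x ⊕ y) p (p ^ j) ⟨
    φ j ((x ⊕ y) ↑ p)                  ≡⟨ cong (φ j) (freshman p-prime characteristic x y) ⟩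
    φ j (x ↑ p ⊕ y ↑ p)                ≡⟨ φ-+ j (x ↑ p) (y ↑ p) ⟩
    φ j (x ↑ p) ⊕ φ j (y ↑ p)          ≡⟨ cong₂ _⊕_ (^-assocʳ x p (p ^ j)) (^-assocʳ y p (p ^ j)) ⟩
    φ (suc j) x ⊕ φ (suc j) y          ∎

  φ-* : ∀ j x y → φ j (x ⊗ y) ≡ φ j x ⊗ φ j y
  φ-* j x y = ^-distrib-* x y (p ^ j)

  φ-∘ : ∀ i j x → φ i (φ j x) ≡ φ (j ℕ.+ i) x
  φ-∘ i j x = trans (^-assocʳ x (p ^ j) (p ^ i)) (cong (x ↑_) (sym (ℕ.^-distribˡ-+-* p j i)))

  φ-0 : ∀ x → φ 0 x ≡ x
  φ-0 = ↑-one

  φ-m : ∀ x → φ m x ≡ x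
  φ-m = fermat

  φ-ι : ∀ j s → φ j (ι s) ≡ ι s
  φ-ι zero s = φ-0 (ι s)
  φ-ι (suc j) s = begin
    φ (suc j) (ι s)     ≡⟨ ^-assocʳ (ι s) p (p ^ j) ⟨
    φ j (ι s ↑ p)       ≡⟨ cong (φ j) (trans (sym (ι-↑ s p)) (cong ι (KT.fermat s))) ⟩
    φ j (ι s)           ≡⟨ φ-ι j s ⟩
    ι s                 ∎

  φ-neg : ∀ j x → φ j (⊖ x) ≡ ⊖ φ j x
  φ-neg j x = +-inverseˡ-unique _ _
    (trans (sym (φ-+ j (⊖ x) x)) (trans (cong (φ j) (-‿inverseˡ x)) φ-𝟘))
    where
    φ-𝟘 = 𝟘↑ (p ^ j) {{ℕ.m^n≢0 p j}}

  φ-fixed-multiple : ∀ {x} j → φ j x ≡ x → ∀ i → φ (i ℕ.* j) x ≡ x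
  φ-fixed-multiple {x} j eq zero = φ-0 x
  φ-fixed-multiple {x} j eq (suc i) = begin
    φ (j ℕ.+ i ℕ.* j) x      ≡⟨ φ-∘ (i ℕ.* j) j x ⟨
    φ (i ℕ.* j) (φ j x)      ≡⟨ cong (φ (i ℕ.* j)) eq ⟩
    φ (i ℕ.* j) x            ≡⟨ φ-fixed-multiple j eq i ⟩
    x                        ∎

  _∈K : Fin q → Set
  x ∈K = ∃ λ s → ι s ≡ x

  -- Otherwise x and the p elements of the image of K would be p + 1 roots of the monic polynomial x
  -- ^ p - x.
  φ-fixed⇒∈K : ∀ {x} → φ 1 x ≡ x → x ∈K
  φ-fixed⇒∈K {x} fixed with Fin.any? (λ s → ι s Fin.≟ x)
  ... | yes found = found
  ... | no missed = contradiction (root-bound x^p-x roots roots-injective roots-vanish)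
    (λ 1≡0 → 𝟘≢𝟙 (sym (trans (sym (+-identityʳ 𝟙)) 1≡0)))
    where
    x^p-x : Poly p (𝟙 ⊕ 𝟘) (λ x → x ↑ p ⊕ ⊖ 𝟙 ⊗ x ↑ 1)
    x^p-x = Poly-+ (Poly-↑ p) (Poly-lift p>1 (Poly-* (⊖ 𝟙) (Poly-↑ 1)))
    roots : Fin (suc p) → Fin q
    roots zero = x
    roots (suc s) = ι s
    roots-injective : Injective _≡_ _≡_ roots
    roots-injective {zero} {zero} eq = refl
    roots-injective {zero} {suc t} eq = contradiction (t , sym eq) missed
    roots-injective {suc s} {zero} eq = contradiction (s , eq) missed
    roots-injective {suc s} {suc t} eq = cong suc (ι-injective eq)
    vanish : ∀ {y} → φ 1 y ≡ y → y ↑ p ⊕ ⊖ 𝟙 ⊗ y ↑ 1 ≡ 𝟘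
    vanish {y} eq = trans
      (cong₂ (λ u v → u ⊕ ⊖ 𝟙 ⊗ v) (trans (cong (y ↑_) (sym (ℕ.*-identityʳ p))) eq) (↑-one y))
      (solve 1 (λ y → y :+ (:- con ℤ.1ℤ) :* y := con ℤ.0ℤ) refl y)
    roots-vanish : ∀ i → roots i ↑ p ⊕ ⊖ 𝟙 ⊗ roots i ↑ 1 ≡ 𝟘
    roots-vanish zero = vanish fixed
    roots-vanish (suc s) = vanish (φ-ι 1 s)

  -- A fixed point of φ k is also fixed by φ m, hence by φ 1, since 1 is an integer combination of k
  -- and m. Exponents are natural numbers, so the two sign patterns of the Bézout identity are
  -- treated separately.
  σ-fixed⇒∈K : ∀ {x} → φ k x ≡ x → x ∈K
  σ-fixed⇒∈K {x} fixed with coprime-Bézout coprime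
  ... | GCD.Bézout.Identity.+- a b 1+bk≡am = φ-fixed⇒∈K (begin
    φ 1 x                     ≡⟨ cong (φ 1) (φ-fixed-multiple k fixed b) ⟨
    φ 1 (φ (b ℕ.* k) x)       ≡⟨ φ-∘ 1 (b ℕ.* k) x ⟩
    φ (b ℕ.* k ℕ.+ 1) x       ≡⟨ cong (λ j → φ j x) (trans (ℕ.+-comm (b ℕ.* k) 1) 1+bk≡am) ⟩
    φ (a ℕ.* m) x             ≡⟨ φ-fixed-multiple m (φ-m x) a ⟩
    x                         ∎)
  ... | GCD.Bézout.Identity.-+ a b 1+am≡bk = φ-fixed⇒∈K (begin
    φ 1 x                     ≡⟨ cong (φ 1) (φ-fixed-multiple m (φ-m x) a) ⟨
    φ 1 (φ (a ℕ.* m) x)       ≡⟨ φ-∘ 1 (a ℕ.* m) x ⟩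
    φ (a ℕ.* m ℕ.+ 1) x       ≡⟨ cong (λ j → φ j x) (trans (ℕ.+-comm (a ℕ.* m) 1) 1+am≡bk) ⟩
    φ (b ℕ.* k) x             ≡⟨ φ-fixed-multiple k fixed b ⟩
    x                         ∎)

  -- If φ x = - x then x = φᵐ x = - x because m is odd.
  square∈K⇒∈K : ∀ {x} → (x ⊗ x) ∈K → x ∈K
  square∈K⇒∈K {x} (s , ιs≡x²) with squares-equal {φ 1 x} {x}
    (trans (sym (φ-* 1 x x)) (trans (cong (φ 1) (sym ιs≡x²)) (trans (φ-ι 1 s) ιs≡x²)))
  ... | inj₁ fixed = φ-fixed⇒∈K fixed
  ... | inj₂ negated = K.𝟘 , trans ι-𝟘 (sym (self-negative x≡-x))
    where
    twice : φ 2 x ≡ x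
    twice = begin
      φ 2 x              ≡⟨ φ-∘ 1 1 x ⟨
      φ 1 (φ 1 x)        ≡⟨ cong (φ 1) negated ⟩
      φ 1 (⊖ x)          ≡⟨ φ-neg 1 x ⟩
      ⊖ φ 1 x            ≡⟨ cong ⊖_ negated ⟩
      ⊖ ⊖ x              ≡⟨ -‿involutive x ⟩
      x                  ∎
    x≡-x : x ≡ ⊖ x
    x≡-x = begin
      x                          ≡⟨ φ-m x ⟨
      φ (suc (r ℕ.+ r)) x        ≡⟨ cong (λ j → φ j x) (trans (ℕ.+-comm 1 (r ℕ.+ r))
                                      (cong (ℕ._+ 1) (trans (cong (ℕ._+_ r) (sym (ℕ.+-identityʳ r))) (ℕ.*-comm 2 r)))) ⟩
      φ (r ℕ.* 2 ℕ.+ 1) x        ≡⟨ φ-∘ 1 (r ℕ.* 2) x ⟨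
      φ 1 (φ (r ℕ.* 2) x)        ≡⟨ cong (φ 1) (φ-fixed-multiple 2 twice r) ⟩
      φ 1 x                      ≡⟨ negated ⟩
      ⊖ x                        ∎

  -- The trace

  conjugateSum : ℕ → Fin q → Fin q
  conjugateSum j x = Sums.sum {suc j} (λ i → φ (toℕ i) x)

  Tr-+ : ∀ x y → Tr (x ⊕ y) ≡ Tr x K.⊕ Tr y
  Tr-+ x y = ι-injective (begin
    ι (Tr (x ⊕ y))                                     ≡⟨ Tr-conjugates (x ⊕ y) ⟩
    conjugateSum (r ℕ.+ r) (x ⊕ y)                     ≡⟨ Sums.sum-cong-≗ {m} (λ i → φ-+ (toℕ i) x y) ⟩
    Sums.sum {m} (λ i → φ (toℕ i) x ⊕ φ (toℕ i) y)      ≡⟨ Sums.∑-distrib-+ {m} (λ i → φ (toℕ i) x) (λ i → φ (toℕ i) y) ⟩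
    conjugateSum (r ℕ.+ r) x ⊕ conjugateSum (r ℕ.+ r) y  ≡⟨ cong₂ _⊕_ (Tr-conjugates x) (Tr-conjugates y) ⟨
    ι (Tr x) ⊕ ι (Tr y)                                ≡⟨ ι-+ (Tr x) (Tr y) ⟨
    ι (Tr x K.⊕ Tr y)                                  ∎)

  Tr-scale : ∀ s x → Tr (ι s ⊗ x) ≡ s K.⊗ Tr x
  Tr-scale s x = ι-injective (begin
    ι (Tr (ι s ⊗ x))                          ≡⟨ Tr-conjugates (ι s ⊗ x) ⟩
    conjugateSum (r ℕ.+ r) (ι s ⊗ x)
      ≡⟨ Sums.sum-cong-≗ {m} (λ i → trans (φ-* (toℕ i) (ι s) x) (cong (_⊗ φ (toℕ i) x) (φ-ι (toℕ i) s))) ⟩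
    Sums.sum {m} (λ i → ι s ⊗ φ (toℕ i) x)     ≡⟨ Sums.*-distribˡ-sum {m} (ι s) (λ i → φ (toℕ i) x) ⟨
    ι s ⊗ conjugateSum (r ℕ.+ r) x            ≡⟨ cong (ι s ⊗_) (Tr-conjugates x) ⟨
    ι s ⊗ ι (Tr x)                            ≡⟨ ι-* s (Tr x) ⟨
    ι (s K.⊗ Tr x)                            ∎)

  Tr-𝟘 : Tr 𝟘 ≡ K.𝟘
  Tr-𝟘 = K.+-cancelˡ (Tr 𝟘) (Tr 𝟘) K.𝟘
    (trans (sym (Tr-+ 𝟘 𝟘)) (trans (cong Tr (+-identityˡ 𝟘)) (sym (K.+-identityʳ _))))

  Tr-neg : ∀ x → Tr (⊖ x) ≡ K.⊖ Tr x
  Tr-neg x = K.+-inverseˡ-unique _ _ (trans (sym (Tr-+ (⊖ x) x)) (trans (cong Tr (-‿inverseˡ x)) Tr-𝟘))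

  -- Frobenius permutes the conjugates cyclically: the one that leaves at the end is φ m x = x,
  -- which is the missing first one.
  Tr-φ₁ : ∀ x → Tr (φ 1 x) ≡ Tr x
  Tr-φ₁ x = ι-injective (begin
    ι (Tr (φ 1 x))                                 ≡⟨ Tr-conjugates (φ 1 x) ⟩
    Sums.sum {m} (λ i → φ (toℕ i) (φ 1 x))          ≡⟨ Sums.sum-cong-≗ {m} (λ i → φ-∘ (toℕ i) 1 x) ⟩
    Sums.sum {m} (λ i → φ (suc (toℕ i)) x)          ≡⟨ Sums.sum-init-last {r ℕ.+ r} (λ i → φ (suc (toℕ i)) x) ⟩
    Sums.sum {r ℕ.+ r} (λ i → φ (suc (toℕ (inject₁ i))) x) ⊕ φ (suc (toℕ (top (r ℕ.+ r)))) x
      ≡⟨ cong₂ _⊕_ (Sums.sum-cong-≗ {r ℕ.+ r} λ i → cong (λ j → φ (suc j) x) (Fin.toℕ-inject₁ i))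
           (trans (cong (λ j → φ (suc j) x) (Fin.toℕ-fromℕ (r ℕ.+ r))) (trans (φ-m x) (sym (φ-0 x)))) ⟩
    Sums.sum {r ℕ.+ r} (λ i → φ (suc (toℕ i)) x) ⊕ φ 0 x   ≡⟨ +-comm _ _ ⟩
    conjugateSum (r ℕ.+ r) x                              ≡⟨ Tr-conjugates x ⟨
    ι (Tr x)                                              ∎)

  Tr-φ : ∀ j x → Tr (φ j x) ≡ Tr x
  Tr-φ zero x = cong Tr (φ-0 x)
  Tr-φ (suc j) x = trans (cong Tr (sym (φ-∘ j 1 x))) (trans (Tr-φ j (φ 1 x)) (Tr-φ₁ x))

  conjugateSum-Poly : ∀ j → Poly (p ^ j) 𝟙 (conjugateSum j)
  conjugateSum-Poly zero = Poly-cong refl (λ x → sym (+-identityʳ _)) (Poly-↑ 1)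
  conjugateSum-Poly (suc j) = Poly-cong (+-identityˡ 𝟙)
    (λ x → sym (trans (Sums.sum-init-last {suc j} (λ i → φ (toℕ i) x))
      (cong₂ _⊕_ (Sums.sum-cong-≗ {suc j} λ i → cong (λ l → φ l x) (Fin.toℕ-inject₁ i))
        (cong (λ l → φ l x) (Fin.toℕ-fromℕ (suc j))))))
    (Poly-+ (Poly-lift (ℕ.^-monoʳ-< p p>1 (ℕ.n<1+n j)) (conjugateSum-Poly j)) (Poly-↑ (p ^ suc j)))

  P<q : P < q
  P<q = ℕ.^-monoʳ-< p p>1 (ℕ.n<1+n (r ℕ.+ r))

  -- The conjugate sum is a monic polynomial of degree P < q, so it cannot vanish on the first P + 1
  -- elements of F.
  Tr-nontrivial : ∃ λ x → Tr x ≢ K.𝟘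
  Tr-nontrivial with Fin.any? (λ x → ¬? (Tr x Fin.≟ K.𝟘))
  ... | yes found = found
  ... | no missed = contradiction
    (root-bound (conjugateSum-Poly (r ℕ.+ r)) (λ i → inject≤ i P<q) (Fin.inject≤-injective P<q P<q _ _)
      (λ i → vanish (inject≤ i P<q)))
    (𝟘≢𝟙 ∘ sym)
    where
    vanish : ∀ x → conjugateSum (r ℕ.+ r) x ≡ 𝟘
    vanish x = trans (sym (Tr-conjugates x))
      (trans (cong ι (decidable-stable (Tr x Fin.≟ K.𝟘) (λ Trx≢𝟘 → missed (x , Trx≢𝟘)))) ι-𝟘)

  Tr-surjective : ∀ s → ∃ λ x → Tr x ≡ s
  Tr-surjective s with Tr-nontrivial
  ... | x , Trx≢𝟘 with K.inverse (Tr x) Trx≢𝟘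
  ...   | t , inv = ι (s K.⊗ t) ⊗ x , (begin
    Tr (ι (s K.⊗ t) ⊗ x)      ≡⟨ Tr-scale (s K.⊗ t) x ⟩
    (s K.⊗ t) K.⊗ Tr x        ≡⟨ K.*-assoc s t (Tr x) ⟩
    s K.⊗ (t K.⊗ Tr x)        ≡⟨ cong (s K.⊗_) (trans (K.*-comm t (Tr x)) inv) ⟩
    s K.⊗ K.𝟙                 ≡⟨ K.*-identityʳ s ⟩
    s                         ∎)

  -- Powers of the primitive element

  module Powers where
    open ≡-Reasoning

    H : ℕ
    H = proj₁ (odd-power {h = h} p-odd m)

    q≡1+2H : q ≡ suc (H ℕ.+ H)
    q≡1+2H = proj₂ (odd-power {h = h} p-odd m)

    H-positive : 0 < H
    H-positive with H | q≡1+2H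
    ... | zero | q≡1 = contradiction (sym q≡1)
      (ℕ.<⇒≢ (ℕ.≤-<-trans (ℕ.>-nonZero⁻¹ P {{ℕ.m^n≢0 p (r ℕ.+ r)}}) P<q))
    ... | suc _ | _ = s≤s z≤n

    private
      instance
        H-nonZero : ℕ.NonZero (H ℕ.+ H)
        H-nonZero = ℕ.>-nonZero (ℕ.<-≤-trans H-positive (ℕ.m≤m+n H H))

    π^M≡𝟙 : π ↑ (H ℕ.+ H) ≡ 𝟙
    π^M≡𝟙 = *-cancelˡ π π-nonzero
      (trans (cong (π ↑_) (sym q≡1+2H)) (trans (fermat π) (sym (*-identityʳ π))))

    π^-reduce : ∀ t → π ↑ t ≡ π ↑ (t % (H ℕ.+ H))
    π^-reduce t = begin
      π ↑ t                                    ≡⟨ cong (π ↑_) (m≡m%n+[m/n]*n t M) ⟩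
      π ↑ (t % M ℕ.+ t / M ℕ.* M)              ≡⟨ ^-homo-* π (t % M) (t / M ℕ.* M) ⟩
      π ↑ (t % M) ⊗ π ↑ (t / M ℕ.* M)          ≡⟨ cong (π ↑ (t % M) ⊗_) (trans (cong (π ↑_) (ℕ.*-comm (t / M) M))
                                                    (trans (sym (^-assocʳ π M (t / M))) (trans (cong (_↑ (t / M)) π^M≡𝟙) (𝟙↑ (t / M))))) ⟩
      π ↑ (t % M) ⊗ 𝟙                          ≡⟨ *-identityʳ _ ⟩
      π ↑ (t % M)                              ∎
      where M = H ℕ.+ H

    private
      list : Fin (suc (H ℕ.+ H)) → Fin q
      list zero = 𝟘
      list (suc t) = π ↑ toℕ t

      list-surjective : ∀ x → ∃ λ i → list i ≡ x
      list-surjective x with x Fin.≟ 𝟘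
      ... | yes refl = zero , refl
      ... | no x≢𝟘 with π-generates x x≢𝟘
      ...   | t , refl = suc (fromℕ< (m%n<n t (H ℕ.+ H))) ,
        trans (cong (π ↑_) (Fin.toℕ-fromℕ< (m%n<n t (H ℕ.+ H)))) (sym (π^-reduce t))

      transported : ∀ {a b} → a ≡ b → (f : Fin a → Fin b) → (∀ y → ∃ λ x → f x ≡ y) → Injective _≡_ _≡_ f
      transported refl f surj = surjective⇒injective surj

      list-injective : Injective _≡_ _≡_ list
      list-injective = transported (sym q≡1+2H) list list-surjective

    -- The list 𝟘, 1, π, π², ... of length 1 + 2 H = q reaches every element, so it has no
    -- repetition; the order of π is found by counting alone.
    π^-injective : ∀ {s t} → s < H ℕ.+ H → t < H ℕ.+ H → π ↑ s ≡ π ↑ t → s ≡ t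
    π^-injective {s} {t} s<M t<M eq = Fin.fromℕ<-injective s t s<M t<M
      (Fin.suc-injective (list-injective {suc (fromℕ< s<M)} {suc (fromℕ< t<M)}
        (trans (cong (π ↑_) (Fin.toℕ-fromℕ< s<M)) (trans eq (cong (π ↑_) (sym (Fin.toℕ-fromℕ< t<M)))))))

    π^H≡-𝟙 : π ↑ H ≡ ⊖ 𝟙
    π^H≡-𝟙 = Sum.[ (λ e → contradiction (trivial e) (λ H≡0 → ℕ.<⇒≢ H-positive (sym H≡0))) , (λ e → e) ]′
      (squares-equal {π ↑ H} {𝟙} (trans (sym (^-homo-* π H H)) (trans π^M≡𝟙 (sym (*-identityˡ 𝟙)))))
      where
      trivial : π ↑ H ≡ 𝟙 → H ≡ 0
      trivial = π^-injective (ℕ.m<m+n H H-positive) (ℕ.<-≤-trans H-positive (ℕ.m≤m+n H H))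

    ∑-powers : ∀ f → ∑ f ≡ f 𝟘 ℤ.+ ∑ {H ℕ.+ H} (λ t → f (π ↑ toℕ t))
    ∑-powers f = ∑-reindex (sym q≡1+2H) list-injective f

    -- Since π ^ H = - 1, the second half of the powers of π consists of the negatives of the first
    -- half, and the π ^ s with s < H represent the nonzero elements up to sign.
    ∑-even : ∀ f → (∀ y → f (⊖ y) ≡ f y) → ∑ f ≡ f 𝟘 ℤ.+ + 2 ℤ.* ∑ {H} (λ s → f (π ↑ toℕ s))
    ∑-even f even = trans (∑-powers f) (cong (ℤ._+_ (f 𝟘)) (begin
      ∑ {H ℕ.+ H} (λ t → f (π ↑ toℕ t))                ≡⟨ ∑-halves H H (λ t → f (π ↑ t)) ⟩
      half ℤ.+ ∑ {H} (λ s → f (π ↑ (H ℕ.+ toℕ s)))     ≡⟨ cong (ℤ._+_ half) (∑-cong {H} second) ⟩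
      half ℤ.+ half                                    ≡⟨ double half ⟩
      + 2 ℤ.* half                                     ∎))
      where
      half = ∑ {H} (λ s → f (π ↑ toℕ s))
      double : ∀ x → x ℤ.+ x ≡ + 2 ℤ.* x
      double = ℤ-solve-∀
      second : ∀ s → f (π ↑ (H ℕ.+ toℕ s)) ≡ f (π ↑ toℕ s)
      second s = trans (cong f (trans (^-homo-* π H (toℕ s)) (trans (cong (_⊗ π ↑ toℕ s) π^H≡-𝟙)
        (solve 1 (λ x → (:- con 1ℤ) :* x := :- x) refl (π ↑ toℕ s))))) (even (π ↑ toℕ s))

  -- The forms Q: polarisation and numbers of zeros

  module Forms where
    open Powers using (∑-even; H)
    open CountingImages
    open ≡-Reasoning




    q≡pP : + q ≡ + p ℤ.* + P
    q≡pP = ℤ.pos-* p P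

    instance
      P-nonZero : ℕ.NonZero P
      P-nonZero = ℕ.m^n≢0 p (r ℕ.+ r)
  
    -- If Tr x = s, the translation by x / v carries the fibre over 𝟘 to the fibre over s. So p
    -- fibres of equal size share q = p P elements.
    hyperplane : ∀ {v} → v ≢ 𝟘 → ∀ s → ∑ (λ u → 𝟏 (Tr (u ⊗ v) Fin.≟ s)) ≡ + P
    hyperplane {v} v≢𝟘 s = trans (translate s) (ℤ.*-cancelˡ-≡ (+ p) _ _ (begin
      + p ℤ.* count K.𝟘            ≡⟨ ∑-const p (count K.𝟘) ⟨
      ∑ {p} (λ _ → count K.𝟘)      ≡⟨ ∑-cong translate ⟨
      ∑ count                      ≡⟨ ∑-comm (λ s u → 𝟏 (Tr (u ⊗ v) Fin.≟ s)) ⟩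
      ∑ (λ u → ∑ (λ s → 𝟏 (Tr (u ⊗ v) Fin.≟ s)))  ≡⟨ ∑-cong (λ u → ∑-singleton (Tr (u ⊗ v))) ⟩
      ∑ {q} (λ _ → 1ℤ)             ≡⟨ trans (∑-const q 1ℤ) (ℤ.*-identityʳ (+ q)) ⟩
      + q                          ≡⟨ q≡pP ⟩
      + p ℤ.* + P                  ∎))
      where
      count : Fin p → ℤ
      count s = ∑ (λ u → 𝟏 (Tr (u ⊗ v) Fin.≟ s))
      translate : ∀ s → count s ≡ count K.𝟘
      translate s with Tr-surjective s | inverse v v≢𝟘
      ... | x , refl | v⁻¹ , vv⁻¹≡𝟙 = trans
        (∑-reindex refl {_⊕ x ⊗ v⁻¹} (+-cancelʳ (x ⊗ v⁻¹) _ _) (λ u → 𝟏 (Tr (u ⊗ v) Fin.≟ Tr x)))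
        (∑-cong λ u → 𝟏-cong (Tr ((u ⊕ x ⊗ v⁻¹) ⊗ v) Fin.≟ Tr x) (Tr (u ⊗ v) Fin.≟ K.𝟘)
          (λ e → K.+-cancelʳ (Tr x) _ _ (trans (sym (shift u)) (trans e (sym (K.+-identityˡ (Tr x))))))
          (λ e → trans (shift u) (trans (cong (K._⊕ Tr x) e) (K.+-identityˡ (Tr x)))))
        where
        shift : ∀ u → Tr ((u ⊕ x ⊗ v⁻¹) ⊗ v) ≡ Tr (u ⊗ v) K.⊕ Tr x
        shift u = begin
          Tr ((u ⊕ x ⊗ v⁻¹) ⊗ v)
            ≡⟨ cong Tr (solve 4 (λ u x w v → (u :+ x :* w) :* v := u :* v :+ x :* (v :* w)) refl u x v⁻¹ v) ⟩
          Tr (u ⊗ v ⊕ x ⊗ (v ⊗ v⁻¹))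
            ≡⟨ cong (λ t → Tr (u ⊗ v ⊕ t)) (trans (cong (x ⊗_) vv⁻¹≡𝟙) (*-identityʳ x)) ⟩
          Tr (u ⊗ v ⊕ x)         ≡⟨ Tr-+ (u ⊗ v) x ⟩
          Tr (u ⊗ v) K.⊕ Tr x    ∎

    affine-hyperplane : ∀ {v} → v ≢ 𝟘 → ∀ s → ∑ (λ u → 𝟏 ((Tr (u ⊗ v) K.⊕ s) Fin.≟ K.𝟘)) ≡ + P
    affine-hyperplane {v} v≢𝟘 s = trans
      (∑-cong λ u → 𝟏-cong ((Tr (u ⊗ v) K.⊕ s) Fin.≟ K.𝟘) (Tr (u ⊗ v) Fin.≟ (K.⊖ s))
        (K.+-inverseˡ-unique _ s) (λ e → trans (cong (K._⊕ s) e) (K.-‿inverseˡ s)))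
      (hyperplane v≢𝟘 (K.⊖ s))

    -- τ is the (m - 1)-st iterate of σ and therefore its inverse, because σ has m-th iterate φ (k
    -- m), the identity.
    σ τ : Fin q → Fin q
    σ = φ k
    τ = φ (k ℕ.* (r ℕ.+ r))

    σ-τ : ∀ x → σ (τ x) ≡ x
    σ-τ x = begin
      φ k (φ (k ℕ.* (r ℕ.+ r)) x)      ≡⟨ φ-∘ k (k ℕ.* (r ℕ.+ r)) x ⟩
      φ (k ℕ.* (r ℕ.+ r) ℕ.+ k) x      ≡⟨ cong (λ j → φ j x) (trans (ℕ.+-comm _ k) (sym (ℕ.*-suc k (r ℕ.+ r)))) ⟩
      φ (k ℕ.* m) x                    ≡⟨ φ-fixed-multiple m (φ-m x) k ⟩
      x                                ∎

    σ-nonzero : ∀ {x} → x ≢ 𝟘 → σ x ≢ 𝟘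
    σ-nonzero = ↑-nonzero (p ^ k)

    σ-𝟘 : σ 𝟘 ≡ 𝟘
    σ-𝟘 = 𝟘↑ (p ^ k) {{ℕ.m^n≢0 p k}}

    Q : Fin q → Fin q → Fin q → Fin p
    Q u c y = Tr (u ⊗ (y ⊗ y) ⊕ c ⊗ (σ y ⊗ y))

    -- The polar form of Q is (w , d) ↦ Tr (w · polar d).
    polar : Fin q → Fin q → Fin q → Fin q
    polar u c d = (u ⊗ d ⊕ u ⊗ d) ⊕ (c ⊗ σ d ⊕ τ (c ⊗ d))

    Q-𝟘 : ∀ u c → Q u c 𝟘 ≡ K.𝟘
    Q-𝟘 u c = trans (cong Tr (trans
      (cong₂ _⊕_ (trans (cong (u ⊗_) (zeroˡ 𝟘)) (zeroʳ u)) (trans (cong (c ⊗_) (zeroʳ (σ 𝟘))) (zeroʳ c)))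
      (+-identityʳ 𝟘))) Tr-𝟘

    Q-neg : ∀ u c y → Q u c (⊖ y) ≡ Q u c y
    Q-neg u c y = cong Tr (trans (cong (λ s → u ⊗ (⊖ y ⊗ ⊖ y) ⊕ c ⊗ (s ⊗ ⊖ y)) (φ-neg k y))
      (solve 4 (λ u c y s → u :* ((:- y) :* (:- y)) :+ c :* ((:- s) :* (:- y)) := u :* (y :* y) :+ c :* (s :* y))
        refl u c y (σ y)))

    Q-scale : ∀ u c s y → Q u c (ι s ⊗ y) ≡ (s K.⊗ s) K.⊗ Q u c y
    Q-scale u c s y = begin
      Tr (u ⊗ ((ι s ⊗ y) ⊗ (ι s ⊗ y)) ⊕ c ⊗ (σ (ι s ⊗ y) ⊗ (ι s ⊗ y)))
        ≡⟨ cong (λ t → Tr (u ⊗ ((ι s ⊗ y) ⊗ (ι s ⊗ y)) ⊕ c ⊗ (t ⊗ (ι s ⊗ y))))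
             (trans (φ-* k (ι s) y) (cong (_⊗ σ y) (φ-ι k s))) ⟩
      Tr (u ⊗ ((ι s ⊗ y) ⊗ (ι s ⊗ y)) ⊕ c ⊗ ((ι s ⊗ σ y) ⊗ (ι s ⊗ y)))
        ≡⟨ cong Tr (solve 5 (λ u c s y z → u :* ((s :* y) :* (s :* y)) :+ c :* ((s :* z) :* (s :* y))
             := (s :* s) :* (u :* (y :* y) :+ c :* (z :* y))) refl u c (ι s) y (σ y)) ⟩
      Tr ((ι s ⊗ ι s) ⊗ (u ⊗ (y ⊗ y) ⊕ c ⊗ (σ y ⊗ y)))
        ≡⟨ cong (λ t → Tr (t ⊗ (u ⊗ (y ⊗ y) ⊕ c ⊗ (σ y ⊗ y)))) (ι-* s s) ⟨
      Tr (ι (s K.⊗ s) ⊗ (u ⊗ (y ⊗ y) ⊕ c ⊗ (σ y ⊗ y)))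
        ≡⟨ Tr-scale (s K.⊗ s) _ ⟩
      (s K.⊗ s) K.⊗ Q u c y ∎

    Q-+ : ∀ u c w d → Q u c (w ⊕ d) ≡ Q u c w K.⊕ (Tr (w ⊗ polar u c d) K.⊕ Q u c d)
    Q-+ u c w d = begin
      Tr (u ⊗ ((w ⊕ d) ⊗ (w ⊕ d)) ⊕ c ⊗ (σ (w ⊕ d) ⊗ (w ⊕ d)))
        ≡⟨ cong (λ t → Tr (u ⊗ ((w ⊕ d) ⊗ (w ⊕ d)) ⊕ c ⊗ (t ⊗ (w ⊕ d)))) (φ-+ k w d) ⟩
      Tr (u ⊗ ((w ⊕ d) ⊗ (w ⊕ d)) ⊕ c ⊗ ((σ w ⊕ σ d) ⊗ (w ⊕ d)))
        ≡⟨ cong Tr (solve 6 (λ u c w d s t →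
             u :* ((w :+ d) :* (w :+ d)) :+ c :* ((s :+ t) :* (w :+ d)) :=
             (u :* (w :* w) :+ c :* (s :* w)) :+
               ((w :* ((u :* d :+ u :* d) :+ c :* t) :+ s :* (c :* d)) :+ (u :* (d :* d) :+ c :* (t :* d))))
             refl u c w d (σ w) (σ d)) ⟩
      Tr (X ⊕ ((w ⊗ Y ⊕ σ w ⊗ (c ⊗ d)) ⊕ Z))
        ≡⟨ trans (Tr-+ _ _) (cong (Tr X K.⊕_) (trans (Tr-+ _ _) (cong (K._⊕ Tr Z) adjoint))) ⟩
      Q u c w K.⊕ (Tr (w ⊗ polar u c d) K.⊕ Q u c d) ∎
      where
      X = u ⊗ (w ⊗ w) ⊕ c ⊗ (σ w ⊗ w)
      Y = (u ⊗ d ⊕ u ⊗ d) ⊕ c ⊗ σ d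
      Z = u ⊗ (d ⊗ d) ⊕ c ⊗ (σ d ⊗ d)
      -- The trace is invariant under σ, so σ can be taken off w at the price of τ on the other
      -- factor: τ is the adjoint of σ for the trace form.
      adjoint : Tr (w ⊗ Y ⊕ σ w ⊗ (c ⊗ d)) ≡ Tr (w ⊗ polar u c d)
      adjoint = begin
        Tr (w ⊗ Y ⊕ σ w ⊗ (c ⊗ d))               ≡⟨ cong (λ t → Tr (w ⊗ Y ⊕ σ w ⊗ t)) (σ-τ (c ⊗ d)) ⟨
        Tr (w ⊗ Y ⊕ σ w ⊗ σ (τ (c ⊗ d)))         ≡⟨ cong (λ t → Tr (w ⊗ Y ⊕ t)) (φ-* k w (τ (c ⊗ d))) ⟨
        Tr (w ⊗ Y ⊕ σ (w ⊗ τ (c ⊗ d)))           ≡⟨ Tr-+ (w ⊗ Y) _ ⟩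
        Tr (w ⊗ Y) K.⊕ Tr (σ (w ⊗ τ (c ⊗ d)))    ≡⟨ cong (Tr (w ⊗ Y) K.⊕_) (Tr-φ k _) ⟩
        Tr (w ⊗ Y) K.⊕ Tr (w ⊗ τ (c ⊗ d))        ≡⟨ Tr-+ (w ⊗ Y) _ ⟨
        Tr (w ⊗ Y ⊕ w ⊗ τ (c ⊗ d))
          ≡⟨ cong Tr (solve 4 (λ w a b t → w :* (a :+ b) :+ w :* t := w :* (a :+ (b :+ t))) refl w (u ⊗ d ⊕ u ⊗ d) (c ⊗ σ d) (τ (c ⊗ d))) ⟩
        Tr (w ⊗ polar u c d)                     ∎

    -- On the radical Q is both additive and homogeneous of degree two: 4 Q d = Q (2 d) = 2 Q d, and
    -- the characteristic is odd.
    Q-radical : ∀ u c {d} → polar u c d ≡ 𝟘 → Q u c d ≡ K.𝟘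
    Q-radical u c {d} rad = KO.double≡𝟘⇒≡𝟘 (K.+-cancelˡ (x K.⊕ x) _ _ (begin
      (x K.⊕ x) K.⊕ (x K.⊕ x)        ≡⟨ four ⟩
      (2K K.⊗ 2K) K.⊗ x              ≡⟨ Q-scale u c 2K d ⟨
      Q u c (ι 2K ⊗ d)               ≡⟨ cong (Q u c) (trans (cong (_⊗ d) (trans (ι-+ K.𝟙 K.𝟙) (cong₂ _⊕_ ι-𝟙 ι-𝟙)))
                                         (solve 1 (λ d → (con 1ℤ :+ con 1ℤ) :* d := d :+ d) refl d)) ⟩
      Q u c (d ⊕ d)                  ≡⟨ Q-+ u c d d ⟩
      x K.⊕ (Tr (d ⊗ polar u c d) K.⊕ x)   ≡⟨ cong (λ t → x K.⊕ (t K.⊕ x)) (trans (cong (λ t → Tr (d ⊗ t)) rad) (trans (cong Tr (zeroʳ d)) Tr-𝟘)) ⟩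
      x K.⊕ (K.𝟘 K.⊕ x)              ≡⟨ cong (x K.⊕_) (K.+-identityˡ x) ⟩
      x K.⊕ x                        ≡⟨ K.+-identityʳ _ ⟨
      (x K.⊕ x) K.⊕ K.𝟘              ∎))
      where
      x = Q u c d
      2K = K.𝟙 K.⊕ K.𝟙
      four : (x K.⊕ x) K.⊕ (x K.⊕ x) ≡ (2K K.⊗ 2K) K.⊗ x
      four = K.solve 1 (λ x → (x K.:+ x) K.:+ (x K.:+ x) K.:=
        ((K.con 1ℤ K.:+ K.con 1ℤ) K.:* (K.con 1ℤ K.:+ K.con 1ℤ)) K.:* x) refl x

    N : Fin q → Fin q → Fin p → ℤ
    N u c s = ∑ (λ y → 𝟏 (Q u c y Fin.≟ s))

    R : Fin q → Fin q → ℤ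
    R u c = ∑ (λ d → 𝟏 (polar u c d Fin.≟ 𝟘))

    N-total : ∀ u c → ∑ (N u c) ≡ + q
    N-total u c = trans (∑-comm (λ s y → 𝟏 (Q u c y Fin.≟ s)))
      (trans (∑-cong (λ y → ∑-singleton (Q u c y))) (trans (∑-const q 1ℤ) (ℤ.*-identityʳ (+ q))))

    -- Both sides count pairs with Q y = Q w; substituting y = w + d linearises the condition on w.
    N-squares : ∀ u c → ∑ (λ s → N u c s ℤ.* N u c s) ≡ + q ℤ.* + P ℤ.+ (+ q ℤ.- + P) ℤ.* R u c
    N-squares u c = begin
      ∑ (λ s → N u c s ℤ.* N u c s)                     ≡⟨ ∑-fibres (Q u c) (N u c) ⟨
      ∑ (λ w → ∑ (λ y → 𝟏 (Q u c y Fin.≟ Q u c w)))     ≡⟨ ∑-cong (λ w → ∑-reindex refl {w ⊕_} (+-cancelˡ w _ _) (λ y → 𝟏 (Q u c y Fin.≟ Q u c w))) ⟩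
      ∑ (λ w → ∑ (λ d → 𝟏 (Q u c (w ⊕ d) Fin.≟ Q u c w)))
        ≡⟨ ∑-comm (λ w d → 𝟏 (Q u c (w ⊕ d) Fin.≟ Q u c w)) ⟩
      ∑ (λ d → ∑ (λ w → 𝟏 (Q u c (w ⊕ d) Fin.≟ Q u c w)))
        ≡⟨ ∑-cong (λ d → ∑-cong λ w → 𝟏-cong (Q u c (w ⊕ d) Fin.≟ Q u c w) ((Tr (w ⊗ polar u c d) K.⊕ Q u c d) Fin.≟ K.𝟘)
             (λ e → K.+-cancelˡ (Q u c w) _ _ (trans (sym (Q-+ u c w d)) (trans e (sym (K.+-identityʳ _)))))
             (λ e → trans (Q-+ u c w d) (trans (cong (Q u c w K.⊕_) e) (K.+-identityʳ _)))) ⟩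
      ∑ (λ d → ∑ (λ w → 𝟏 ((Tr (w ⊗ polar u c d) K.⊕ Q u c d) Fin.≟ K.𝟘)))
        ≡⟨ ∑-cong solutions ⟩
      ∑ (λ d → + P ℤ.+ (+ q ℤ.- + P) ℤ.* 𝟏 (polar u c d Fin.≟ 𝟘))
        ≡⟨ ∑-+ (λ _ → + P) (λ d → (+ q ℤ.- + P) ℤ.* 𝟏 (polar u c d Fin.≟ 𝟘)) ⟩
      ∑ {q} (λ _ → + P) ℤ.+ ∑ (λ d → (+ q ℤ.- + P) ℤ.* 𝟏 (polar u c d Fin.≟ 𝟘))
        ≡⟨ cong₂ ℤ._+_ (∑-const q (+ P)) (∑-*ˡ (+ q ℤ.- + P) (λ d → 𝟏 (polar u c d Fin.≟ 𝟘))) ⟩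
      + q ℤ.* + P ℤ.+ (+ q ℤ.- + P) ℤ.* R u c ∎
      where
      cancel : ∀ q P → q ≡ P ℤ.+ (q ℤ.- P) ℤ.* 1ℤ
      cancel = ℤ-solve-∀
      cancel₀ : ∀ q P → P ≡ P ℤ.+ (q ℤ.- P) ℤ.* 0ℤ
      cancel₀ = ℤ-solve-∀
      solutions : ∀ d → ∑ (λ w → 𝟏 ((Tr (w ⊗ polar u c d) K.⊕ Q u c d) Fin.≟ K.𝟘)) ≡
                  + P ℤ.+ (+ q ℤ.- + P) ℤ.* 𝟏 (polar u c d Fin.≟ 𝟘)
      solutions d with polar u c d Fin.≟ 𝟘
      ... | no ≢𝟘 = trans (affine-hyperplane ≢𝟘 (Q u c d)) (cancel₀ (+ q) (+ P))
      ... | yes ≡𝟘 = trans (trans (∑-cong λ w → 𝟏-true ((Tr (w ⊗ polar u c d) K.⊕ Q u c d) Fin.≟ K.𝟘)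
          (trans (cong₂ K._⊕_ (trans (cong (λ t → Tr (w ⊗ t)) ≡𝟘) (trans (cong Tr (zeroʳ w)) Tr-𝟘)) (Q-radical u c ≡𝟘))
            (K.+-identityʳ K.𝟘)))
        (trans (∑-const q 1ℤ) (ℤ.*-identityʳ (+ q)))) (cancel (+ q) (+ P))

    N-scale : ∀ u c {x} → x ≢ K.𝟘 → ∀ s → N u c ((x K.⊗ x) K.⊗ s) ≡ N u c s
    N-scale u c {x} x≢𝟘 s = trans
      (∑-reindex refl {ι x ⊗_} (*-cancelˡ (ι x) (ι-nonzero x≢𝟘)) (λ y → 𝟏 (Q u c y Fin.≟ ((x K.⊗ x) K.⊗ s))))
      (∑-cong λ y → 𝟏-cong (Q u c (ι x ⊗ y) Fin.≟ ((x K.⊗ x) K.⊗ s)) (Q u c y Fin.≟ s)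
        (λ e → K.*-cancelˡ (x K.⊗ x) (K.*-nonzero x≢𝟘 x≢𝟘) (trans (sym (Q-scale u c x y)) e))
        (λ e → trans (Q-scale u c x y) (cong ((x K.⊗ x) K.⊗_) e)))

    N-even : ∀ u c {s} → s ≢ K.𝟘 → ∃ λ a → N u c s ≡ + 2 ℤ.* a
    N-even u c {s} s≢𝟘 = half , (begin
      N u c s                                     ≡⟨ ∑-even (λ y → 𝟏 (Q u c y Fin.≟ s)) (λ y → cong (λ t → 𝟏 (t Fin.≟ s)) (Q-neg u c y)) ⟩
      𝟏 (Q u c 𝟘 Fin.≟ s) ℤ.+ + 2 ℤ.* half        ≡⟨ cong (ℤ._+ + 2 ℤ.* half) (𝟏-false (Q u c 𝟘 Fin.≟ s) (λ e → s≢𝟘 (trans (sym e) (Q-𝟘 u c)))) ⟩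
      0ℤ ℤ.+ + 2 ℤ.* half                         ≡⟨ ℤ.+-identityˡ (+ 2 ℤ.* half) ⟩
      + 2 ℤ.* half                                ∎)
      where
      half = ∑ {H} (λ t → 𝟏 (Q u c (π ↑ toℕ t) Fin.≟ s))

    open Squares K (KT.odd-characteristic {h} (subst (λ n → n KT.· K.𝟙 ≡ K.𝟘) p-odd (KT.order-annihilates K.𝟙)))

    p-1-nonZero : ℤ.NonZero (+ p ℤ.- 1ℤ)
    p-1-nonZero = ℤ.≢-nonZero λ e → ℕ.<⇒≢ p>1 (sym (ℤ.+-injective (ℤ.i-j≡0⇒i≡j (+ p) 1ℤ e)))

    private
      excess′ : ∀ u c → ∃₂ λ a b → N u c K.𝟘 ≡ + P ℤ.- (+ p ℤ.- 1ℤ) ℤ.* a ×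
                                   + p ℤ.* (a ℤ.* a) ℤ.+ b ℤ.* b ≡ R u c ℤ.* + P
      excess′ u c = E.a , E.b , E.linear , E.quadratic
        where
        N₀ = N u c K.𝟘
        a₁ = proj₁ (N-even u c {K.𝟙} (K.𝟘≢𝟙 ∘ sym))
        N₁≡ = proj₂ (N-even u c {K.𝟙} (K.𝟘≢𝟙 ∘ sym))
        a₂ = proj₁ (N-even u c {g} g-nonzero)
        N₂≡ = proj₂ (N-even u c {g} g-nonzero)
        total : + 2 ℤ.* (+ p ℤ.* + P) ≡ + 2 ℤ.* N₀ ℤ.+ (+ p ℤ.- 1ℤ) ℤ.* (+ 2 ℤ.* a₁ ℤ.+ + 2 ℤ.* a₂)
        total = begin
          + 2 ℤ.* (+ p ℤ.* + P)      ≡⟨ cong (ℤ._*_ (+ 2)) (trans (N-total u c) q≡pP) ⟨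
          + 2 ℤ.* ∑ (N u c)          ≡⟨ ∑-square-classes (N u c) (N-scale u c) ⟩
          + 2 ℤ.* N₀ ℤ.+ (+ p ℤ.- 1ℤ) ℤ.* (N u c K.𝟙 ℤ.+ N u c g)
            ≡⟨ cong₂ (λ x y → + 2 ℤ.* N₀ ℤ.+ (+ p ℤ.- 1ℤ) ℤ.* (x ℤ.+ y)) N₁≡ N₂≡ ⟩
          + 2 ℤ.* N₀ ℤ.+ (+ p ℤ.- 1ℤ) ℤ.* (+ 2 ℤ.* a₁ ℤ.+ + 2 ℤ.* a₂) ∎
        squares : + 2 ℤ.* (+ p ℤ.* + P ℤ.* + P ℤ.+ (+ p ℤ.* + P ℤ.- + P) ℤ.* R u c) ≡
          + 2 ℤ.* (N₀ ℤ.* N₀) ℤ.+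
            (+ p ℤ.- 1ℤ) ℤ.* ((+ 2 ℤ.* a₁) ℤ.* (+ 2 ℤ.* a₁) ℤ.+ (+ 2 ℤ.* a₂) ℤ.* (+ 2 ℤ.* a₂))
        squares = begin
          + 2 ℤ.* (+ p ℤ.* + P ℤ.* + P ℤ.+ (+ p ℤ.* + P ℤ.- + P) ℤ.* R u c)
            ≡⟨ cong (λ x → + 2 ℤ.* (x ℤ.* + P ℤ.+ (x ℤ.- + P) ℤ.* R u c)) q≡pP ⟨
          + 2 ℤ.* (+ q ℤ.* + P ℤ.+ (+ q ℤ.- + P) ℤ.* R u c)
            ≡⟨ cong (ℤ._*_ (+ 2)) (N-squares u c) ⟨
          + 2 ℤ.* ∑ (λ s → N u c s ℤ.* N u c s)
            ≡⟨ ∑-square-classes (λ s → N u c s ℤ.* N u c s) (λ x≢𝟘 s → cong (λ z → z ℤ.* z) (N-scale u c x≢𝟘 s)) ⟩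
          + 2 ℤ.* (N₀ ℤ.* N₀) ℤ.+ (+ p ℤ.- 1ℤ) ℤ.* (N u c K.𝟙 ℤ.* N u c K.𝟙 ℤ.+ N u c g ℤ.* N u c g)
            ≡⟨ cong₂ (λ x y → + 2 ℤ.* (N₀ ℤ.* N₀) ℤ.+ (+ p ℤ.- 1ℤ) ℤ.* (x ℤ.* x ℤ.+ y ℤ.* y)) N₁≡ N₂≡ ⟩
          + 2 ℤ.* (N₀ ℤ.* N₀) ℤ.+
            (+ p ℤ.- 1ℤ) ℤ.* ((+ 2 ℤ.* a₁) ℤ.* (+ 2 ℤ.* a₁) ℤ.+ (+ 2 ℤ.* a₂) ℤ.* (+ 2 ℤ.* a₂)) ∎
        module E = Excess (+ p) (+ P) (R u c) N₀ a₁ a₂ {{p-1-nonZero}} total squares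

    abstract
      -- From here on the two integers are accessible only through these two equations; the first
      -- determines a, which is named E below.
      excess : ∀ u c → ∃₂ λ a b → N u c K.𝟘 ≡ + P ℤ.- (+ p ℤ.- 1ℤ) ℤ.* a ×
                                 + p ℤ.* (a ℤ.* a) ℤ.+ b ℤ.* b ≡ R u c ℤ.* + P
      excess = excess′

  -- The size of the radical and the values of E

  module Rank where
    open Forms
    open CountingImages
    open ≡-Reasoning

    polar-+ : ∀ u c x y → polar u c (x ⊕ y) ≡ polar u c x ⊕ polar u c y
    polar-+ u c x y = begin
      polar u c (x ⊕ y)
        ≡⟨ cong₂ (λ s t → (u ⊗ (x ⊕ y) ⊕ u ⊗ (x ⊕ y)) ⊕ (c ⊗ s ⊕ t)) (φ-+ k x y)
             (trans (cong τ (distribˡ c x y)) (φ-+ (k ℕ.* (r ℕ.+ r)) (c ⊗ x) (c ⊗ y))) ⟩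
      (u ⊗ (x ⊕ y) ⊕ u ⊗ (x ⊕ y)) ⊕ (c ⊗ (σ x ⊕ σ y) ⊕ (τ (c ⊗ x) ⊕ τ (c ⊗ y)))
        ≡⟨ solve 8 (λ u c x y s t v w → (u :* (x :+ y) :+ u :* (x :+ y)) :+ (c :* (s :+ t) :+ (v :+ w)) :=
             ((u :* x :+ u :* x) :+ (c :* s :+ v)) :+ ((u :* y :+ u :* y) :+ (c :* t :+ w)))
             refl u c x y (σ x) (σ y) (τ (c ⊗ x)) (τ (c ⊗ y)) ⟩
      polar u c x ⊕ polar u c y ∎

    polar-scale : ∀ u c s x → polar u c (ι s ⊗ x) ≡ ι s ⊗ polar u c x
    polar-scale u c s x = begin
      polar u c (ι s ⊗ x)
        ≡⟨ cong₂ (λ a b → (u ⊗ (ι s ⊗ x) ⊕ u ⊗ (ι s ⊗ x)) ⊕ (c ⊗ a ⊕ b))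
             (trans (φ-* k (ι s) x) (cong (_⊗ σ x) (φ-ι k s)))
             (trans (cong τ (solve 3 (λ c s x → c :* (s :* x) := s :* (c :* x)) refl c (ι s) x))
               (trans (φ-* (k ℕ.* (r ℕ.+ r)) (ι s) (c ⊗ x)) (cong (_⊗ τ (c ⊗ x)) (φ-ι (k ℕ.* (r ℕ.+ r)) s)))) ⟩
      (u ⊗ (ι s ⊗ x) ⊕ u ⊗ (ι s ⊗ x)) ⊕ (c ⊗ (ι s ⊗ σ x) ⊕ ι s ⊗ τ (c ⊗ x))
        ≡⟨ solve 6 (λ u c s x y t → (u :* (s :* x) :+ u :* (s :* x)) :+ (c :* (s :* y) :+ s :* t) :=
             s :* ((u :* x :+ u :* x) :+ (c :* y :+ t))) refl u c (ι s) x (σ x) (τ (c ⊗ x)) ⟩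
      ι s ⊗ polar u c x ∎

    _∈line_ : Fin q → Fin q → Set
    x ∈line d = ∃ λ s → ι s ⊗ d ≡ x

    _∈line?_ : ∀ x d → Dec (x ∈line d)
    x ∈line? d = Fin.any? (λ s → (ι s ⊗ d) Fin.≟ x)

    count-line : ∀ {d} → d ≢ 𝟘 → ∑ (λ x → 𝟏 (x ∈line? d)) ≡ + p
    count-line {d} d≢𝟘 = count-image (_∈line? d) (λ s → ι s ⊗ d) (ι-injective ∘ *-cancelʳ d d≢𝟘)
      (λ s → s , refl) (λ x x∈ → x∈)

    module _ {d₀ d₁ : Fin q} (d₀≢𝟘 : d₀ ≢ 𝟘) (d₁∉ : ¬ (d₁ ∈line d₀)) where
      -- If t and t′ differ, dividing by t - t′ expresses d₁ as a multiple of d₀, against `d₁∉`.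
      independent : ∀ {s t s′ t′} → ι s ⊗ d₀ ⊕ ι t ⊗ d₁ ≡ ι s′ ⊗ d₀ ⊕ ι t′ ⊗ d₁ → s ≡ s′ × t ≡ t′
      independent {s} {t} {s′} {t′} eq with (t K.⊕ K.⊖ t′) Fin.≟ K.𝟘
      ... | yes t-t′≡𝟘 = ι-injective (*-cancelʳ d₀ d₀≢𝟘 (+-cancelʳ (ι t ⊗ d₁) _ _
              (trans eq (cong (λ z → ι s′ ⊗ d₀ ⊕ ι z ⊗ d₁) (sym t≡t′))))) , t≡t′
        where t≡t′ = K.sub≡𝟘⇒≡ t-t′≡𝟘
      ... | no t-t′≢𝟘 with K.inverse (t K.⊕ K.⊖ t′) t-t′≢𝟘
      ...   | z , inv = contradiction ((s′ K.⊕ K.⊖ s) K.⊗ z , (begin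
          ι ((s′ K.⊕ K.⊖ s) K.⊗ z) ⊗ d₀
            ≡⟨ cong (_⊗ d₀) (trans (ι-* _ z) (cong (_⊗ ι z) (ι-sub s′ s))) ⟩
          ((ι s′ ⊕ ⊖ ι s) ⊗ ι z) ⊗ d₀
            ≡⟨ solve 6 (λ a b z d e f → ((a :+ (:- b)) :* z) :* d := z :* ((a :* d :+ e) :+ (:- (b :* d :+ f))) :+ z :* (f :+ (:- e)))
                 refl (ι s′) (ι s) (ι z) d₀ (ι t′ ⊗ d₁) (ι t ⊗ d₁) ⟩
          ι z ⊗ ((ι s′ ⊗ d₀ ⊕ ι t′ ⊗ d₁) ⊕ ⊖ (ι s ⊗ d₀ ⊕ ι t ⊗ d₁)) ⊕ ι z ⊗ (ι t ⊗ d₁ ⊕ ⊖ (ι t′ ⊗ d₁))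
            ≡⟨ cong (λ x → ι z ⊗ (x ⊕ ⊖ (ι s ⊗ d₀ ⊕ ι t ⊗ d₁)) ⊕ ι z ⊗ (ι t ⊗ d₁ ⊕ ⊖ (ι t′ ⊗ d₁))) (sym eq) ⟩
          ι z ⊗ ((ι s ⊗ d₀ ⊕ ι t ⊗ d₁) ⊕ ⊖ (ι s ⊗ d₀ ⊕ ι t ⊗ d₁)) ⊕ ι z ⊗ (ι t ⊗ d₁ ⊕ ⊖ (ι t′ ⊗ d₁))
            ≡⟨ solve 5 (λ x z t t′ d → z :* (x :+ (:- x)) :+ z :* (t :* d :+ (:- (t′ :* d))) := ((t :+ (:- t′)) :* z) :* d)
                 refl (ι s ⊗ d₀ ⊕ ι t ⊗ d₁) (ι z) (ι t) (ι t′) d₁ ⟩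
          ((ι t ⊕ ⊖ ι t′) ⊗ ι z) ⊗ d₁
            ≡⟨ cong (_⊗ d₁) (trans (cong (_⊗ ι z) (sym (ι-sub t t′))) (trans (sym (ι-* _ z)) (trans (cong ι inv) ι-𝟙))) ⟩
          𝟙 ⊗ d₁
            ≡⟨ *-identityˡ d₁ ⟩
          d₁ ∎)) d₁∉
        where
        ι-sub : ∀ a b → ι (a K.⊕ K.⊖ b) ≡ ι a ⊕ ⊖ ι b
        ι-sub a b = trans (ι-+ a (K.⊖ b)) (cong (ι a ⊕_) (ι-neg b))

    -- Applying σ removes its inverse τ and leaves σ c σ²d + 2 σ u σ d + c d = 0, an equation in
    -- which only iterates of σ occur.
    radical-equation : ∀ u c {d} → polar u c d ≡ 𝟘 →
      (σ u ⊗ σ d ⊕ σ u ⊗ σ d) ⊕ (σ c ⊗ σ (σ d) ⊕ c ⊗ d) ≡ 𝟘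
    radical-equation u c {d} rad = begin
      (σ u ⊗ σ d ⊕ σ u ⊗ σ d) ⊕ (σ c ⊗ σ (σ d) ⊕ c ⊗ d)
        ≡⟨ cong₂ _⊕_ (trans (φ-+ k _ _) (cong₂ _⊕_ (φ-* k u d) (φ-* k u d)))
             (trans (φ-+ k _ _) (cong₂ _⊕_ (φ-* k c (σ d)) (σ-τ (c ⊗ d)))) ⟨
      σ (u ⊗ d ⊕ u ⊗ d) ⊕ σ (c ⊗ σ d ⊕ τ (c ⊗ d))     ≡⟨ φ-+ k _ _ ⟨
      σ (polar u c d)                                 ≡⟨ cong σ rad ⟩
      σ 𝟘                                             ≡⟨ σ-𝟘 ⟩
      𝟘                                               ∎

    -- The σ-polynomial of order 2 cutting out the radical, divided by the solution d₀:
    -- for d = w d₀ the difference σ w - w solves an equation of order 1.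
    module _ (u c : Fin q) (c≢𝟘 : c ≢ 𝟘) {d₀ : Fin q} (d₀≢𝟘 : d₀ ≢ 𝟘) (rad₀ : polar u c d₀ ≡ 𝟘) where
      private
        α β γ : Fin q
        α = σ c ⊗ σ (σ d₀)
        β = σ u ⊗ σ d₀ ⊕ σ u ⊗ σ d₀
        γ = c ⊗ d₀
        α≢𝟘 : α ≢ 𝟘
        α≢𝟘 = *-nonzero (σ-nonzero c≢𝟘) (σ-nonzero (σ-nonzero d₀≢𝟘))

      Δ : Fin q → Fin q
      Δ w = σ w ⊕ ⊖ w

      σ-Δ : ∀ w → σ (Δ w) ≡ σ (σ w) ⊕ ⊖ σ w
      σ-Δ w = trans (φ-+ k (σ w) (⊖ w)) (cong (σ (σ w) ⊕_) (φ-neg k w))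

      -- This is the radical equation of w d₀ minus σ w times that of d₀: the middle terms with σ u
      -- cancel.
      Δ-equation : ∀ {w} → polar u c (w ⊗ d₀) ≡ 𝟘 → α ⊗ σ (Δ w) ≡ γ ⊗ Δ w
      Δ-equation {w} rad = sub≡𝟘⇒≡ (begin
        α ⊗ σ (Δ w) ⊕ ⊖ (γ ⊗ Δ w)
          ≡⟨ cong (λ t → α ⊗ t ⊕ ⊖ (γ ⊗ Δ w)) (σ-Δ w) ⟩
        α ⊗ (σ (σ w) ⊕ ⊖ σ w) ⊕ ⊖ (γ ⊗ (σ w ⊕ ⊖ w))
          ≡⟨ solve 9 (λ sc ssd su sd c d ssw sw w →
               (sc :* ssd) :* (ssw :+ (:- sw)) :+ (:- ((c :* d) :* (sw :+ (:- w)))) :=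
               ((su :* (sw :* sd) :+ su :* (sw :* sd)) :+ (sc :* (ssw :* ssd) :+ c :* (w :* d)))
                 :+ (:- (sw :* ((su :* sd :+ su :* sd) :+ (sc :* ssd :+ c :* d)))))
               refl (σ c) (σ (σ d₀)) (σ u) (σ d₀) c d₀ (σ (σ w)) (σ w) w ⟩
        X ⊕ ⊖ (σ w ⊗ (β ⊕ (α ⊕ γ)))
          ≡⟨ cong (λ t → X ⊕ ⊖ (σ w ⊗ t)) (radical-equation u c rad₀) ⟩
        X ⊕ ⊖ (σ w ⊗ 𝟘)
          ≡⟨ solve 2 (λ x y → x :+ (:- (y :* con 0ℤ)) := x) refl X (σ w) ⟩
        (σ u ⊗ (σ w ⊗ σ d₀) ⊕ σ u ⊗ (σ w ⊗ σ d₀)) ⊕ (σ c ⊗ (σ (σ w) ⊗ σ (σ d₀)) ⊕ c ⊗ (w ⊗ d₀))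
          ≡⟨ cong₂ (λ s t → (σ u ⊗ s ⊕ σ u ⊗ s) ⊕ (σ c ⊗ t ⊕ c ⊗ (w ⊗ d₀))) (φ-* k w d₀)
               (trans (cong σ (φ-* k w d₀)) (φ-* k (σ w) (σ d₀))) ⟨
        (σ u ⊗ σ (w ⊗ d₀) ⊕ σ u ⊗ σ (w ⊗ d₀)) ⊕ (σ c ⊗ σ (σ (w ⊗ d₀)) ⊕ c ⊗ (w ⊗ d₀))
          ≡⟨ radical-equation u c rad ⟩
        𝟘 ∎)
        where
        X = (σ u ⊗ (σ w ⊗ σ d₀) ⊕ σ u ⊗ (σ w ⊗ σ d₀)) ⊕ (σ c ⊗ (σ (σ w) ⊗ σ (σ d₀)) ⊕ c ⊗ (w ⊗ d₀))

      Δ≡𝟘⇒∈K : ∀ {w} → Δ w ≡ 𝟘 → w ∈K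
      Δ≡𝟘⇒∈K = σ-fixed⇒∈K ∘ sub≡𝟘⇒≡

      -- Write d = w d₀ and d₁ = w₁ d₀. Both Δ w and Δ w₁ solve the same equation of order one, so
      -- their ratio is fixed by σ and is some ι t. Then Δ vanishes on w - t w₁, which is thus also
      -- in K.
      radical-plane : ∀ {d₁} → polar u c d₁ ≡ 𝟘 → ¬ (d₁ ∈line d₀) →
                      ∀ {d} → polar u c d ≡ 𝟘 → ∃₂ λ s t → ι s ⊗ d₀ ⊕ ι t ⊗ d₁ ≡ d
      radical-plane {d₁} rad₁ d₁∉ {d} rad = s , t , (begin
        ι s ⊗ d₀ ⊕ ι t ⊗ d₁
          ≡⟨ cong₂ (λ x y → x ⊗ d₀ ⊕ ι t ⊗ y) (proj₂ in-K₂) (sym (divide d₁)) ⟩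
        (w ⊕ ⊖ (ι t ⊗ w₁)) ⊗ d₀ ⊕ ι t ⊗ (w₁ ⊗ d₀)
          ≡⟨ solve 4 (λ w t w₁ d → (w :+ (:- (t :* w₁))) :* d :+ t :* (w₁ :* d) := w :* d) refl w (ι t) w₁ d₀ ⟩
        w ⊗ d₀
          ≡⟨ divide d ⟩
        d ∎)
        where
        d₀⁻¹ = proj₁ (inverse d₀ d₀≢𝟘)
        divide : ∀ x → (x ⊗ d₀⁻¹) ⊗ d₀ ≡ x
        divide x = trans (*-assoc x d₀⁻¹ d₀)
          (trans (cong (x ⊗_) (trans (*-comm d₀⁻¹ d₀) (proj₂ (inverse d₀ d₀≢𝟘)))) (*-identityʳ x))
        w = d ⊗ d₀⁻¹
        w₁ = d₁ ⊗ d₀⁻¹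
        eq : α ⊗ σ (Δ w) ≡ γ ⊗ Δ w
        eq = Δ-equation (trans (cong (polar u c) (divide d)) rad)
        eq₁ : α ⊗ σ (Δ w₁) ≡ γ ⊗ Δ w₁
        eq₁ = Δ-equation (trans (cong (polar u c) (divide d₁)) rad₁)
        δ₁≢𝟘 : Δ w₁ ≢ 𝟘
        δ₁≢𝟘 e = d₁∉ (proj₁ (Δ≡𝟘⇒∈K e) , trans (cong (_⊗ d₀) (proj₂ (Δ≡𝟘⇒∈K e))) (divide d₁))
        δ₁⁻¹ = proj₁ (inverse (Δ w₁) δ₁≢𝟘)
        ρ = Δ w ⊗ δ₁⁻¹
        ρδ₁ : ρ ⊗ Δ w₁ ≡ Δ w
        ρδ₁ = trans (*-assoc (Δ w) δ₁⁻¹ (Δ w₁)) (trans (cong (Δ w ⊗_)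
          (trans (*-comm δ₁⁻¹ (Δ w₁)) (proj₂ (inverse (Δ w₁) δ₁≢𝟘)))) (*-identityʳ (Δ w)))
        in-K₁ : ρ ∈K
        in-K₁ = σ-fixed⇒∈K (*-cancelʳ (α ⊗ σ (Δ w₁)) (*-nonzero α≢𝟘 (σ-nonzero δ₁≢𝟘)) (begin
          σ ρ ⊗ (α ⊗ σ (Δ w₁))    ≡⟨ solve 3 (λ x a y → x :* (a :* y) := a :* (x :* y)) refl (σ ρ) α (σ (Δ w₁)) ⟩
          α ⊗ (σ ρ ⊗ σ (Δ w₁))    ≡⟨ cong (α ⊗_) (φ-* k ρ (Δ w₁)) ⟨
          α ⊗ σ (ρ ⊗ Δ w₁)        ≡⟨ cong (λ x → α ⊗ σ x) ρδ₁ ⟩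
          α ⊗ σ (Δ w)             ≡⟨ eq ⟩
          γ ⊗ Δ w                 ≡⟨ cong (γ ⊗_) ρδ₁ ⟨
          γ ⊗ (ρ ⊗ Δ w₁)          ≡⟨ solve 3 (λ c x y → c :* (x :* y) := x :* (c :* y)) refl γ ρ (Δ w₁) ⟩
          ρ ⊗ (γ ⊗ Δ w₁)          ≡⟨ cong (ρ ⊗_) eq₁ ⟨
          ρ ⊗ (α ⊗ σ (Δ w₁))      ∎))
        t = proj₁ in-K₁
        in-K₂ : (w ⊕ ⊖ (ι t ⊗ w₁)) ∈K
        in-K₂ = σ-fixed⇒∈K (sub≡𝟘⇒≡ (begin
          σ (w ⊕ ⊖ (ι t ⊗ w₁)) ⊕ ⊖ (w ⊕ ⊖ (ι t ⊗ w₁))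
            ≡⟨ cong (_⊕ ⊖ (w ⊕ ⊖ (ι t ⊗ w₁))) (trans (φ-+ k w _) (cong (σ w ⊕_) (trans (φ-neg k _)
                 (cong ⊖_ (trans (φ-* k (ι t) w₁) (cong (_⊗ σ w₁) (φ-ι k t))))))) ⟩
          (σ w ⊕ ⊖ (ι t ⊗ σ w₁)) ⊕ ⊖ (w ⊕ ⊖ (ι t ⊗ w₁))
            ≡⟨ solve 5 (λ a t b w x → (a :+ (:- (t :* b))) :+ (:- (w :+ (:- (t :* x)))) := (a :+ (:- w)) :+ (:- (t :* (b :+ (:- x)))))
                 refl (σ w) (ι t) (σ w₁) w w₁ ⟩
          Δ w ⊕ ⊖ (ι t ⊗ Δ w₁)
            ≡⟨ cong (λ x → Δ w ⊕ ⊖ x) (trans (cong (_⊗ Δ w₁) (proj₂ in-K₁)) ρδ₁) ⟩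
          Δ w ⊕ ⊖ Δ w
            ≡⟨ -‿inverseʳ (Δ w) ⟩
          𝟘 ∎))
        s = proj₁ in-K₂

    R-trivial : ∀ u c → (∀ {d} → polar u c d ≡ 𝟘 → d ≡ 𝟘) → R u c ≡ 1ℤ
    R-trivial u c trivial = trans
      (∑-cong λ d → 𝟏-cong (polar u c d Fin.≟ 𝟘) (𝟘 Fin.≟ d) (sym ∘ trivial) λ { refl → polar-𝟘 })
      (∑-singleton 𝟘)
      where
      polar-𝟘 : polar u c 𝟘 ≡ 𝟘
      polar-𝟘 = +-cancelˡ (polar u c 𝟘) _ _
        (trans (sym (polar-+ u c 𝟘 𝟘)) (trans (cong (polar u c) (+-identityˡ 𝟘)) (sym (+-identityʳ _))))

    R-diagonal : ∀ {u} → u ≢ 𝟘 → R u 𝟘 ≡ 1ℤ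
    R-diagonal {u} u≢𝟘 = R-trivial u 𝟘 λ {d} rad → *-cancelˡ u u≢𝟘 (trans
      (double≡𝟘⇒≡𝟘 (trans (sym (trans (cong₂ (λ s t → (u ⊗ d ⊕ u ⊗ d) ⊕ (s ⊕ t)) (zeroˡ (σ d)) τ-𝟘)
        (trans (cong ((u ⊗ d ⊕ u ⊗ d) ⊕_) (+-identityʳ 𝟘)) (+-identityʳ _)))) rad))
      (sym (zeroʳ u)))
      where
      τ-𝟘 : ∀ {d} → τ (𝟘 ⊗ d) ≡ 𝟘
      τ-𝟘 {d} = trans (cong τ (zeroˡ d)) (𝟘↑ _ {{ℕ.m^n≢0 p (k ℕ.* (r ℕ.+ r))}})

    -- The radical is searched for some d₀ ≠ 𝟘 and then for some d₁ off the line of d₀; by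
    -- `radical-plane` the two span everything. The cases are a point, a line and a plane over K.
    R-values : ∀ u c → c ≢ 𝟘 → R u c ≡ 1ℤ ⊎ R u c ≡ + p ⊎ R u c ≡ + (p ℕ.* p)
    R-values u c c≢𝟘 = point? (Fin.any? (λ d → ¬? (d Fin.≟ 𝟘) ×-dec polar u c d Fin.≟ 𝟘))
      where
      Values = R u c ≡ 1ℤ ⊎ R u c ≡ + p ⊎ R u c ≡ + (p ℕ.* p)
      multiple : ∀ s {d} → polar u c d ≡ 𝟘 → polar u c (ι s ⊗ d) ≡ 𝟘
      multiple s {d} rad = trans (polar-scale u c s d) (trans (cong (ι s ⊗_) rad) (zeroʳ (ι s)))
      line? : ∀ d₀ → d₀ ≢ 𝟘 → polar u c d₀ ≡ 𝟘 → Dec (∃ λ d → ¬ (d ∈line d₀) × polar u c d ≡ 𝟘) → Values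
      line? d₀ d₀≢𝟘 rad₀ (no none) = inj₂ (inj₁ (count-image (λ d → polar u c d Fin.≟ 𝟘) (λ s → ι s ⊗ d₀)
        (ι-injective ∘ *-cancelʳ d₀ d₀≢𝟘) (λ s → multiple s rad₀)
        (λ d rad → decidable-stable (d ∈line? d₀) λ d∉ → none (d , d∉ , rad))))
      line? d₀ d₀≢𝟘 rad₀ (yes (d₁ , d₁∉ , rad₁)) = inj₂ (inj₂ (count-image (λ d → polar u c d Fin.≟ 𝟘)
        (λ i → plane (remQuot p i)) injective in-radical onto))
        where
        plane : Fin p × Fin p → Fin q
        plane (s , t) = ι s ⊗ d₀ ⊕ ι t ⊗ d₁
        injective : Injective _≡_ _≡_ (λ i → plane (remQuot {p} p i))
        injective {i} {j} eq = trans (sym (Fin.combine-remQuot {p} p i))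
          (trans (cong₂ combine (proj₁ components) (proj₂ components)) (Fin.combine-remQuot {p} p j))
          where
          components = independent d₀≢𝟘 d₁∉ {proj₁ (remQuot {p} p i)} {proj₂ (remQuot {p} p i)} eq
        in-radical : ∀ i → polar u c (plane (remQuot p i)) ≡ 𝟘
        in-radical i = trans (polar-+ u c _ _) (trans (cong₂ _⊕_ (multiple _ rad₀) (multiple _ rad₁)) (+-identityʳ 𝟘))
        onto : ∀ d → polar u c d ≡ 𝟘 → ∃ λ i → plane (remQuot p i) ≡ d
        onto d rad = combine (proj₁ st) (proj₁ (proj₂ st)) ,
          trans (cong plane (Fin.remQuot-combine (proj₁ st) (proj₁ (proj₂ st)))) (proj₂ (proj₂ st))
          where st = radical-plane u c c≢𝟘 d₀≢𝟘 rad₀ rad₁ d₁∉ rad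
      point? : Dec (∃ λ d → d ≢ 𝟘 × polar u c d ≡ 𝟘) → Values
      point? (no none) = inj₁ (R-trivial u c λ {d} rad → decidable-stable (d Fin.≟ 𝟘) λ d≢𝟘 → none (d , d≢𝟘 , rad))
      point? (yes (d₀ , d₀≢𝟘 , rad₀)) = line? d₀ d₀≢𝟘 rad₀ (Fin.any? (λ d → ¬? (d ∈line? d₀) ×-dec polar u c d Fin.≟ 𝟘))

    -- N u c 𝟘 = P - (p - 1) E u c.
    E : Fin q → Fin q → ℤ
    E u c = proj₁ (excess u c)

    private
      B : Fin q → Fin q → ℤ
      B u c = proj₁ (proj₂ (excess u c))

      open Descent p-prime

      square-abs : ∀ i → i ℤ.* i ≡ + (ℤ.∣ i ∣ ℕ.* ℤ.∣ i ∣)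
      square-abs (+ n) = sym (ℤ.pos-* n n)
      square-abs -[1+ n ] = refl

      quadratic : ∀ u c {n} → R u c ≡ + n → let a = ℤ.∣ E u c ∣; b = ℤ.∣ B u c ∣ in
                  p ℕ.* (a ℕ.* a) ℕ.+ b ℕ.* b ≡ n ℕ.* P
      quadratic u c {n} eq = ℤ.+-injective (begin
        + (p ℕ.* (a ℕ.* a) ℕ.+ b ℕ.* b)                ≡⟨ cong (ℤ._+ + (b ℕ.* b)) (ℤ.pos-* p (a ℕ.* a)) ⟩
        + p ℤ.* + (a ℕ.* a) ℤ.+ + (b ℕ.* b)            ≡⟨ cong₂ (λ x y → + p ℤ.* x ℤ.+ y) (square-abs (E u c)) (square-abs (B u c)) ⟨
        + p ℤ.* (E u c ℤ.* E u c) ℤ.+ B u c ℤ.* B u c          ≡⟨ proj₂ (proj₂ (proj₂ (excess u c))) ⟩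
        R u c ℤ.* + P                                  ≡⟨ cong (ℤ._* + P) eq ⟩
        + n ℤ.* + P                                    ≡⟨ ℤ.pos-* n P ⟨
        + (n ℕ.* P)                                    ∎)
        where
        a = ℤ.∣ E u c ∣
        b = ℤ.∣ B u c ∣

      abs-cases : ∀ i {n} → ℤ.∣ i ∣ ≡ n → i ≡ + n ⊎ i ≡ ℤ.- + n
      abs-cases (+ n) refl = inj₁ refl
      abs-cases -[1+ n ] refl = inj₂ refl

      E-rank₀ : ∀ u c → R u c ≡ 1ℤ → E u c ≡ 0ℤ
      E-rank₀ u c eq = ℤ.∣i∣≡0⇒i≡0 (descent-even r ℤ.∣ E u c ∣ ℤ.∣ B u c ∣ (trans (quadratic u c eq) (ℕ.*-identityˡ P)))

    E-diagonal : ∀ {u} → u ≢ 𝟘 → E u 𝟘 ≡ 0ℤ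
    E-diagonal {u} u≢𝟘 = E-rank₀ u 𝟘 (R-diagonal u≢𝟘)

    -- R P is p ^ (2 r), p ^ (2 r + 1) or p ^ (2 r + 2). The even exponents force E = 0, the odd one
    -- makes the absolute value of E equal to p ^ r = S.
    E-values : ∀ u {c} → c ≢ 𝟘 → E u c ≡ 0ℤ ⊎ E u c ≡ + S ⊎ E u c ≡ ℤ.- + S
    E-values u {c} c≢𝟘 = Sum.[ (λ eq → inj₁ (E-rank₀ u c eq)) , Sum.[ rank₁ , rank₂ ]′ ]′ (R-values u c c≢𝟘)
      where
      rank₁ : R u c ≡ + p → E u c ≡ 0ℤ ⊎ E u c ≡ + S ⊎ E u c ≡ ℤ.- + S
      rank₁ eq = inj₂ (abs-cases (E u c) (descent-odd r ℤ.∣ E u c ∣ ℤ.∣ B u c ∣ (quadratic u c eq)))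
      rank₂ : R u c ≡ + (p ℕ.* p) → E u c ≡ 0ℤ ⊎ E u c ≡ + S ⊎ E u c ≡ ℤ.- + S
      rank₂ eq = inj₁ (ℤ.∣i∣≡0⇒i≡0 (descent-even (suc r) ℤ.∣ E u c ∣ ℤ.∣ B u c ∣
        (trans (quadratic u c eq) (trans (ℕ.*-assoc p p P) (cong (λ n → p ^ suc n) (sym (ℕ.+-suc r r)))))))

  -- The first two moments of E over u

  module Moments where
    open Forms
    open Rank
    open Algebra.Properties.AbelianGroup ℤ.+-0-abelianGroup using ()
      renaming (∙-cancelˡ to +-cancelˡ-ℤ)
    open ≡-Reasoning

    -- For fixed y the value Q u c y is affine in u with slope y². Summing over u before y turns the
    -- moments of the numbers of zeros into counts of points on hyperplanes.
    pencil : Fin q → Fin q → ℤ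
    pencil c y = ∑ (λ u → 𝟏 (Q u c y Fin.≟ K.𝟘))

    Q-split : ∀ u c y → Q u c y ≡ Tr (u ⊗ (y ⊗ y)) K.⊕ Tr (c ⊗ (σ y ⊗ y))
    Q-split u c y = Tr-+ (u ⊗ (y ⊗ y)) (c ⊗ (σ y ⊗ y))

    pencil-nonzero : ∀ c {y} → y ≢ 𝟘 → pencil c y ≡ + P
    pencil-nonzero c {y} y≢𝟘 = trans (∑-cong λ u → cong (λ t → 𝟏 (t Fin.≟ K.𝟘)) (Q-split u c y))
      (affine-hyperplane (*-nonzero y≢𝟘 y≢𝟘) (Tr (c ⊗ (σ y ⊗ y))))

    pencil-𝟘 : ∀ c → pencil c 𝟘 ≡ + q
    pencil-𝟘 c = trans (∑-cong λ u → 𝟏-true (Q u c 𝟘 Fin.≟ K.𝟘) (Q-𝟘 u c))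
      (trans (∑-const q 1ℤ) (ℤ.*-identityʳ (+ q)))

    interpolate : ∀ (f : Fin q → ℤ) X Y → f 𝟘 ≡ Y → (∀ {y} → y ≢ 𝟘 → f y ≡ X) →
                  ∑ f ≡ + q ℤ.* X ℤ.+ (Y ℤ.- X)
    interpolate f X Y at-𝟘 off-𝟘 = begin
      ∑ f                                                       ≡⟨ ∑-cong (λ y → pointwise y (𝟘 Fin.≟ y)) ⟩
      ∑ (λ y → X ℤ.+ 𝟏 (𝟘 Fin.≟ y) ℤ.* (Y ℤ.- X))               ≡⟨ ∑-+ (λ _ → X) (λ y → 𝟏 (𝟘 Fin.≟ y) ℤ.* (Y ℤ.- X)) ⟩
      ∑ {q} (λ _ → X) ℤ.+ ∑ (λ y → 𝟏 (𝟘 Fin.≟ y) ℤ.* (Y ℤ.- X)) ≡⟨ cong₂ ℤ._+_ (∑-const q X) (∑-delta 𝟘 (λ _ → Y ℤ.- X)) ⟩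
      + q ℤ.* X ℤ.+ (Y ℤ.- X)                                   ∎
      where
      replace : ∀ x y → y ≡ x ℤ.+ 1ℤ ℤ.* (y ℤ.- x)
      replace = ℤ-solve-∀
      pointwise : ∀ y (d : Dec (𝟘 ≡ y)) → f y ≡ X ℤ.+ 𝟏 d ℤ.* (Y ℤ.- X)
      pointwise y (yes refl) = trans at-𝟘 (replace X Y)
      pointwise y (no 𝟘≢y) = trans (off-𝟘 (𝟘≢y ∘ sym)) (sym (ℤ.+-identityʳ X))

    pair : Fin q → Fin q → Fin q → ℤ
    pair c y z = ∑ (λ u → 𝟏 (Q u c y Fin.≟ K.𝟘) ℤ.* 𝟏 (Q u c z Fin.≟ K.𝟘))

    pair-𝟘 : ∀ c z → pair c 𝟘 z ≡ pencil c z
    pair-𝟘 c z = ∑-cong λ u → trans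
      (cong (ℤ._* 𝟏 (Q u c z Fin.≟ K.𝟘)) (𝟏-true (Q u c 𝟘 Fin.≟ K.𝟘) (Q-𝟘 u c))) (ℤ.*-identityˡ (𝟏 (Q u c z Fin.≟ K.𝟘)))

    -- For z = s y the value at z is s² times the value at y, so the second condition follows from
    -- the first.
    pair-line : ∀ c {y z} → y ≢ 𝟘 → z ∈line y → pair c y z ≡ + P
    pair-line c {y} y≢𝟘 (s , refl) = trans (∑-cong λ u → absorb u (Q u c y Fin.≟ K.𝟘)) (pencil-nonzero c y≢𝟘)
      where
      absorb : ∀ u (d : Dec (Q u c y ≡ K.𝟘)) → 𝟏 d ℤ.* 𝟏 (Q u c (ι s ⊗ y) Fin.≟ K.𝟘) ≡ 𝟏 d
      absorb u (yes e) = trans (ℤ.*-identityˡ (𝟏 (Q u c (ι s ⊗ y) Fin.≟ K.𝟘))) (𝟏-true (Q u c (ι s ⊗ y) Fin.≟ K.𝟘)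
        (trans (Q-scale u c s y) (trans (cong ((s K.⊗ s) K.⊗_) e) (K.zeroʳ _))))
      absorb u (no _) = ℤ.*-zeroˡ (𝟏 (Q u c (ι s ⊗ y) Fin.≟ K.𝟘))

    -- The difference Q u c z - s Q u c y is affine in u with slope z² - s y². If the slope were 𝟘,
    -- then (z / y)² = s would lie in K, so z / y would as well and z would be on the line of y.
    proportional : ∀ c {y z} → y ≢ 𝟘 → ¬ (z ∈line y) → ∀ s →
                   ∑ (λ u → 𝟏 (Q u c z Fin.≟ (s K.⊗ Q u c y))) ≡ + P
    proportional c {y} {z} y≢𝟘 z∉ s = trans
      (∑-cong λ u → 𝟏-cong (Q u c z Fin.≟ (s K.⊗ Q u c y)) ((Tr (u ⊗ v) K.⊕ t) Fin.≟ K.𝟘)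
        (λ e → trans (difference u) (trans (cong (K._⊕ K.⊖ (s K.⊗ Q u c y)) e) (K.-‿inverseʳ _)))
        (λ e → K.sub≡𝟘⇒≡ (trans (sym (difference u)) e)))
      (affine-hyperplane v≢𝟘 t)
      where
      v = z ⊗ z ⊕ ⊖ (ι s ⊗ (y ⊗ y))
      B : Fin q → Fin p
      B x = Tr (c ⊗ (σ x ⊗ x))
      t = B z K.⊕ K.⊖ (s K.⊗ B y)
      y⁻¹ = proj₁ (inverse y y≢𝟘)
      inv : y ⊗ y⁻¹ ≡ 𝟙
      inv = proj₂ (inverse y y≢𝟘)
      v≢𝟘 : v ≢ 𝟘
      v≢𝟘 v≡𝟘 = z∉ (proj₁ ratio , trans (cong (_⊗ y) (proj₂ ratio))
        (trans (*-assoc z y⁻¹ y) (trans (cong (z ⊗_) (trans (*-comm y⁻¹ y) inv)) (*-identityʳ z))))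
        where
        ratio : (z ⊗ y⁻¹) ∈K
        ratio = square∈K⇒∈K (s , (begin
          ι s                                  ≡⟨ solve 1 (λ s → s := s :* (con 1ℤ :* con 1ℤ)) refl (ι s) ⟩
          ι s ⊗ (𝟙 ⊗ 𝟙)                        ≡⟨ cong (λ x → ι s ⊗ (x ⊗ x)) inv ⟨
          ι s ⊗ ((y ⊗ y⁻¹) ⊗ (y ⊗ y⁻¹))        ≡⟨ solve 3 (λ s y w → s :* ((y :* w) :* (y :* w)) := (s :* (y :* y)) :* (w :* w)) refl (ι s) y y⁻¹ ⟩
          (ι s ⊗ (y ⊗ y)) ⊗ (y⁻¹ ⊗ y⁻¹)        ≡⟨ cong (_⊗ (y⁻¹ ⊗ y⁻¹)) (sub≡𝟘⇒≡ v≡𝟘) ⟨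
          (z ⊗ z) ⊗ (y⁻¹ ⊗ y⁻¹)                ≡⟨ solve 2 (λ z w → (z :* z) :* (w :* w) := (z :* w) :* (z :* w)) refl z y⁻¹ ⟩
          (z ⊗ y⁻¹) ⊗ (z ⊗ y⁻¹)                ∎))
      difference : ∀ u → Tr (u ⊗ v) K.⊕ t ≡ Q u c z K.⊕ K.⊖ (s K.⊗ Q u c y)
      difference u = begin
        Tr (u ⊗ v) K.⊕ t
          ≡⟨ cong (K._⊕ t) (trans (cong Tr (solve 4 (λ u z s y → u :* (z :+ (:- (s :* y))) := u :* z :+ (:- (s :* (u :* y)))) refl u (z ⊗ z) (ι s) (y ⊗ y)))
               (trans (Tr-+ _ _) (cong (Tr (u ⊗ (z ⊗ z)) K.⊕_) (trans (Tr-neg _) (cong K.⊖_ (Tr-scale s (u ⊗ (y ⊗ y)))))))) ⟩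
        (Tr (u ⊗ (z ⊗ z)) K.⊕ K.⊖ (s K.⊗ Tr (u ⊗ (y ⊗ y)))) K.⊕ t
          ≡⟨ K.solve 5 (λ a b s x y → (a K.:+ (K.:- (s K.:* b))) K.:+ (x K.:+ (K.:- (s K.:* y))) K.:=
               (a K.:+ x) K.:+ (K.:- (s K.:* (b K.:+ y)))) refl (Tr (u ⊗ (z ⊗ z))) (Tr (u ⊗ (y ⊗ y))) s (B z) (B y) ⟩
        (Tr (u ⊗ (z ⊗ z)) K.⊕ B z) K.⊕ K.⊖ (s K.⊗ (Tr (u ⊗ (y ⊗ y)) K.⊕ B y))
          ≡⟨ cong₂ (λ a b → a K.⊕ K.⊖ (s K.⊗ b)) (Q-split u c z) (Q-split u c y) ⟨
        Q u c z K.⊕ K.⊖ (s K.⊗ Q u c y) ∎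

    -- For each of the p + 1 possible ratios of the values at z and y there are P parameters u.
    -- Values that are not both 𝟘 have one ratio, two zeros satisfy all p + 1 conditions; hence p P
    -- + P = q + p `pair c y z`.
    pair-generic : ∀ c {y z} → y ≢ 𝟘 → ¬ (z ∈line y) → + p ℤ.* pair c y z ≡ + P
    pair-generic c {y} {z} y≢𝟘 z∉ = +-cancelˡ-ℤ (+ q) (+ p ℤ.* pair c y z) (+ P) (begin
      + q ℤ.+ + p ℤ.* pair c y z
        ≡⟨ cong₂ ℤ._+_ (trans (∑-const q 1ℤ) (ℤ.*-identityʳ (+ q))) (∑-*ˡ (+ p) both) ⟨
      ∑ {q} (λ _ → 1ℤ) ℤ.+ ∑ (λ u → + p ℤ.* both u)
        ≡⟨ ∑-+ (λ _ → 1ℤ) (λ u → + p ℤ.* both u) ⟨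
      ∑ (λ u → 1ℤ ℤ.+ + p ℤ.* both u)
        ≡⟨ ∑-cong (λ u → count-ratios (Q u c z) (Q u c y)) ⟨
      ∑ (λ u → ∑ (λ s → 𝟏 (Q u c z Fin.≟ (s K.⊗ Q u c y))) ℤ.+ 𝟏 (Q u c y Fin.≟ K.𝟘))
        ≡⟨ ∑-+ (λ u → ∑ (λ s → 𝟏 (Q u c z Fin.≟ (s K.⊗ Q u c y)))) (λ u → 𝟏 (Q u c y Fin.≟ K.𝟘)) ⟩
      ∑ (λ u → ∑ (λ s → 𝟏 (Q u c z Fin.≟ (s K.⊗ Q u c y)))) ℤ.+ pencil c y
        ≡⟨ cong₂ ℤ._+_ (trans (∑-comm (λ u s → 𝟏 (Q u c z Fin.≟ (s K.⊗ Q u c y))))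
             (trans (∑-cong (proportional c y≢𝟘 z∉)) (trans (∑-const p (+ P)) (sym q≡pP))))
             (pencil-nonzero c y≢𝟘) ⟩
      + q ℤ.+ + P ∎)
      where
      open Ratios K
      both : Fin q → ℤ
      both u = 𝟏 (Q u c y Fin.≟ K.𝟘) ℤ.* 𝟏 (Q u c z Fin.≟ K.𝟘)

    private
      -- The sums of p `pair c y z` over z, for y ≠ 𝟘 and for y = 𝟘. In X every z counts P, and the
      -- p points on the line of y count q - P more.
      X Y : ℤ
      X = + q ℤ.* + P ℤ.+ (+ q ℤ.- + P) ℤ.* + p
      Y = + p ℤ.* (+ q ℤ.* + P ℤ.+ (+ q ℤ.- + P))

    ∑-pencil : ∀ c → ∑ (pencil c) ≡ + q ℤ.* + P ℤ.+ (+ q ℤ.- + P)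
    ∑-pencil c = interpolate (pencil c) (+ P) (+ q) (pencil-𝟘 c) (pencil-nonzero c)

    pairs-𝟘 : ∀ c → ∑ (λ z → + p ℤ.* pair c 𝟘 z) ≡ Y
    pairs-𝟘 c = trans (∑-*ˡ (+ p) (pair c 𝟘)) (cong (ℤ._*_ (+ p)) (trans (∑-cong (pair-𝟘 c)) (∑-pencil c)))

    pairs-nonzero : ∀ c {y} → y ≢ 𝟘 → ∑ (λ z → + p ℤ.* pair c y z) ≡ X
    pairs-nonzero c {y} y≢𝟘 = begin
      ∑ (λ z → + p ℤ.* pair c y z)                              ≡⟨ ∑-cong (λ z → value z (z ∈line? y)) ⟩
      ∑ (λ z → + P ℤ.+ (+ q ℤ.- + P) ℤ.* 𝟏 (z ∈line? y))        ≡⟨ ∑-+ (λ _ → + P) (λ z → (+ q ℤ.- + P) ℤ.* 𝟏 (z ∈line? y)) ⟩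
      ∑ {q} (λ _ → + P) ℤ.+ ∑ (λ z → (+ q ℤ.- + P) ℤ.* 𝟏 (z ∈line? y))
        ≡⟨ cong₂ ℤ._+_ (∑-const q (+ P)) (trans (∑-*ˡ (+ q ℤ.- + P) (λ z → 𝟏 (z ∈line? y)))
             (cong (ℤ._*_ (+ q ℤ.- + P)) (count-line y≢𝟘))) ⟩
      X                                                         ∎
      where
      cancel : ∀ q P → q ≡ P ℤ.+ (q ℤ.- P) ℤ.* 1ℤ
      cancel = ℤ-solve-∀
      cancel₀ : ∀ q P → P ≡ P ℤ.+ (q ℤ.- P) ℤ.* 0ℤ
      cancel₀ = ℤ-solve-∀
      value : ∀ z (d : Dec (z ∈line y)) → + p ℤ.* pair c y z ≡ + P ℤ.+ (+ q ℤ.- + P) ℤ.* 𝟏 d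
      value z (yes z∈) = trans (cong (ℤ._*_ (+ p)) (pair-line c y≢𝟘 z∈)) (trans (sym q≡pP) (cancel (+ q) (+ P)))
      value z (no z∉) = trans (pair-generic c y≢𝟘 z∉) (cancel₀ (+ q) (+ P))

    N₀ : Fin q → Fin q → ℤ
    N₀ c u = N u c K.𝟘

    N₀≡ : ∀ c u → N₀ c u ≡ + P ℤ.- (+ p ℤ.- 1ℤ) ℤ.* E u c
    N₀≡ c u = proj₁ (proj₂ (proj₂ (excess u c)))

    private
      instance
        p-1≢0 = p-1-nonZero

      module Algebra (c : Fin q) = MomentAlgebra (+ p) (+ P) (+ q) (∑ (λ u → E u c)) (∑ (λ u → E u c ℤ.* E u c)) q≡pP

    first-moment : ∀ c → ∑ (λ u → E u c) ≡ ℤ.- + P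
    first-moment c = Algebra.first c (begin
      + q ℤ.* + P ℤ.- (+ p ℤ.- 1ℤ) ℤ.* ∑ (λ u → E u c)
        ≡⟨ cong₂ ℤ._-_ (∑-const q (+ P)) (∑-*ˡ (+ p ℤ.- 1ℤ) (λ u → E u c)) ⟨
      ∑ {q} (λ _ → + P) ℤ.- ∑ (λ u → (+ p ℤ.- 1ℤ) ℤ.* E u c)
        ≡⟨ cong (ℤ._+_ (∑ {q} (λ _ → + P))) (∑-neg (λ u → (+ p ℤ.- 1ℤ) ℤ.* E u c)) ⟨
      ∑ {q} (λ _ → + P) ℤ.+ ∑ (λ u → ℤ.- ((+ p ℤ.- 1ℤ) ℤ.* E u c))
        ≡⟨ ∑-+ (λ _ → + P) (λ u → ℤ.- ((+ p ℤ.- 1ℤ) ℤ.* E u c)) ⟨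
      ∑ (λ u → + P ℤ.- (+ p ℤ.- 1ℤ) ℤ.* E u c)
        ≡⟨ ∑-cong (N₀≡ c) ⟨
      ∑ (N₀ c)
        ≡⟨ ∑-comm (λ u y → 𝟏 (Q u c y Fin.≟ K.𝟘)) ⟩
      ∑ (pencil c)
        ≡⟨ ∑-pencil c ⟩
      + q ℤ.* + P ℤ.+ (+ q ℤ.- + P) ∎)

    ∑-N₀² : ∀ c → + p ℤ.* ∑ (λ u → N₀ c u ℤ.* N₀ c u) ≡ + q ℤ.* X ℤ.+ (Y ℤ.- X)
    ∑-N₀² c = begin
      + p ℤ.* ∑ (λ u → N₀ c u ℤ.* N₀ c u)                     ≡⟨ cong (ℤ._*_ (+ p)) (∑-cong λ u → sym (∑-*ʳ (N₀ c u) (I u))) ⟩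
      + p ℤ.* ∑ (λ u → ∑ (λ y → I u y ℤ.* N₀ c u))            ≡⟨ cong (ℤ._*_ (+ p)) (∑-cong λ u → ∑-cong λ y → sym (∑-*ˡ (I u y) (I u))) ⟩
      + p ℤ.* ∑ (λ u → ∑ (λ y → ∑ (λ z → I u y ℤ.* I u z)))   ≡⟨ cong (ℤ._*_ (+ p)) (∑-comm (λ u y → ∑ (λ z → I u y ℤ.* I u z))) ⟩
      + p ℤ.* ∑ (λ y → ∑ (λ u → ∑ (λ z → I u y ℤ.* I u z)))   ≡⟨ cong (ℤ._*_ (+ p)) (∑-cong λ y → ∑-comm (λ u z → I u y ℤ.* I u z)) ⟩
      + p ℤ.* ∑ (λ y → ∑ (pair c y))                          ≡⟨ ∑-*ˡ (+ p) (λ y → ∑ (pair c y)) ⟨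
      ∑ (λ y → + p ℤ.* ∑ (pair c y))                          ≡⟨ ∑-cong (λ y → ∑-*ˡ (+ p) (pair c y)) ⟨
      ∑ (λ y → ∑ (λ z → + p ℤ.* pair c y z))
        ≡⟨ interpolate (λ y → ∑ (λ z → + p ℤ.* pair c y z)) X Y (pairs-𝟘 c) (pairs-nonzero c) ⟩
      + q ℤ.* X ℤ.+ (Y ℤ.- X)                                 ∎
      where
      I : Fin q → Fin q → ℤ
      I u y = 𝟏 (Q u c y Fin.≟ K.𝟘)

    second-moment : ∀ c → ∑ (λ u → E u c ℤ.* E u c) ≡ + P ℤ.* + P
    second-moment c = Algebra.second c (first-moment c) (trans (cong (ℤ._*_ (+ p)) (begin
      + q ℤ.* (+ P ℤ.* + P) ℤ.+ (β ℤ.* ∑ (λ u → E u c) ℤ.+ γ ℤ.* ∑ (λ u → E u c ℤ.* E u c))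
        ≡⟨ cong₂ ℤ._+_ (∑-const q (+ P ℤ.* + P)) (cong₂ ℤ._+_ (∑-*ˡ β (λ u → E u c)) (∑-*ˡ γ (λ u → E u c ℤ.* E u c))) ⟨
      ∑ {q} (λ _ → + P ℤ.* + P) ℤ.+ (∑ (λ u → β ℤ.* E u c) ℤ.+ ∑ (λ u → γ ℤ.* (E u c ℤ.* E u c)))
        ≡⟨ cong (ℤ._+_ (∑ {q} (λ _ → + P ℤ.* + P))) (∑-+ (λ u → β ℤ.* E u c) (λ u → γ ℤ.* (E u c ℤ.* E u c))) ⟨
      ∑ {q} (λ _ → + P ℤ.* + P) ℤ.+ ∑ (λ u → β ℤ.* E u c ℤ.+ γ ℤ.* (E u c ℤ.* E u c))
        ≡⟨ ∑-+ (λ _ → + P ℤ.* + P) (λ u → β ℤ.* E u c ℤ.+ γ ℤ.* (E u c ℤ.* E u c)) ⟨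
      ∑ (λ u → + P ℤ.* + P ℤ.+ (β ℤ.* E u c ℤ.+ γ ℤ.* (E u c ℤ.* E u c)))
        ≡⟨ ∑-cong (λ u → expand (+ p) (+ P) (E u c)) ⟩
      ∑ (λ u → (+ P ℤ.- (+ p ℤ.- 1ℤ) ℤ.* E u c) ℤ.* (+ P ℤ.- (+ p ℤ.- 1ℤ) ℤ.* E u c))
        ≡⟨ ∑-cong (λ u → cong (λ x → x ℤ.* x) (N₀≡ c u)) ⟨
      ∑ (λ u → N₀ c u ℤ.* N₀ c u) ∎)) (∑-N₀² c))
      where
      β = ℤ.- (+ 2 ℤ.* ((+ p ℤ.- 1ℤ) ℤ.* + P))
      γ = (+ p ℤ.- 1ℤ) ℤ.* (+ p ℤ.- 1ℤ)
      expand : ∀ p P e → P ℤ.* P ℤ.+ (ℤ.- (+ 2 ℤ.* ((p ℤ.- 1ℤ) ℤ.* P)) ℤ.* e ℤ.+ (p ℤ.- 1ℤ) ℤ.* (p ℤ.- 1ℤ) ℤ.* (e ℤ.* e)) ≡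
                         (P ℤ.- (p ℤ.- 1ℤ) ℤ.* e) ℤ.* (P ℤ.- (p ℤ.- 1ℤ) ℤ.* e)
      expand = ℤ-solve-∀

  -- The weight of a codeword and its distribution

  module Weights where
    open Powers
    open Forms
    open Rank
    open Moments using (first-moment; second-moment; interpolate; N₀≡)
    open ≡-Reasoning

    private
      instance
        S-nonZero : ℕ.NonZero S
        S-nonZero = ℕ.m^n≢0 p r

      p-1≡2h : + p ℤ.- 1ℤ ≡ + 2 ℤ.* + h
      p-1≡2h = trans (cong (λ n → + n ℤ.- 1ℤ) p-odd) (trans (identity (+ h)) refl)
        where
        identity : ∀ x → (1ℤ ℤ.+ (x ℤ.+ x)) ℤ.- 1ℤ ≡ + 2 ℤ.* x
        identity = ℤ-solve-∀

    h-positive : 0 < h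
    h-positive = positive h p-odd
      where
      positive : ∀ h → p ≡ suc (h ℕ.+ h) → 0 < h
      positive zero p≡1 = contradiction (sym p≡1) (ℕ.<⇒≢ p>1)
      positive (suc _) _ = s≤s z≤n

    P≡S² : P ≡ S ℕ.* S
    P≡S² = ℕ.^-distribˡ-+-* p r r

    2<S : 2 < S
    2<S = ℕ.≤-trans (subst (2 <_) (sym p-odd) (s≤s (ℕ.+-mono-≤ h-positive h-positive)))
      (ℕ.≤-trans (ℕ.≤-reflexive (sym (ℕ.^-identityʳ p))) (ℕ.^-monoʳ-≤ p 1≤r))

    -- Separates - P from - 2 S among the sums of two values of E. The bound S > 2 behind it rests
    -- on r ≥ 1, that is on m ≥ 3.
    2S<P : 2 ℕ.* S < P
    2S<P = subst (2 ℕ.* S <_) (sym P≡S²) (ℕ.*-monoˡ-< S 2<S)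

    -- The zero form vanishes at all q = P + (p - 1) P points.
    E-𝟘𝟘 : E 𝟘 𝟘 ≡ ℤ.- + P
    E-𝟘𝟘 = ℤ.*-cancelˡ-≡ (+ p ℤ.- 1ℤ) (E 𝟘 𝟘) (ℤ.- + P) {{p-1-nonZero}} (begin
      (+ p ℤ.- 1ℤ) ℤ.* E 𝟘 𝟘                          ≡⟨ isolate (+ P) ((+ p ℤ.- 1ℤ) ℤ.* E 𝟘 𝟘) ⟩
      + P ℤ.- (+ P ℤ.- (+ p ℤ.- 1ℤ) ℤ.* E 𝟘 𝟘)        ≡⟨ cong (ℤ._-_ (+ P)) (N₀≡ 𝟘 𝟘) ⟨
      + P ℤ.- N 𝟘 𝟘 K.𝟘                               ≡⟨ cong (ℤ._-_ (+ P)) (trans total q≡pP) ⟩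
      + P ℤ.- + p ℤ.* + P                             ≡⟨ collect (+ p) (+ P) ⟩
      (+ p ℤ.- 1ℤ) ℤ.* (ℤ.- + P)                      ∎)
      where
      isolate : ∀ x y → y ≡ x ℤ.- (x ℤ.- y)
      isolate = ℤ-solve-∀
      collect : ∀ p P → P ℤ.- p ℤ.* P ≡ (p ℤ.- 1ℤ) ℤ.* (ℤ.- P)
      collect = ℤ-solve-∀
      total : N 𝟘 𝟘 K.𝟘 ≡ + q
      total = trans (∑-cong λ y → 𝟏-true (Q 𝟘 𝟘 y Fin.≟ K.𝟘)
          (trans (cong Tr (trans (cong₂ _⊕_ (zeroˡ (y ⊗ y)) (zeroˡ (σ y ⊗ y))) (+-identityʳ 𝟘))) Tr-𝟘))
        (trans (∑-const q 1ℤ) (ℤ.*-identityʳ (+ q)))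

    private
      module Counts (c : Fin q) (c≢𝟘 : c ≢ 𝟘) = ThreeValues (λ u → E u c) S (λ u → E-values u c≢𝟘)

      -- With a and b the numbers of u where E is S and - S, the first moment says S (a - b) = - P =
      -- - S² and the second S² (a + b) = P². So a - b = - S and a + b = P.
      count-equations : ∀ c (c≢𝟘 : c ≢ 𝟘) → let open Counts c c≢𝟘 in
        (count 0ℤ ≡ + q ℤ.- + P) × (+ 2 ℤ.* count (+ S) ≡ + P ℤ.- + S) × (+ 2 ℤ.* count (ℤ.- + S) ≡ + P ℤ.+ + S)
      count-equations c c≢𝟘 = zeros , plus , minus
        where
        open Counts c c≢𝟘
        n₀ = count 0ℤ
        a = count (+ S)
        b = count (ℤ.- + S)
        +P : + P ≡ + S ℤ.* + S
        +P = trans (cong +_ P≡S²) (ℤ.pos-* S S)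
        total : + q ≡ n₀ ℤ.+ (a ℤ.+ b)
        total = trans (sym (trans (∑-const q 1ℤ) (ℤ.*-identityʳ (+ q))))
          (trans (distribution (λ _ → 1ℤ)) (ones n₀ a b))
          where
          ones : ∀ x y z → x ℤ.* 1ℤ ℤ.+ (y ℤ.* 1ℤ ℤ.+ z ℤ.* 1ℤ) ≡ x ℤ.+ (y ℤ.+ z)
          ones = ℤ-solve-∀
        difference : a ℤ.- b ≡ ℤ.- + S
        difference = ℤ.*-cancelˡ-≡ (+ S) (a ℤ.- b) (ℤ.- + S) (begin
          + S ℤ.* (a ℤ.- b)       ≡⟨ arrange n₀ a b (+ S) ⟨
          n₀ ℤ.* 0ℤ ℤ.+ (a ℤ.* + S ℤ.+ b ℤ.* (ℤ.- + S))  ≡⟨ distribution (λ x → x) ⟨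
          ∑ (λ u → E u c)         ≡⟨ first-moment c ⟩
          ℤ.- + P                 ≡⟨ cong ℤ.-_ +P ⟩
          ℤ.- (+ S ℤ.* + S)       ≡⟨ ℤ.neg-distribʳ-* (+ S) (+ S) ⟩
          + S ℤ.* (ℤ.- + S)       ∎)
          where
          arrange : ∀ n a b s → n ℤ.* 0ℤ ℤ.+ (a ℤ.* s ℤ.+ b ℤ.* (ℤ.- s)) ≡ s ℤ.* (a ℤ.- b)
          arrange = ℤ-solve-∀
        sum : a ℤ.+ b ≡ + P
        sum = ℤ.*-cancelˡ-≡ (+ P) (a ℤ.+ b) (+ P) (begin
          + P ℤ.* (a ℤ.+ b)               ≡⟨ cong (ℤ._* (a ℤ.+ b)) +P ⟩
          + S ℤ.* + S ℤ.* (a ℤ.+ b)       ≡⟨ arrange n₀ a b (+ S) ⟨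
          n₀ ℤ.* (0ℤ ℤ.* 0ℤ) ℤ.+ (a ℤ.* (+ S ℤ.* + S) ℤ.+ b ℤ.* (ℤ.- + S ℤ.* ℤ.- + S))  ≡⟨ distribution (λ x → x ℤ.* x) ⟨
          ∑ (λ u → E u c ℤ.* E u c)       ≡⟨ second-moment c ⟩
          + P ℤ.* + P                     ∎)
          where
          arrange : ∀ n a b s → n ℤ.* (0ℤ ℤ.* 0ℤ) ℤ.+ (a ℤ.* (s ℤ.* s) ℤ.+ b ℤ.* (ℤ.- s ℤ.* ℤ.- s)) ≡ s ℤ.* s ℤ.* (a ℤ.+ b)
          arrange = ℤ-solve-∀
        zeros : n₀ ≡ + q ℤ.- + P
        zeros = trans (isolate n₀ (a ℤ.+ b)) (cong₂ ℤ._-_ (sym total) sum)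
          where
          isolate : ∀ x y → x ≡ (x ℤ.+ y) ℤ.- y
          isolate = ℤ-solve-∀
        plus : + 2 ℤ.* a ≡ + P ℤ.- + S
        plus = trans (double a b) (cong₂ ℤ._+_ sum difference)
          where
          double : ∀ a b → + 2 ℤ.* a ≡ (a ℤ.+ b) ℤ.+ (a ℤ.- b)
          double = ℤ-solve-∀
        minus : + 2 ℤ.* b ≡ + P ℤ.+ + S
        minus = trans (double a b) (trans (cong₂ ℤ._-_ sum difference) (cong (ℤ._+_ (+ P)) (ℤ.neg-involutive (+ S))))
          where
          double : ∀ a b → + 2 ℤ.* b ≡ (a ℤ.+ b) ℤ.- (a ℤ.- b)
          double = ℤ-solve-∀

      𝟙≢𝟘 : 𝟙 ≢ 𝟘
      𝟙≢𝟘 = 𝟘≢𝟙 ∘ sym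

    abstract
      -- The integers (P + S) / 2 and (P - S) / 2, realised as counts for c = 𝟙 so that nothing has
      -- to be divided by 2. The subscript is the sign in front of S here; n₊ counts the value - S.
      n₊ n₋ : ℤ
      n₊ = Counts.count 𝟙 𝟙≢𝟘 (ℤ.- + S)
      n₋ = Counts.count 𝟙 𝟙≢𝟘 (+ S)

      2n₊ : + 2 ℤ.* n₊ ≡ + P ℤ.+ + S
      2n₊ = proj₂ (proj₂ (count-equations 𝟙 𝟙≢𝟘))

      2n₋ : + 2 ℤ.* n₋ ≡ + P ℤ.- + S
      2n₋ = proj₁ (proj₂ (count-equations 𝟙 𝟙≢𝟘))

    -- The distribution of E over u as a functional on test functions, for c ≠ 𝟘 and for c = 𝟘.
    -- Nesting it twice expresses a sum over independent u and v.
    D D₀ : (ℤ → ℤ) → ℤ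
    D g = (+ q ℤ.- + P) ℤ.* g 0ℤ ℤ.+ (n₋ ℤ.* g (+ S) ℤ.+ n₊ ℤ.* g (ℤ.- + S))
    D₀ g = + q ℤ.* g 0ℤ ℤ.+ (g (ℤ.- + P) ℤ.- g 0ℤ)

    E-distribution : ∀ {c} → c ≢ 𝟘 → ∀ g → ∑ (λ u → g (E u c)) ≡ D g
    E-distribution {c} c≢𝟘 g = trans (Counts.distribution c c≢𝟘 g)
      (cong₂ (λ x y → x ℤ.* g 0ℤ ℤ.+ y) (proj₁ (count-equations c c≢𝟘))
        (cong₂ (λ x y → x ℤ.* g (+ S) ℤ.+ y ℤ.* g (ℤ.- + S))
          (ℤ.*-cancelˡ-≡ (+ 2) (Counts.count c c≢𝟘 (+ S)) n₋ (trans (proj₁ (proj₂ (count-equations c c≢𝟘))) (sym 2n₋)))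
          (ℤ.*-cancelˡ-≡ (+ 2) (Counts.count c c≢𝟘 (ℤ.- + S)) n₊ (trans (proj₂ (proj₂ (count-equations c c≢𝟘))) (sym 2n₊)))))

    E-distribution₀ : ∀ g → ∑ (λ u → g (E u 𝟘)) ≡ D₀ g
    E-distribution₀ g = interpolate (λ u → g (E u 𝟘)) (g 0ℤ) (g (ℤ.- + P)) (cong g E-𝟘𝟘) (λ u≢𝟘 → cong g (E-diagonal u≢𝟘))

    halfWeight : Fin q → Fin q → ℤ
    halfWeight u c = ∑ {H} (λ s → 𝟏 (¬? (Q u c (π ↑ toℕ s) Fin.≟ K.𝟘)))

    -- Twice this count is the number q - N₀ of all nonzero values, which equals (p - 1) (P + E) = 2
    -- h (P + E).
    halfWeight≡ : ∀ u c → halfWeight u c ≡ + h ℤ.* (+ P ℤ.+ E u c)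
    halfWeight≡ u c = ℤ.*-cancelˡ-≡ (+ 2) (halfWeight u c) (+ h ℤ.* (+ P ℤ.+ E u c)) (begin
      + 2 ℤ.* halfWeight u c                     ≡⟨ cong (ℤ._*_ (+ 2)) complement ⟩
      + 2 ℤ.* (+ H ℤ.* 1ℤ ℤ.- T)                 ≡⟨ arrange (+ H) T ⟩
      (1ℤ ℤ.+ (+ H ℤ.+ + H)) ℤ.- (1ℤ ℤ.+ + 2 ℤ.* T)
        ≡⟨ cong₂ ℤ._-_ (trans (cong +_ (sym q≡1+2H)) q≡pP) (trans (sym even) (N₀≡ c u)) ⟩
      + p ℤ.* + P ℤ.- (+ P ℤ.- (+ p ℤ.- 1ℤ) ℤ.* E u c)   ≡⟨ collect (+ p) (+ P) (E u c) ⟩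
      (+ p ℤ.- 1ℤ) ℤ.* (+ P ℤ.+ E u c)           ≡⟨ cong (ℤ._* (+ P ℤ.+ E u c)) p-1≡2h ⟩
      (+ 2 ℤ.* + h) ℤ.* (+ P ℤ.+ E u c)          ≡⟨ ℤ.*-assoc (+ 2) (+ h) (+ P ℤ.+ E u c) ⟩
      + 2 ℤ.* (+ h ℤ.* (+ P ℤ.+ E u c))          ∎)
      where
      T = ∑ {H} (λ s → 𝟏 (Q u c (π ↑ toℕ s) Fin.≟ K.𝟘))
      arrange : ∀ H T → + 2 ℤ.* (H ℤ.* 1ℤ ℤ.- T) ≡ (1ℤ ℤ.+ (H ℤ.+ H)) ℤ.- (1ℤ ℤ.+ + 2 ℤ.* T)
      arrange = ℤ-solve-∀
      collect : ∀ p P e → p ℤ.* P ℤ.- (P ℤ.- (p ℤ.- 1ℤ) ℤ.* e) ≡ (p ℤ.- 1ℤ) ℤ.* (P ℤ.+ e)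
      collect = ℤ-solve-∀
      even : N u c K.𝟘 ≡ 1ℤ ℤ.+ + 2 ℤ.* T
      even = trans (∑-even (λ y → 𝟏 (Q u c y Fin.≟ K.𝟘)) (λ y → cong (λ t → 𝟏 (t Fin.≟ K.𝟘)) (Q-neg u c y)))
        (cong (ℤ._+ + 2 ℤ.* T) (𝟏-true (Q u c 𝟘 Fin.≟ K.𝟘) (Q-𝟘 u c)))
      𝟏-¬ : ∀ {A : Set} (d : Dec A) → 𝟏 (¬? d) ≡ 1ℤ ℤ.+ ℤ.- 𝟏 d
      𝟏-¬ (yes _) = refl
      𝟏-¬ (no _) = refl
      complement : halfWeight u c ≡ + H ℤ.* 1ℤ ℤ.- T
      complement = trans (∑-cong {H} λ s → 𝟏-¬ (Q u c (π ↑ toℕ s) Fin.≟ K.𝟘))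
        (trans (∑-+ {H} (λ _ → 1ℤ) (λ s → ℤ.- 𝟏 (Q u c (π ↑ toℕ s) Fin.≟ K.𝟘)))
          (cong₂ ℤ._+_ (∑-const H 1ℤ) (∑-neg {H} (λ s → 𝟏 (Q u c (π ↑ toℕ s) Fin.≟ K.𝟘)))))

    entry : Fin q → Fin q → Fin q → ℕ → Fin p
    entry a b c t = Tr (a ⊗ π ↑ t ⊕ b ⊗ (⊖ π) ↑ t ⊕ c ⊗ π ↑ (((p ^ k ℕ.+ 1) ℕ.* t) / 2))

    private
      half-exponent : ∃ λ e → p ^ k ℕ.+ 1 ≡ e ℕ.* 2
      half-exponent = suc (proj₁ (odd-power {h = h} p-odd k)) ,
        trans (cong (ℕ._+ 1) (proj₂ (odd-power {h = h} p-odd k))) (identity (proj₁ (odd-power {h = h} p-odd k)))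
        where
        identity : ∀ x → suc (x ℕ.+ x) ℕ.+ 1 ≡ suc x ℕ.* 2
        identity = ℕ-solve-∀

    -- This is (p ^ k + 1) / 2, so the third exponent at position t is exactly e t without rounding.
    e : ℕ
    e = proj₁ half-exponent

    p^k+1≡2e : p ^ k ℕ.+ 1 ≡ e ℕ.* 2
    p^k+1≡2e = proj₂ half-exponent

    exponent≡ : ∀ t → ((p ^ k ℕ.+ 1) ℕ.* t) / 2 ≡ e ℕ.* t
    exponent≡ t = trans (cong (λ x → (x ℕ.* t) / 2) p^k+1≡2e) (trans (cong (_/ 2) (swap e t)) (m*n/n≡m (e ℕ.* t) 2))
      where
      swap : ∀ e t → e ℕ.* 2 ℕ.* t ≡ e ℕ.* t ℕ.* 2
      swap = ℕ-solve-∀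

    square-power : ∀ x s → x ↑ (s ℕ.* 2) ≡ x ↑ s ⊗ x ↑ s
    square-power x s = trans (cong (x ↑_) (identity s)) (^-homo-* x s s)
      where
      identity : ∀ s → s ℕ.* 2 ≡ s ℕ.+ s
      identity = ℕ-solve-∀

    neg-square-power : ∀ s → (⊖ π) ↑ (s ℕ.* 2) ≡ π ↑ s ⊗ π ↑ s
    neg-square-power s = begin
      (⊖ π) ↑ (s ℕ.* 2)          ≡⟨ cong ((⊖ π) ↑_) (ℕ.*-comm s 2) ⟩
      (⊖ π) ↑ (2 ℕ.* s)          ≡⟨ ^-assocʳ (⊖ π) 2 s ⟨
      ((⊖ π) ↑ 2) ↑ s            ≡⟨ cong (_↑ s) (solve 1 (λ x → (:- x) :* ((:- x) :* con 1ℤ) := x :* (x :* con 1ℤ)) refl π) ⟩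
      (π ↑ 2) ↑ s                ≡⟨ ^-assocʳ π 2 s ⟩
      π ↑ (2 ℕ.* s)              ≡⟨ cong (π ↑_) (ℕ.*-comm 2 s) ⟩
      π ↑ (s ℕ.* 2)              ≡⟨ square-power π s ⟩
      π ↑ s ⊗ π ↑ s              ∎

    norm-power : ∀ s → π ↑ (e ℕ.* (s ℕ.* 2)) ≡ σ (π ↑ s) ⊗ π ↑ s
    norm-power s = begin
      π ↑ (e ℕ.* (s ℕ.* 2))        ≡⟨ cong (π ↑_) (trans (identity e s) (cong (s ℕ.*_) (sym p^k+1≡2e))) ⟩
      π ↑ (s ℕ.* (p ^ k ℕ.+ 1))    ≡⟨ ^-assocʳ π s (p ^ k ℕ.+ 1) ⟨
      (π ↑ s) ↑ (p ^ k ℕ.+ 1)      ≡⟨ ^-homo-* (π ↑ s) (p ^ k) 1 ⟩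
      σ (π ↑ s) ⊗ (π ↑ s) ↑ 1      ≡⟨ cong (σ (π ↑ s) ⊗_) (↑-one (π ↑ s)) ⟩
      σ (π ↑ s) ⊗ π ↑ s            ∎
      where
      identity : ∀ e s → e ℕ.* (s ℕ.* 2) ≡ s ℕ.* (e ℕ.* 2)
      identity = ℕ-solve-∀

    -- At t = 2 s and y = π ^ s both π ^ t and (- π) ^ t are y², and π ^ (e t) = y ^ (p ^ k + 1) = σ
    -- y · y.
    entry-even : ∀ a b c s → entry a b c (s ℕ.* 2) ≡ Q (a ⊕ b) c (π ↑ s)
    entry-even a b c s = cong Tr (trans
      (cong₂ (λ x y → a ⊗ x ⊕ b ⊗ y ⊕ c ⊗ π ↑ (((p ^ k ℕ.+ 1) ℕ.* (s ℕ.* 2)) / 2)) (square-power π s) (neg-square-power s))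
      (trans (cong (λ x → a ⊗ (y ⊗ y) ⊕ b ⊗ (y ⊗ y) ⊕ c ⊗ x) (trans (cong (π ↑_) (exponent≡ (s ℕ.* 2))) (norm-power s)))
        (cong (_⊕ c ⊗ (σ y ⊗ y)) (sym (distribʳ (y ⊗ y) a b)))))
      where y = π ↑ s

    -- Compared with position 2 s the three terms gain the factors π, - π and π ^ e, which are
    -- absorbed into u and c.
    entry-odd : ∀ a b c s → entry a b c (suc (s ℕ.* 2)) ≡ Q ((a ⊕ ⊖ b) ⊗ π) (c ⊗ π ↑ e) (π ↑ s)
    entry-odd a b c s = cong Tr (begin
      a ⊗ (π ⊗ π ↑ (s ℕ.* 2)) ⊕ b ⊗ (⊖ π ⊗ (⊖ π) ↑ (s ℕ.* 2)) ⊕ c ⊗ π ↑ (((p ^ k ℕ.+ 1) ℕ.* suc (s ℕ.* 2)) / 2)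
        ≡⟨ cong₂ (λ x z → a ⊗ (π ⊗ x) ⊕ b ⊗ (⊖ π ⊗ z) ⊕ c ⊗ π ↑ (((p ^ k ℕ.+ 1) ℕ.* suc (s ℕ.* 2)) / 2))
             (square-power π s) (neg-square-power s) ⟩
      a ⊗ (π ⊗ (y ⊗ y)) ⊕ b ⊗ (⊖ π ⊗ (y ⊗ y)) ⊕ c ⊗ π ↑ (((p ^ k ℕ.+ 1) ℕ.* suc (s ℕ.* 2)) / 2)
        ≡⟨ cong (λ x → a ⊗ (π ⊗ (y ⊗ y)) ⊕ b ⊗ (⊖ π ⊗ (y ⊗ y)) ⊕ c ⊗ x)
             (trans (cong (π ↑_) (trans (exponent≡ (suc (s ℕ.* 2))) (ℕ.*-suc e (s ℕ.* 2))))
               (trans (^-homo-* π e (e ℕ.* (s ℕ.* 2))) (cong (π ↑ e ⊗_) (norm-power s)))) ⟩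
      a ⊗ (π ⊗ (y ⊗ y)) ⊕ b ⊗ (⊖ π ⊗ (y ⊗ y)) ⊕ c ⊗ (π ↑ e ⊗ (σ y ⊗ y))
        ≡⟨ solve 7 (λ a b c π y f z → a :* (π :* (y :* y)) :+ b :* ((:- π) :* (y :* y)) :+ c :* (f :* (z :* y)) :=
             ((a :+ (:- b)) :* π) :* (y :* y) :+ (c :* f) :* (z :* y)) refl a b c π y (π ↑ e) (σ y) ⟩
      ((a ⊕ ⊖ b) ⊗ π) ⊗ (y ⊗ y) ⊕ (c ⊗ π ↑ e) ⊗ (σ y ⊗ y) ∎)
      where y = π ↑ s

    wordWeight : Fin q → Fin q → Fin q → ℤ
    wordWeight a b c = ∑ {q ℕ.∸ 1} (λ t → 𝟏 (¬? (entry a b c (toℕ t) Fin.≟ K.𝟘)))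

    wordExcess : Fin q → Fin q → Fin q → ℤ
    wordExcess a b c = E (a ⊕ b) c ℤ.+ E ((a ⊕ ⊖ b) ⊗ π) (c ⊗ π ↑ e)

    q-1≡ : q ℕ.∸ 1 ≡ H ℕ.* 2
    q-1≡ = trans (cong (ℕ._∸ 1) q≡1+2H) (identity H)
      where
      identity : ∀ H → H ℕ.+ H ≡ H ℕ.* 2
      identity = ℕ-solve-∀

    wordWeight≡ : ∀ a b c → wordWeight a b c ≡ + h ℤ.* (+ 2 ℤ.* + P ℤ.+ wordExcess a b c)
    wordWeight≡ a b c = begin
      wordWeight a b c                        ≡⟨ cong (λ n → ∑ {n} (f ∘ toℕ)) q-1≡ ⟩
      ∑ {H ℕ.* 2} (f ∘ toℕ)                   ≡⟨ ∑-pairs H f ⟩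
      ∑ {H} (λ s → f (toℕ s ℕ.* 2) ℤ.+ f (suc (toℕ s ℕ.* 2)))
        ≡⟨ ∑-cong {H} (λ s → cong₂ (λ x y → 𝟏 (¬? (x Fin.≟ K.𝟘)) ℤ.+ 𝟏 (¬? (y Fin.≟ K.𝟘))) (entry-even a b c (toℕ s)) (entry-odd a b c (toℕ s))) ⟩
      ∑ {H} (λ s → 𝟏 (¬? (Q (a ⊕ b) c (π ↑ toℕ s) Fin.≟ K.𝟘)) ℤ.+ 𝟏 (¬? (Q ((a ⊕ ⊖ b) ⊗ π) (c ⊗ π ↑ e) (π ↑ toℕ s) Fin.≟ K.𝟘)))
        ≡⟨ ∑-+ {H} (λ s → 𝟏 (¬? (Q (a ⊕ b) c (π ↑ toℕ s) Fin.≟ K.𝟘))) (λ s → 𝟏 (¬? (Q ((a ⊕ ⊖ b) ⊗ π) (c ⊗ π ↑ e) (π ↑ toℕ s) Fin.≟ K.𝟘))) ⟩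
      halfWeight (a ⊕ b) c ℤ.+ halfWeight ((a ⊕ ⊖ b) ⊗ π) (c ⊗ π ↑ e)
        ≡⟨ cong₂ ℤ._+_ (halfWeight≡ (a ⊕ b) c) (halfWeight≡ ((a ⊕ ⊖ b) ⊗ π) (c ⊗ π ↑ e)) ⟩
      + h ℤ.* (+ P ℤ.+ E (a ⊕ b) c) ℤ.+ + h ℤ.* (+ P ℤ.+ E ((a ⊕ ⊖ b) ⊗ π) (c ⊗ π ↑ e))
        ≡⟨ collect (+ h) (+ P) (E (a ⊕ b) c) (E ((a ⊕ ⊖ b) ⊗ π) (c ⊗ π ↑ e)) ⟩
      + h ℤ.* (+ 2 ℤ.* + P ℤ.+ wordExcess a b c) ∎
      where
      f : ℕ → ℤ
      f t = 𝟏 (¬? (entry a b c t Fin.≟ K.𝟘))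
      collect : ∀ h P x y → h ℤ.* (P ℤ.+ x) ℤ.+ h ℤ.* (P ℤ.+ y) ≡ h ℤ.* (+ 2 ℤ.* P ℤ.+ (x ℤ.+ y))
      collect = ℤ-solve-∀

    πᵉ-nonzero : π ↑ e ≢ 𝟘
    πᵉ-nonzero = ↑-nonzero e π-nonzero

    -- The sum over c is taken last. For fixed c the pair (a , b) is traded for (u , v), and since c
    -- ≠ 𝟘 implies c π ^ e ≠ 𝟘, both forms follow the same distribution `D`, which does not depend
    -- on c.
    ∑-wordExcess : ∀ (G : ℤ → ℤ) → ∑ (λ a → ∑ (λ b → ∑ (λ c → G (wordExcess a b c)))) ≡
      + q ℤ.* D (λ y → D (λ x → G (y ℤ.+ x))) ℤ.+ (D₀ (λ y → D₀ (λ x → G (y ℤ.+ x))) ℤ.- D (λ y → D (λ x → G (y ℤ.+ x))))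
    ∑-wordExcess G = begin
      ∑ (λ a → ∑ (λ b → ∑ (λ c → G (wordExcess a b c))))      ≡⟨ ∑-cong (λ a → ∑-comm (λ b c → G (wordExcess a b c))) ⟩
      ∑ (λ a → ∑ (λ c → ∑ (λ b → G (wordExcess a b c))))      ≡⟨ ∑-comm (λ a c → ∑ (λ b → G (wordExcess a b c))) ⟩
      ∑ (λ c → ∑ (λ a → ∑ (λ b → G (wordExcess a b c))))      ≡⟨ ∑-cong (λ c → substitute (λ u v → G (E u c ℤ.+ E v (c ⊗ π ↑ e)))) ⟩
      ∑ (λ c → ∑ (λ u → ∑ (λ v → G (E u c ℤ.+ E v (c ⊗ π ↑ e)))))
        ≡⟨ interpolate (λ c → ∑ (λ u → ∑ (λ v → G (E u c ℤ.+ E v (c ⊗ π ↑ e)))))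
             (D (λ y → D (λ x → G (y ℤ.+ x)))) (D₀ (λ y → D₀ (λ x → G (y ℤ.+ x)))) degenerate generic ⟩
      + q ℤ.* D (λ y → D (λ x → G (y ℤ.+ x))) ℤ.+ (D₀ (λ y → D₀ (λ x → G (y ℤ.+ x))) ℤ.- D (λ y → D (λ x → G (y ℤ.+ x)))) ∎
      where
      -- For fixed a put u = a + b, then for fixed u put v = (2 a - u) π.
      substitute : (f : Fin q → Fin q → ℤ) → ∑ (λ a → ∑ (λ b → f (a ⊕ b) ((a ⊕ ⊖ b) ⊗ π))) ≡ ∑ (λ u → ∑ (f u))
      substitute f = begin
        ∑ (λ a → ∑ (λ b → f (a ⊕ b) ((a ⊕ ⊖ b) ⊗ π)))
          ≡⟨ ∑-cong (λ a → ∑-cong λ b → cong (λ x → f (a ⊕ b) (x ⊗ π))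
               (solve 2 (λ a b → a :+ (:- b) := (a :+ a) :+ (:- (a :+ b))) refl a b)) ⟩
        ∑ (λ a → ∑ (λ b → f (a ⊕ b) (((a ⊕ a) ⊕ ⊖ (a ⊕ b)) ⊗ π)))
          ≡⟨ ∑-cong (λ a → sym (∑-reindex refl {a ⊕_} (+-cancelˡ a _ _) (λ u → f u (((a ⊕ a) ⊕ ⊖ u) ⊗ π)))) ⟩
        ∑ (λ a → ∑ (λ u → f u (((a ⊕ a) ⊕ ⊖ u) ⊗ π)))
          ≡⟨ ∑-comm (λ a u → f u (((a ⊕ a) ⊕ ⊖ u) ⊗ π)) ⟩
        ∑ (λ u → ∑ (λ a → f u (((a ⊕ a) ⊕ ⊖ u) ⊗ π)))
          ≡⟨ ∑-cong (λ u → sym (∑-reindex refl {λ a → ((a ⊕ a) ⊕ ⊖ u) ⊗ π} (injective u) (f u))) ⟩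
        ∑ (λ u → ∑ (f u)) ∎
        where
        injective : ∀ u → Injective _≡_ _≡_ (λ a → ((a ⊕ a) ⊕ ⊖ u) ⊗ π)
        injective u {a} {b} eq = sub≡𝟘⇒≡ (double≡𝟘⇒≡𝟘 (trans
          (solve 2 (λ a b → (a :+ (:- b)) :+ (a :+ (:- b)) := (a :+ a) :+ (:- (b :+ b))) refl a b)
          (trans (cong (_⊕ ⊖ (b ⊕ b)) (+-cancelʳ (⊖ u) _ _ (*-cancelʳ π π-nonzero eq))) (-‿inverseʳ (b ⊕ b)))))
      generic : ∀ {c} → c ≢ 𝟘 → ∑ (λ u → ∑ (λ v → G (E u c ℤ.+ E v (c ⊗ π ↑ e)))) ≡ D (λ y → D (λ x → G (y ℤ.+ x)))
      generic {c} c≢𝟘 = trans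
        (∑-cong λ u → E-distribution (*-nonzero c≢𝟘 πᵉ-nonzero) (λ x → G (E u c ℤ.+ x)))
        (E-distribution c≢𝟘 (λ y → D (λ x → G (y ℤ.+ x))))
      degenerate : ∑ (λ u → ∑ (λ v → G (E u 𝟘 ℤ.+ E v (𝟘 ⊗ π ↑ e)))) ≡ D₀ (λ y → D₀ (λ x → G (y ℤ.+ x)))
      degenerate = trans
        (∑-cong λ u → trans (∑-cong λ v → cong (λ c → G (E u 𝟘 ℤ.+ E v c)) (zeroˡ (π ↑ e)))
          (E-distribution₀ (λ x → G (E u 𝟘 ℤ.+ x))))
        (E-distribution₀ (λ y → D₀ (λ x → G (y ℤ.+ x))))

  -- The seven weights and their frequencies

  module Frequencies where
    open Forms
    open Rank
    open Weights
    open FrequencyPolynomial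
    open Algebra.Properties.AbelianGroup ℤ.+-0-abelianGroup using ()
      renaming (∙-cancelˡ to +-cancelˡ-ℤ)

    -- Sums of two values of E. The values - 2 P and - P come from c = 𝟘 only; the others are the
    -- sums of two elements of { - S , 0 , S }.
    excessValue : Fin 7 → ℤ
    excessValue 0F = ℤ.- + (P ℕ.+ P)
    excessValue 1F = ℤ.- + P
    excessValue 2F = ℤ.- + (S ℕ.+ S)
    excessValue 3F = ℤ.- + S
    excessValue 4F = 0ℤ
    excessValue 5F = + S
    excessValue 6F = + (S ℕ.+ S)

    weightValue : Fin 7 → ℕ
    weightValue 0F = 0
    weightValue 1F = h ℕ.* P
    weightValue 2F = (h ℕ.+ h) ℕ.* (P ℕ.∸ S)
    weightValue 3F = h ℕ.* (2 ℕ.* P ℕ.∸ S)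
    weightValue 4F = (h ℕ.+ h) ℕ.* P
    weightValue 5F = h ℕ.* (2 ℕ.* P ℕ.+ S)
    weightValue 6F = (h ℕ.+ h) ℕ.* (P ℕ.+ S)

    frequencyValue : Fin 7 → ℤ
    frequencyValue = value (+ q) (+ P) n₊ n₋

    S-positive : 0 < S
    S-positive = ℕ.<-trans (s≤s z≤n) 2<S

    S<P : S < P
    S<P = ℕ.≤-<-trans (ℕ.m≤m+n S (S ℕ.+ 0)) 2S<P

    excessValue-injective : Injective _≡_ _≡_ excessValue
    excessValue-injective = increasing⇒injective excessValue increasing
      where
      P-positive : 0 < P
      P-positive = ℕ.≤-<-trans z≤n S<P
      increasing : ∀ i → excessValue (inject₁ i) ℤ.< excessValue (suc i)
      increasing 0F = ℤ.neg-mono-< (ℤ.+<+ (ℕ.m<m+n P P-positive))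
      increasing 1F = ℤ.neg-mono-< (ℤ.+<+ (subst (_< P) (cong (ℕ._+_ S) (ℕ.+-identityʳ S)) 2S<P))
      increasing 2F = ℤ.neg-mono-< (ℤ.+<+ (ℕ.m<m+n S S-positive))
      increasing 3F = ℤ.neg-mono-< (ℤ.+<+ S-positive)
      increasing 4F = ℤ.+<+ S-positive
      increasing 5F = ℤ.+<+ (ℕ.m<m+n S S-positive)

    private
      monus : ∀ {m n} → n ≤ m → + (m ℕ.∸ n) ≡ + m ℤ.- + n
      monus {m} {n} n≤m = trans (sym (ℤ.⊖-≥ n≤m)) (sym (ℤ.m-n≡m⊖n m n))

      S≤2P : S ≤ 2 ℕ.* P
      S≤2P = ℕ.≤-trans (ℕ.<⇒≤ S<P) (ℕ.m≤m+n P (P ℕ.+ 0))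

    weightValue≡ : ∀ i → + weightValue i ≡ + h ℤ.* (+ 2 ℤ.* + P ℤ.+ excessValue i)
    weightValue≡ 0F = identity (+ h) (+ P)
      where
      identity : ∀ h P → 0ℤ ≡ h ℤ.* (+ 2 ℤ.* P ℤ.+ ℤ.- (P ℤ.+ P))
      identity = ℤ-solve-∀
    weightValue≡ 1F = trans (ℤ.pos-* h P) (identity (+ h) (+ P))
      where
      identity : ∀ h P → h ℤ.* P ≡ h ℤ.* (+ 2 ℤ.* P ℤ.+ ℤ.- P)
      identity = ℤ-solve-∀
    weightValue≡ 2F = trans (ℤ.pos-* (h ℕ.+ h) (P ℕ.∸ S))
      (trans (cong (ℤ._*_ (+ (h ℕ.+ h))) (monus (ℕ.<⇒≤ S<P))) (identity (+ h) (+ P) (+ S)))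
      where
      identity : ∀ h P S → (h ℤ.+ h) ℤ.* (P ℤ.- S) ≡ h ℤ.* (+ 2 ℤ.* P ℤ.+ ℤ.- (S ℤ.+ S))
      identity = ℤ-solve-∀
    weightValue≡ 3F = trans (ℤ.pos-* h (2 ℕ.* P ℕ.∸ S)) (cong (ℤ._*_ (+ h))
      (trans (monus S≤2P) (cong (ℤ._- + S) (ℤ.pos-* 2 P))))
    weightValue≡ 4F = trans (ℤ.pos-* (h ℕ.+ h) P) (identity (+ h) (+ P))
      where
      identity : ∀ h P → (h ℤ.+ h) ℤ.* P ≡ h ℤ.* (+ 2 ℤ.* P ℤ.+ 0ℤ)
      identity = ℤ-solve-∀
    weightValue≡ 5F = trans (ℤ.pos-* h (2 ℕ.* P ℕ.+ S)) (cong (λ x → + h ℤ.* (x ℤ.+ + S)) (ℤ.pos-* 2 P))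
    weightValue≡ 6F = trans (ℤ.pos-* (h ℕ.+ h) (P ℕ.+ S)) (identity (+ h) (+ P) (+ S))
      where
      identity : ∀ h P S → (h ℤ.+ h) ℤ.* (P ℤ.+ S) ≡ h ℤ.* (+ 2 ℤ.* P ℤ.+ (S ℤ.+ S))
      identity = ℤ-solve-∀

    private
      -S-S : ℤ.- + S ℤ.+ ℤ.- + S ≡ ℤ.- + (S ℕ.+ S)
      -S-S = sym (ℤ.neg-distrib-+ (+ S) (+ S))
      -P-P : ℤ.- + P ℤ.+ ℤ.- + P ≡ ℤ.- + (P ℕ.+ P)
      -P-P = sym (ℤ.neg-distrib-+ (+ P) (+ P))

    private
      generic : ∀ {x y} → x ≡ 0ℤ ⊎ x ≡ + S ⊎ x ≡ ℤ.- + S → y ≡ 0ℤ ⊎ y ≡ + S ⊎ y ≡ ℤ.- + S →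
                ∃ λ i → x ℤ.+ y ≡ excessValue (suc i)
      generic (inj₁ refl) (inj₁ refl) = 3F , refl
      generic (inj₁ refl) (inj₂ (inj₁ refl)) = 4F , refl
      generic (inj₁ refl) (inj₂ (inj₂ refl)) = 2F , ℤ.+-identityˡ (ℤ.- + S)
      generic (inj₂ (inj₁ refl)) (inj₁ refl) = 4F , ℤ.+-identityʳ (+ S)
      generic (inj₂ (inj₁ refl)) (inj₂ (inj₁ refl)) = 5F , refl
      generic (inj₂ (inj₁ refl)) (inj₂ (inj₂ refl)) = 3F , ℤ.+-inverseʳ (+ S)
      generic (inj₂ (inj₂ refl)) (inj₁ refl) = 2F , ℤ.+-identityʳ (ℤ.- + S)
      generic (inj₂ (inj₂ refl)) (inj₂ (inj₁ refl)) = 3F , ℤ.+-inverseˡ (+ S)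
      generic (inj₂ (inj₂ refl)) (inj₂ (inj₂ refl)) = 1F , -S-S

    Zero : Fin q → Fin q → Fin q → Set
    Zero a b c = a ≡ 𝟘 × b ≡ 𝟘 × c ≡ 𝟘

    -- The lowest value is recorded together with the vanishing of the triple; the injectivity of
    -- the encoding, hence the dimension and the minimum distance, rest on this.
    excess-values : ∀ a b c → (Zero a b c × wordExcess a b c ≡ excessValue 0F) ⊎
                              ∃ λ i → wordExcess a b c ≡ excessValue (suc i)
    excess-values a b c = cases (c Fin.≟ 𝟘)
      where
      u = a ⊕ b
      v = (a ⊕ ⊖ b) ⊗ π
      Values : Fin q → Fin q → Set
      Values c c′ = (Zero a b c × E u c ℤ.+ E v c′ ≡ excessValue 0F) ⊎ ∃ λ i → E u c ℤ.+ E v c′ ≡ excessValue (suc i)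
      zero-word : u ≡ 𝟘 → v ≡ 𝟘 → a ≡ 𝟘 × b ≡ 𝟘
      zero-word u≡𝟘 v≡𝟘 = a≡𝟘 , trans (sym (+-identityˡ b)) (trans (cong (_⊕ b) (sym a≡𝟘)) u≡𝟘)
        where
        a≡b : a ≡ b
        a≡b = sub≡𝟘⇒≡ (*-cancelʳ π π-nonzero (trans v≡𝟘 (sym (zeroˡ π))))
        a≡𝟘 : a ≡ 𝟘
        a≡𝟘 = double≡𝟘⇒≡𝟘 (trans (cong (a ⊕_) a≡b) u≡𝟘)
      diagonal : Dec (u ≡ 𝟘) → Dec (v ≡ 𝟘) → Values 𝟘 𝟘
      diagonal (yes u≡𝟘) (yes v≡𝟘) = inj₁ ((proj₁ (zero-word u≡𝟘 v≡𝟘) , proj₂ (zero-word u≡𝟘 v≡𝟘) , refl) ,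
        trans (cong₂ (λ x y → E x 𝟘 ℤ.+ E y 𝟘) u≡𝟘 v≡𝟘) (trans (cong₂ ℤ._+_ E-𝟘𝟘 E-𝟘𝟘) -P-P))
      diagonal (yes u≡𝟘) (no v≢𝟘) = inj₂ (0F , trans (cong₂ ℤ._+_ (trans (cong (λ x → E x 𝟘) u≡𝟘) E-𝟘𝟘) (E-diagonal v≢𝟘)) (ℤ.+-identityʳ (ℤ.- + P)))
      diagonal (no u≢𝟘) (yes v≡𝟘) = inj₂ (0F , trans (cong₂ ℤ._+_ (E-diagonal u≢𝟘) (trans (cong (λ x → E x 𝟘) v≡𝟘) E-𝟘𝟘)) (ℤ.+-identityˡ (ℤ.- + P)))
      diagonal (no u≢𝟘) (no v≢𝟘) = inj₂ (3F , cong₂ ℤ._+_ (E-diagonal u≢𝟘) (E-diagonal v≢𝟘))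
      zero-case : ∀ {c c′} → c ≡ 𝟘 → c′ ≡ 𝟘 → Values c c′
      zero-case refl refl = diagonal (u Fin.≟ 𝟘) (v Fin.≟ 𝟘)
      cases : Dec (c ≡ 𝟘) → Values c (c ⊗ π ↑ e)
      cases (yes c≡𝟘) = zero-case c≡𝟘 (trans (cong (_⊗ π ↑ e) c≡𝟘) (zeroˡ (π ↑ e)))
      cases (no c≢𝟘) = inj₂ (generic (E-values u c≢𝟘) (E-values v (*-nonzero c≢𝟘 πᵉ-nonzero)))

    weight-values : ∀ a b c → (Zero a b c × wordWeight a b c ≡ + weightValue 0F) ⊎
                              ∃ λ i → wordWeight a b c ≡ + weightValue (suc i)
    weight-values a b c = Sum.map (λ (z , eq) → z , weight 0F eq) (λ (i , eq) → i , weight (suc i) eq) (excess-values a b c)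
      where
      weight : ∀ i → wordExcess a b c ≡ excessValue i → wordWeight a b c ≡ + weightValue i
      weight i eq = trans (wordWeight≡ a b c)
        (trans (cong (λ x → + h ℤ.* (+ 2 ℤ.* + P ℤ.+ x)) eq) (sym (weightValue≡ i)))

    private
      D-eval : ∀ (g : ℤ → ℤ) {x y z} → g 0ℤ ≡ x → g (+ S) ≡ y → g (ℤ.- + S) ≡ z →
               D g ≡ (+ q ℤ.- + P) ℤ.* x ℤ.+ (n₋ ℤ.* y ℤ.+ n₊ ℤ.* z)
      D-eval g refl refl refl = refl

      D₀-eval : ∀ (g : ℤ → ℤ) {x y} → g 0ℤ ≡ x → g (ℤ.- + P) ≡ y → D₀ g ≡ + q ℤ.* x ℤ.+ (y ℤ.- x)
      D₀-eval g refl refl = refl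

      module Evaluation (G : ℤ → ℤ) (j : Fin 7) (G-value : ∀ {x} i → x ≡ excessValue i → G x ≡ δ j i) where
        DD≡ : D (λ y → D (λ x → G (y ℤ.+ x))) ≡ twofold (+ q) (+ P) n₊ n₋ (δ j)
        DD≡ = D-eval (λ y → D (λ x → G (y ℤ.+ x)))
          (D-eval (λ x → G (0ℤ ℤ.+ x)) (G-value 4F refl) (G-value 5F refl) (G-value 3F (ℤ.+-identityˡ (ℤ.- + S))))
          (D-eval (λ x → G (+ S ℤ.+ x)) (G-value 5F (ℤ.+-identityʳ (+ S))) (G-value 6F refl) (G-value 4F (ℤ.+-inverseʳ (+ S))))
          (D-eval (λ x → G (ℤ.- + S ℤ.+ x)) (G-value 3F (ℤ.+-identityʳ (ℤ.- + S))) (G-value 4F (ℤ.+-inverseˡ (+ S))) (G-value 2F -S-S))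

        D₀D₀≡ : D₀ (λ y → D₀ (λ x → G (y ℤ.+ x))) ≡ twofold₀ (+ q) (+ P) n₊ n₋ (δ j)
        D₀D₀≡ = D₀-eval (λ y → D₀ (λ x → G (y ℤ.+ x)))
          (D₀-eval (λ x → G (0ℤ ℤ.+ x)) (G-value 4F refl) (G-value 1F (ℤ.+-identityˡ (ℤ.- + P))))
          (D₀-eval (λ x → G (ℤ.- + P ℤ.+ x)) (G-value 1F (ℤ.+-identityʳ (ℤ.- + P))) (G-value 0F -P-P))

        excess-total : ∑ (λ a → ∑ (λ b → ∑ (λ c → G (wordExcess a b c)))) ≡ frequencyValue j
        excess-total = trans (∑-wordExcess G) (trans (cong₂ (λ x y → + q ℤ.* x ℤ.+ (y ℤ.- x)) DD≡ D₀D₀≡)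
          (total≡value (+ q) (+ P) n₊ n₋ j))

    weight-frequency : ∀ j → ∑ (λ a → ∑ (λ b → ∑ (λ c → 𝟏 (wordWeight a b c ℤ.≟ + weightValue j)))) ≡ frequencyValue j
    weight-frequency j = trans
      (∑-cong λ a → ∑-cong λ b → ∑-cong λ c → cong₂ (λ x y → 𝟏 (x ℤ.≟ y)) (wordWeight≡ a b c) (weightValue≡ j))
      (Evaluation.excess-total G j G-value)
      where
      G : ℤ → ℤ
      G x = 𝟏 (+ h ℤ.* (+ 2 ℤ.* + P ℤ.+ x) ℤ.≟ + h ℤ.* (+ 2 ℤ.* + P ℤ.+ excessValue j))
      G-value : ∀ {x} i → x ≡ excessValue i → G x ≡ δ j i
      -- The factor h ≠ 0 and the summand 2 P cancel, so two of the weights agree only if their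
      -- excess values, and hence their indices, do.
      G-value i refl = 𝟏-cong (+ h ℤ.* (+ 2 ℤ.* + P ℤ.+ excessValue i) ℤ.≟ + h ℤ.* (+ 2 ℤ.* + P ℤ.+ excessValue j)) (i Fin.≟ j)
        (λ eq → excessValue-injective (+-cancelˡ-ℤ (+ 2 ℤ.* + P) _ _
          (ℤ.*-cancelˡ-≡ (+ h) (+ 2 ℤ.* + P ℤ.+ excessValue i) (+ 2 ℤ.* + P ℤ.+ excessValue j)
            {{ℕ.>-nonZero h-positive}} eq)))
        (cong (λ i → + h ℤ.* (+ 2 ℤ.* + P ℤ.+ excessValue i)))

  -- Linearity, cyclic shift and minimum weight in terms of the parameters

  module Words where
    open Powers
    open Forms
    open Rank using (E; E-diagonal)
    open Weights
    open Frequencies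
    open ≡-Reasoning

    entry-+ : ∀ a b c a′ b′ c′ t → entry (a ⊕ a′) (b ⊕ b′) (c ⊕ c′) t ≡ entry a b c t K.⊕ entry a′ b′ c′ t
    entry-+ a b c a′ b′ c′ t = trans (cong Tr
      (solve 9 (λ a b c a′ b′ c′ x y z → (a :+ a′) :* x :+ (b :+ b′) :* y :+ (c :+ c′) :* z :=
        (a :* x :+ b :* y :+ c :* z) :+ (a′ :* x :+ b′ :* y :+ c′ :* z)) refl a b c a′ b′ c′
        (π ↑ t) ((⊖ π) ↑ t) (π ↑ (((p ^ k ℕ.+ 1) ℕ.* t) / 2)))) (Tr-+ _ _)

    entry-scale : ∀ s a b c t → entry (ι s ⊗ a) (ι s ⊗ b) (ι s ⊗ c) t ≡ s K.⊗ entry a b c t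
    entry-scale s a b c t = trans (cong Tr
      (solve 7 (λ s a b c x y z → (s :* a) :* x :+ (s :* b) :* y :+ (s :* c) :* z :=
        s :* (a :* x :+ b :* y :+ c :* z)) refl (ι s) a b c
        (π ↑ t) ((⊖ π) ↑ t) (π ↑ (((p ^ k ℕ.+ 1) ℕ.* t) / 2)))) (Tr-scale s _)

    entry-𝟘 : ∀ t → entry 𝟘 𝟘 𝟘 t ≡ K.𝟘
    entry-𝟘 t = trans (cong Tr (solve 3 (λ x y z → con 0ℤ :* x :+ con 0ℤ :* y :+ con 0ℤ :* z := con 0ℤ) refl
      (π ↑ t) ((⊖ π) ↑ t) (π ↑ (((p ^ k ℕ.+ 1) ℕ.* t) / 2)))) Tr-𝟘

    entry-neg : ∀ a b c t → entry (⊖ a) (⊖ b) (⊖ c) t ≡ K.⊖ entry a b c t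
    entry-neg a b c t = trans (cong Tr
      (solve 6 (λ a b c x y z → (:- a) :* x :+ (:- b) :* y :+ (:- c) :* z := :- (a :* x :+ b :* y :+ c :* z))
        refl a b c (π ↑ t) ((⊖ π) ↑ t) (π ↑ (((p ^ k ℕ.+ 1) ℕ.* t) / 2)))) (Tr-neg _)

    entry-difference : ∀ a b c a′ b′ c′ t → entry (a ⊕ ⊖ a′) (b ⊕ ⊖ b′) (c ⊕ ⊖ c′) t ≡ entry a b c t K.⊕ K.⊖ entry a′ b′ c′ t
    entry-difference a b c a′ b′ c′ t =
      trans (entry-+ a b c (⊖ a′) (⊖ b′) (⊖ c′) t) (cong (entry a b c t K.⊕_) (entry-neg a′ b′ c′ t))

    private
      _/ᶠ_ : Fin q → ∀ {x} → x ≢ 𝟘 → Fin q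
      _/ᶠ_ a {x} x≢𝟘 = a ⊗ proj₁ (inverse x x≢𝟘)

      /ᶠ-cancel : ∀ a {x} (x≢𝟘 : x ≢ 𝟘) y → (a /ᶠ x≢𝟘) ⊗ (x ⊗ y) ≡ a ⊗ y
      /ᶠ-cancel a {x} x≢𝟘 y = trans
        (solve 4 (λ a w x y → (a :* w) :* (x :* y) := a :* ((x :* w) :* y)) refl a (proj₁ (inverse x x≢𝟘)) x y)
        (cong (a ⊗_) (trans (cong (_⊗ y) (proj₂ (inverse x x≢𝟘))) (*-identityˡ y)))

    -- A cyclic shift moves entry t to position t + 1, so each parameter is divided by the factor
    -- that its term gains in one step: π, - π and π ^ e.
    rotateᵃ rotateᵇ rotateᶜ : Fin q → Fin q
    rotateᵃ a = a /ᶠ π-nonzero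
    rotateᵇ b = b /ᶠ neg-nonzero π-nonzero
    rotateᶜ c = c /ᶠ πᵉ-nonzero

    entry-suc : ∀ a b c t → entry (rotateᵃ a) (rotateᵇ b) (rotateᶜ c) (suc t) ≡ entry a b c t
    entry-suc a b c t = cong Tr (cong₂ _⊕_
      (cong₂ _⊕_ (/ᶠ-cancel a π-nonzero (π ↑ t)) (/ᶠ-cancel b (neg-nonzero π-nonzero) ((⊖ π) ↑ t)))
      (begin
        rotateᶜ c ⊗ π ↑ (((p ^ k ℕ.+ 1) ℕ.* suc t) / 2)
          ≡⟨ cong (λ n → rotateᶜ c ⊗ π ↑ n) (trans (exponent≡ (suc t)) (ℕ.*-suc e t)) ⟩
        rotateᶜ c ⊗ π ↑ (e ℕ.+ e ℕ.* t)          ≡⟨ cong (rotateᶜ c ⊗_) (^-homo-* π e (e ℕ.* t)) ⟩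
        rotateᶜ c ⊗ (π ↑ e ⊗ π ↑ (e ℕ.* t))      ≡⟨ /ᶠ-cancel c πᵉ-nonzero (π ↑ (e ℕ.* t)) ⟩
        c ⊗ π ↑ (e ℕ.* t)                        ≡⟨ cong (λ n → c ⊗ π ↑ n) (exponent≡ t) ⟨
        c ⊗ π ↑ (((p ^ k ℕ.+ 1) ℕ.* t) / 2)      ∎))

    -- All three terms have period q - 1: this number is even, which takes care of - π, and e (q -
    -- 1) is a multiple of it.
    entry-periodic : ∀ a b c → entry a b c (q ℕ.∸ 1) ≡ entry a b c 0
    entry-periodic a b c = trans (cong (entry a b c) q-1≡) (cong Tr (cong₂ _⊕_
      (cong₂ (λ x y → a ⊗ x ⊕ b ⊗ y) π^M (trans (neg-square-power H) (trans (sym (^-homo-* π H H)) π^M≡𝟙)))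
      (cong (c ⊗_) (begin
        π ↑ (((p ^ k ℕ.+ 1) ℕ.* (H ℕ.* 2)) / 2)      ≡⟨ cong (π ↑_) (trans (exponent≡ (H ℕ.* 2)) (ℕ.*-comm e (H ℕ.* 2))) ⟩
        π ↑ (H ℕ.* 2 ℕ.* e)                          ≡⟨ ^-assocʳ π (H ℕ.* 2) e ⟨
        (π ↑ (H ℕ.* 2)) ↑ e                          ≡⟨ trans (cong (_↑ e) π^M) (𝟙↑ e) ⟩
        𝟙                                            ≡⟨⟩
        π ↑ 0                                        ≡⟨ cong (π ↑_) (trans (exponent≡ 0) (ℕ.*-zeroʳ e)) ⟨
        π ↑ (((p ^ k ℕ.+ 1) ℕ.* 0) / 2)              ∎))))
      where
      π^M : π ↑ (H ℕ.* 2) ≡ 𝟙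
      π^M = trans (cong (π ↑_) (trans (ℕ.*-comm H 2) (cong (ℕ._+_ H) (ℕ.+-identityʳ H)))) π^M≡𝟙

    -- A vanishing word has weight 0, and the excess values with positive index give weights
    -- different from 0.
    zero-word⇒zero : ∀ a b c → (∀ t → entry a b c (toℕ {q ℕ.∸ 1} t) ≡ K.𝟘) → Zero a b c
    zero-word⇒zero a b c vanish = Sum.[ proj₁ , (λ (i , eq) → contradiction (trans (sym weight≡0) eq) (nonzero i)) ]′ (weight-values a b c)
      where
      weight≡0 : wordWeight a b c ≡ 0ℤ
      weight≡0 = ∑-zero {q ℕ.∸ 1} λ t → 𝟏-false (¬? (entry a b c (toℕ t) Fin.≟ K.𝟘)) (λ ≢𝟘 → ≢𝟘 (vanish t))
      nonzero : ∀ i → 0ℤ ≢ + weightValue (suc i)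
      nonzero i eq = contradiction (excessValue-injective {0F} {suc i} (+-cancelˡ-ℤ (+ 2 ℤ.* + P) _ _
        (ℤ.*-cancelˡ-≡ (+ h) _ _ {{ℕ.>-nonZero h-positive}}
          (trans (sym (weightValue≡ 0F)) (trans eq (weightValue≡ (suc i))))))) λ ()
        where
        open Algebra.Properties.AbelianGroup ℤ.+-0-abelianGroup using ()
          renaming (∙-cancelˡ to +-cancelˡ-ℤ)

    -- The closest competitor is 2 h (P - S), which is at least h P because 2 S < P.
    minimum-weight : ∀ i → h ℕ.* P ≤ weightValue (suc i)
    minimum-weight 0F = ℕ.≤-refl
    minimum-weight 1F = subst (h ℕ.* P ≤_) (assoc h (P ℕ.∸ S)) (ℕ.*-monoʳ-≤ h
      (subst (P ≤_) (sym (ℕ.*-distribˡ-∸ 2 P S)) (ℕ.m+n≤o⇒m≤o∸n P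
        (ℕ.≤-trans (ℕ.+-monoʳ-≤ P (ℕ.<⇒≤ 2S<P)) (ℕ.≤-reflexive (cong (ℕ._+_ P) (sym (ℕ.+-identityʳ P))))))))
      where
      assoc : ∀ h x → h ℕ.* (2 ℕ.* x) ≡ (h ℕ.+ h) ℕ.* x
      assoc = ℕ-solve-∀
    minimum-weight 2F = ℕ.*-monoʳ-≤ h (ℕ.m+n≤o⇒m≤o∸n P
      (ℕ.≤-trans (ℕ.+-monoʳ-≤ P (ℕ.<⇒≤ S<P)) (ℕ.≤-reflexive (cong (ℕ._+_ P) (sym (ℕ.+-identityʳ P))))))
    minimum-weight 3F = ℕ.*-monoˡ-≤ P (ℕ.m≤m+n h h)
    minimum-weight 4F = ℕ.*-monoʳ-≤ h (ℕ.≤-trans (ℕ.m≤m+n P (P ℕ.+ 0)) (ℕ.m≤m+n (2 ℕ.* P) S))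
    minimum-weight 5F = ℕ.*-mono-≤ (ℕ.m≤m+n h h) (ℕ.m≤m+n P S)

    -- For a = b = 𝟙 and c = 𝟘 the odd positions carry the zero form, with excess - P, and the even
    -- ones the form with u = 2 ≠ 𝟘, with excess 0.
    minimum-attained : wordWeight 𝟙 𝟙 𝟘 ≡ + (h ℕ.* P)
    minimum-attained = trans (wordWeight≡ 𝟙 𝟙 𝟘) (trans (cong (λ x → + h ℤ.* (+ 2 ℤ.* + P ℤ.+ x)) excess≡) (sym (weightValue≡ 1F)))
      where
      excess≡ : wordExcess 𝟙 𝟙 𝟘 ≡ ℤ.- + P
      excess≡ = trans (cong₂ ℤ._+_
        (E-diagonal (λ 2≡𝟘 → 𝟘≢𝟙 (sym (double≡𝟘⇒≡𝟘 2≡𝟘))))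
        (trans (cong₂ E (trans (cong (_⊗ π) (-‿inverseʳ 𝟙)) (zeroˡ π)) (zeroˡ (π ↑ e))) E-𝟘𝟘))
        (ℤ.+-identityˡ (ℤ.- + P))

    parameterSpace : FiniteVectorSpace K (q ℕ.* (q ℕ.* q))
    parameterSpace = record
      { V = Fin q × Fin q × Fin q
      ; _+ᵥ_ = λ (a , b , c) (a′ , b′ , c′) → a ⊕ a′ , b ⊕ b′ , c ⊕ c′
      ; 0ᵥ = 𝟘 , 𝟘 , 𝟘
      ; _∙_ = λ s (a , b , c) → ι s ⊗ a , ι s ⊗ b , ι s ⊗ c
      ; +ᵥ-assoc = λ (a , b , c) (a′ , b′ , c′) (a″ , b″ , c″) →
          triple (+-assoc a a′ a″) (+-assoc b b′ b″) (+-assoc c c′ c″)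
      ; +ᵥ-comm = λ (a , b , c) (a′ , b′ , c′) → triple (+-comm a a′) (+-comm b b′) (+-comm c c′)
      ; +ᵥ-identityˡ = λ (a , b , c) → triple (+-identityˡ a) (+-identityˡ b) (+-identityˡ c)
      ; ∙-distribˡ = λ s (a , b , c) (a′ , b′ , c′) →
          triple (distribˡ (ι s) a a′) (distribˡ (ι s) b b′) (distribˡ (ι s) c c′)
      ; ∙-distribʳ = λ s t (a , b , c) → triple (add s t a) (add s t b) (add s t c)
      ; ∙-assoc = λ s t (a , b , c) → triple (multiply s t a) (multiply s t b) (multiply s t c)
      ; ∙-identity = λ (a , b , c) → triple (one a) (one b) (one c)
      ; ∙-zeroˡ = λ (a , b , c) → triple (zero′ a) (zero′ b) (zero′ c)
      ; ∙-zeroʳ = λ s → triple (zeroʳ (ι s)) (zeroʳ (ι s)) (zeroʳ (ι s))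
      ; encode = λ (a , b , c) → combine a (combine b c)
      ; decode = decode
      ; encode-decode = λ i → trans (cong (combine (proj₁ (remQuot {q} (q ℕ.* q) i))) (Fin.combine-remQuot {q} q _))
          (Fin.combine-remQuot {q} (q ℕ.* q) i)
      ; decode-encode = λ (a , b , c) → trans (cong (λ (x , y) → x , remQuot {q} q y) (Fin.remQuot-combine a (combine b c)))
          (cong (a ,_) (Fin.remQuot-combine b c))
      }
      where
      triple : ∀ {a a′ b b′ c c′ : Fin q} → a ≡ a′ → b ≡ b′ → c ≡ c′ → (a , b , c) ≡ (a′ , b′ , c′)
      triple refl refl refl = refl
      add : ∀ s t x → ι (s K.⊕ t) ⊗ x ≡ ι s ⊗ x ⊕ ι t ⊗ x
      add s t x = trans (cong (_⊗ x) (ι-+ s t)) (distribʳ x (ι s) (ι t))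
      multiply : ∀ s t x → ι (s K.⊗ t) ⊗ x ≡ ι s ⊗ (ι t ⊗ x)
      multiply s t x = trans (cong (_⊗ x) (ι-* s t)) (*-assoc (ι s) (ι t) x)
      one : ∀ x → ι K.𝟙 ⊗ x ≡ x
      one x = trans (cong (_⊗ x) ι-𝟙) (*-identityˡ x)
      zero′ : ∀ x → ι K.𝟘 ⊗ x ≡ 𝟘
      zero′ x = trans (cong (_⊗ x) ι-𝟘) (zeroˡ x)
      decode : Fin (q ℕ.* (q ℕ.* q)) → Fin q × Fin q × Fin q
      decode i = proj₁ (remQuot {q} (q ℕ.* q) i) , remQuot {q} q (proj₂ (remQuot {q} (q ℕ.* q) i))

    module Parameters = Bases parameterSpace

    entryᵥ : Fin q × Fin q × Fin q → ℕ → Fin p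
    entryᵥ (a , b , c) = entry a b c

    -- The code is the image of F³ under an injective K-linear map, so its basis is taken from F³,
    -- which has q³ = p ^ (3 m) elements.
    parameterBasis : ∃ λ (g : Fin (3 ℕ.* m) → Fin q × Fin q × Fin q) →
                     Parameters.Independent g × (∀ v → Parameters.Spanned g v)
    parameterBasis = Parameters.basis p>1 (3 ℕ.* m) (begin
      p ^ (3 ℕ.* m)           ≡⟨ cong (p ^_) (ℕ.*-comm 3 m) ⟩
      p ^ (m ℕ.* 3)           ≡⟨ ℕ.^-*-assoc p m 3 ⟨
      q ℕ.* (q ℕ.* (q ℕ.* 1)) ≡⟨ cong (λ x → q ℕ.* (q ℕ.* x)) (ℕ.*-identityʳ q) ⟩
      q ℕ.* (q ℕ.* q)         ∎)

-- The code

module Main {c₁ c₂ ℓ₁ ℓ₂ : Level} (p h r k : ℕ) (p-prime : Prime p) (p-odd : p ≡ suc (h ℕ.+ h))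
  (1≤r : 1 ≤ r) (coprime : gcd (suc (r ℕ.+ r)) k ≡ 1)
  (K₀ : FiniteField c₁ ℓ₁ p) (F₀ : FiniteField c₂ ℓ₂ (p ^ suc (r ℕ.+ r)))
  (ι₀ : FiniteField.Carrier K₀ → FiniteField.Carrier F₀) (embedding : IsEmbedding K₀ F₀ ι₀)
  (Tr₀ : FiniteField.Carrier F₀ → FiniteField.Carrier K₀) (trace : IsTrace K₀ F₀ (suc (r ℕ.+ r)) ι₀ Tr₀)
  (π₀ : FiniteField.Carrier F₀) (π-primitive : FiniteField.IsPrimitive F₀ π₀) where

  private
    module K₀ = FiniteField K₀
    module F₀ = FiniteField F₀
    module KR = CommutativeRing K₀.commutativeRing
    module FR = CommutativeRing F₀.commutativeRing
    module KE = Transfer K₀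
    module FE = Transfer F₀
    module ι₀ = RingMorphisms.IsRingHomomorphism embedding
    module π₀ = F₀.IsPrimitive π-primitive

  setting : Setting p h r k
  setting = record
    { p-prime = p-prime
    ; p-odd = p-odd
    ; 1≤r = 1≤r
    ; coprime = gcd≡1⇒coprime coprime
    ; K = KE.model
    ; F = FE.model
    ; ι = ι′
    ; ι-+ = λ s t → trans (FE.encode-cong (FR.trans (ι₀.⟦⟧-cong (KE.decode-encode _)) (ι₀.+-homo _ _))) (FE.encode-⊕ _ _)
    ; ι-* = λ s t → trans (FE.encode-cong (FR.trans (ι₀.⟦⟧-cong (KE.decode-encode _)) (ι₀.*-homo _ _))) (FE.encode-⊗ _ _)
    ; ι-𝟙 = FE.encode-cong (FR.trans (ι₀.⟦⟧-cong (KE.decode-encode _)) ι₀.1#-homo)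
    ; Tr = λ x → KE.encode (Tr₀ (FE.decode x))
    ; Tr-conjugates = λ x → trans (conjugates (FE.decode x))
        (Sums.sum-cong-≗ {suc (r ℕ.+ r)} (λ i → cong (λ y → FinField._↑_ FE.model y (p ^ toℕ i)) (FE.encode-decode x)))
    ; π = FE.encode π₀
    ; π-nonzero = π₀.nonzero ∘ FE.encode-injective
    ; π-generates = λ x x≢𝟘 →
        let t , eq = π₀.generates (FE.decode x) (λ e → x≢𝟘 (trans (sym (FE.encode-decode x)) (FE.encode-cong e)))
        in t , trans (sym (FE.encode-decode x)) (trans (FE.encode-cong eq) (FE.encode-↑ π₀ t))
    }
    where
    ι′ : Fin p → Fin (p ^ suc (r ℕ.+ r))
    ι′ s = FE.encode (ι₀ (KE.decode s))
    module Sums = Algebra.Properties.Semiring.Sum (FinField.semiring FE.model)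
    conjugates : ∀ x → ι′ (KE.encode (Tr₀ x)) ≡ Sums.sum {suc (r ℕ.+ r)} (λ i → FinField._↑_ FE.model (FE.encode x) (p ^ toℕ i))
    conjugates x = trans (FE.encode-cong (FR.trans (ι₀.⟦⟧-cong (KE.decode-encode _)) (trace x)))
      (trans (FE.encode-sum {suc (r ℕ.+ r)} (λ i → x F₀.↑ (p ^ toℕ i))) (Sums.sum-cong-≗ {suc (r ℕ.+ r)} (λ i → FE.encode-↑ x (p ^ toℕ i))))

  open Theory setting hiding (p-prime; p-odd; 1≤r; coprime)
  open Weights
  open Frequencies
  open Words
  open CyclicCode p m k K₀ F₀ Tr₀ π₀
  open Coding K₀
  open ListCounting
  open ≡-Reasoning

  -- `Tr₀` is not assumed to respect `≈`, so `decode (encode x)` cannot simply be replaced by x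
  -- beneath it. Both sides are compared under the injective ι, where the sum of conjugates
  -- determines them.
  encode-Tr : ∀ x → KE.encode (Tr₀ x) ≡ Tr (FE.encode x)
  encode-Tr x = ι-injective (trans
    (FE.encode-cong (FR.trans (ι₀.⟦⟧-cong (KE.decode-encode (Tr₀ x))) (trace x)))
    (trans (FE.encode-sum {m} (λ i → x F₀.↑ (p ^ toℕ i)))
      (trans (Sums.sum-cong-≗ {m} (λ i → FE.encode-↑ x (p ^ toℕ i))) (sym (Tr-conjugates (FE.encode x))))))
    where module Sums = Algebra.Properties.Semiring.Sum semiring

  encode-codeword : ∀ x y z t → KE.encode (codeword x y z t) ≡ entry (FE.encode x) (FE.encode y) (FE.encode z) (toℕ t)
  encode-codeword x y z i = trans (encode-Tr _) (cong Tr (trans (FE.encode-⊕ _ _)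
    (cong₂ _⊕_ (trans (FE.encode-⊕ _ _) (cong₂ _⊕_
        (trans (FE.encode-⊗ x _) (cong (FE.encode x ⊗_) (FE.encode-↑ π₀ t)))
        (trans (FE.encode-⊗ y _) (cong (FE.encode y ⊗_) (trans (FE.encode-↑ (F₀.⊖ π₀) t) (cong (_↑ t) (FE.encode-⊖ π₀)))))))
      (trans (FE.encode-⊗ z _) (cong (FE.encode z ⊗_) (FE.encode-↑ π₀ (((p ^ k ℕ.+ 1) ℕ.* t) / 2)))))))
    where t = toℕ i

  word : Fin q × Fin q × Fin q → Word (q ℕ.∸ 1)
  word (a , b , c) = codeword (FE.decode a) (FE.decode b) (FE.decode c)

  encode-word : ∀ v t → KE.encode (word v t) ≡ entryᵥ v (toℕ t)
  encode-word (a , b , c) t = trans (encode-codeword _ _ _ t) (decoded (FE.encode-decode a) (FE.encode-decode b) (FE.encode-decode c))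
    where
    decoded : ∀ {a a′ b b′ c c′} → a ≡ a′ → b ≡ b′ → c ≡ c′ → entry a b c (toℕ t) ≡ entry a′ b′ c′ (toℕ t)
    decoded refl refl refl = refl

  parameters : F₀.Carrier → F₀.Carrier → F₀.Carrier → Fin q × Fin q × Fin q
  parameters x y z = FE.encode x , FE.encode y , FE.encode z

  Encodes : Word (q ℕ.∸ 1) → Fin q × Fin q × Fin q → Set
  Encodes u v = ∀ t → KE.encode (u t) ≡ entryᵥ v (toℕ t)

  encodes⇒code : ∀ {u v} → Encodes u v → code u
  encodes⇒code {u} {a , b , c} enc = FE.decode a , FE.decode b , FE.decode c ,
    λ t → KE.encode-injective (trans (enc t) (sym (encode-word (a , b , c) t)))

  code⇒encodes : ∀ {u} → code u → ∃ (Encodes u)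
  code⇒encodes (x , y , z , u≋) = parameters x y z , λ t → trans (KE.encode-cong (u≋ t)) (encode-codeword x y z t)

  distance : ∀ {u v a b c a′ b′ c′} → Encodes u (a , b , c) → Encodes v (a′ , b′ , c′) →
             + hammingDistance u v ≡ wordWeight (a ⊕ ⊖ a′) (b ⊕ ⊖ b′) (c ⊕ ⊖ c′)
  distance {u} {v} {a} {b} {c} {a′} {b′} {c′} eu ev = trans (count-tabulate (λ t → ¬? (u t K₀.≟ v t)) (λ t → t))
    (∑-cong {q ℕ.∸ 1} λ t → 𝟏-cong (¬? (u t K₀.≟ v t)) (¬? (entry (a ⊕ ⊖ a′) (b ⊕ ⊖ b′) (c ⊕ ⊖ c′) (toℕ t) Fin.≟ K.𝟘))
      (λ u≉v e → u≉v (KE.encode-injective (trans (eu t) (trans (K.sub≡𝟘⇒≡ (trans (sym (entry-difference a b c a′ b′ c′ (toℕ t))) e)) (sym (ev t))))))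
      (λ ≢𝟘 u≈v → ≢𝟘 (trans (entry-difference a b c a′ b′ c′ (toℕ t)) (trans (cong (λ x → x K.⊕ K.⊖ entry a′ b′ c′ (toℕ t))
        (trans (sym (eu t)) (trans (KE.encode-cong u≈v) (ev t)))) (K.-‿inverseʳ _)))))

  weight≡ : ∀ x y z → + weight (x , y , z) ≡ wordWeight (FE.encode x) (FE.encode y) (FE.encode z)
  weight≡ x y z = trans (count-tabulate (λ t → ¬? (codeword x y z t K₀.≟ K₀.0#)) (λ t → t))
    (∑-cong {q ℕ.∸ 1} λ t → 𝟏-cong (¬? (codeword x y z t K₀.≟ K₀.0#))
      (¬? (entry (FE.encode x) (FE.encode y) (FE.encode z) (toℕ t) Fin.≟ K.𝟘))
      (λ ≉0 e → ≉0 (KE.encode-injective (trans (encode-codeword x y z t) e)))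
      (λ ≢𝟘 e → ≢𝟘 (trans (sym (encode-codeword x y z t)) (KE.encode-cong e))))

  frequency≡ : ∀ w → + frequency w ≡ ∑ (λ a → ∑ (λ b → ∑ (λ c → 𝟏 (wordWeight a b c ℤ.≟ + w))))
  frequency≡ w = begin
    + frequency w
      ≡⟨ count-cartesianProduct P? FE.decode (λ i → i) (cartesianProduct F₀.elements F₀.elements) ⟩
    ∑ (λ a → count (λ yz → P? (FE.decode a , yz)) (cartesianProduct F₀.elements F₀.elements))
      ≡⟨ ∑-cong (λ a → count-cartesianProduct (λ yz → P? (FE.decode a , yz)) FE.decode (λ i → i) F₀.elements) ⟩
    ∑ (λ a → ∑ (λ b → count (λ z → P? (FE.decode a , FE.decode b , z)) F₀.elements))
      ≡⟨ ∑-cong (λ a → ∑-cong λ b → trans (count-map (λ z → P? (FE.decode a , FE.decode b , z)) FE.decode (allFin q))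
           (count-tabulate (λ c → P? (FE.decode a , FE.decode b , FE.decode c)) (λ i → i))) ⟩
    ∑ (λ a → ∑ (λ b → ∑ (λ c → 𝟏 (P? (FE.decode a , FE.decode b , FE.decode c)))))
      ≡⟨ ∑-cong (λ a → ∑-cong λ b → ∑-cong λ c → 𝟏-cong (P? (FE.decode a , FE.decode b , FE.decode c)) (wordWeight a b c ℤ.≟ + w)
           (λ e → trans (sym (decoded a b c)) (cong +_ e)) (λ e → ℤ.+-injective (trans (decoded a b c) e))) ⟩
    ∑ (λ a → ∑ (λ b → ∑ (λ c → 𝟏 (wordWeight a b c ℤ.≟ + w)))) ∎
    where
    P? : ∀ xyz → Dec (weight xyz ≡ w)
    P? xyz = weight xyz ℕ.≟ w
    decoded : ∀ a b c → + weight (FE.decode a , FE.decode b , FE.decode c) ≡ wordWeight a b c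
    decoded a b c = trans (weight≡ _ _ _) (rewritten (FE.encode-decode a) (FE.encode-decode b) (FE.encode-decode c))
      where
      rewritten : ∀ {a a′ b b′ c c′} → a ≡ a′ → b ≡ b′ → c ≡ c′ → wordWeight a b c ≡ wordWeight a′ b′ c′
      rewritten refl refl refl = refl

  -- Stated for every length n, because `cyclicShift` computes only on successors and q ∸ 1 is not
  -- literally one.
  cyclicShift-encodes : ∀ {n} (v : Word n) (f g : ℕ → Fin p) → (∀ t → KE.encode (v t) ≡ f (toℕ t)) →
    (∀ t → g (suc t) ≡ f t) → g 0 ≡ f (n ℕ.∸ 1) → ∀ t → KE.encode (cyclicShift v t) ≡ g (toℕ t)
  cyclicShift-encodes {suc n} v f g enc shift wrap zero = trans (enc (top n)) (trans (cong f (Fin.toℕ-fromℕ n)) (sym wrap))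
  cyclicShift-encodes {suc n} v f g enc shift wrap (suc i) =
    trans (enc (inject₁ i)) (trans (cong f (Fin.toℕ-inject₁ i)) (sym (shift (toℕ i))))

  isLinear : IsLinear code
  isLinear = record
    { respects = λ u≋v (x , y , z , u≋) → x , y , z , λ t → KR.trans (KR.sym (u≋v t)) (u≋ t)
    ; 0-closed = encodes⇒code {v = 𝟘 , 𝟘 , 𝟘} (λ t → sym (entry-𝟘 (toℕ t)))
    ; +-closed = λ {u} {v} cu cv →
        let (a , b , c) , eu = code⇒encodes cu
            (a′ , b′ , c′) , ev = code⇒encodes cv
        in encodes⇒code {v = a ⊕ a′ , b ⊕ b′ , c ⊕ c′} λ t → trans (KE.encode-⊕ (u t) (v t))
             (trans (cong₂ K._⊕_ (eu t) (ev t)) (sym (entry-+ a b c a′ b′ c′ (toℕ t))))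
    ; *-closed = λ s {v} cv →
        let (a , b , c) , ev = code⇒encodes cv
        in encodes⇒code {v = ι (KE.encode s) ⊗ a , ι (KE.encode s) ⊗ b , ι (KE.encode s) ⊗ c} λ t →
             trans (KE.encode-⊗ s (v t)) (trans (cong (KE.encode s K.⊗_) (ev t)) (sym (entry-scale (KE.encode s) a b c (toℕ t))))
    }

  shift-closed : ∀ {v} → code v → code (cyclicShift v)
  shift-closed {v} cv = encodes⇒code {v = rotateᵃ a , rotateᵇ b , rotateᶜ c}
    (cyclicShift-encodes v (entry a b c) (entry (rotateᵃ a) (rotateᵇ b) (rotateᶜ c)) ev (entry-suc a b c) wrap)
    where
    encoded = code⇒encodes cv
    a = proj₁ (proj₁ encoded)
    b = proj₁ (proj₂ (proj₁ encoded))
    c = proj₂ (proj₂ (proj₁ encoded))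
    ev = proj₂ encoded
    1≤q-1 : 1 ≤ q ℕ.∸ 1
    1≤q-1 = ℕ.m<n⇒0<n∸m (ℕ.≤-<-trans (ℕ.>-nonZero⁻¹ P {{ℕ.m^n≢0 p (r ℕ.+ r)}}) P<q)
    -- The first entry of the shifted word must be the last one of the old word, at position q - 2.
    -- By periodicity position 0 may be read as q - 1, one step after it.
    wrap : entry (rotateᵃ a) (rotateᵇ b) (rotateᶜ c) 0 ≡ entry a b c (q ℕ.∸ 1 ℕ.∸ 1)
    wrap = trans (sym (entry-periodic (rotateᵃ a) (rotateᵇ b) (rotateᶜ c)))
      (trans (cong (entry (rotateᵃ a) (rotateᵇ b) (rotateᶜ c)) (sym (ℕ.m+[n∸m]≡n 1≤q-1)))
        (entry-suc a b c (q ℕ.∸ 1 ℕ.∸ 1)))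

  encode-linearCombination : ∀ {n} (s : Fin n → K₀.Carrier) (g : Fin n → Fin q × Fin q × Fin q) t →
    KE.encode (linearCombination s (λ i → word (g i)) t) ≡ entryᵥ (Parameters.combination (λ i → KE.encode (s i)) g) (toℕ t)
  encode-linearCombination {zero} s g t = sym (entry-𝟘 (toℕ t))
  encode-linearCombination {suc n} s g t = begin
    KE.encode (s zero K₀.⊗ word (g zero) t K₀.⊕ linearCombination (s ∘ suc) (λ i → word (g (suc i))) t)
      ≡⟨ KE.encode-⊕ _ _ ⟩
    KE.encode (s zero K₀.⊗ word (g zero) t) K.⊕ KE.encode (linearCombination (s ∘ suc) (λ i → word (g (suc i))) t)
      ≡⟨ cong₂ K._⊕_ (trans (KE.encode-⊗ _ _) (cong (KE.encode (s zero) K.⊗_) (encode-word (g zero) t)))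
           (encode-linearCombination (s ∘ suc) (g ∘ suc) t) ⟩
    KE.encode (s zero) K.⊗ entry a b c (toℕ t) K.⊕ entry a′ b′ c′ (toℕ t)
      ≡⟨ cong (K._⊕ entry a′ b′ c′ (toℕ t)) (entry-scale (KE.encode (s zero)) a b c (toℕ t)) ⟨
    entry (ι′ ⊗ a) (ι′ ⊗ b) (ι′ ⊗ c) (toℕ t) K.⊕ entry a′ b′ c′ (toℕ t)
      ≡⟨ entry-+ (ι′ ⊗ a) (ι′ ⊗ b) (ι′ ⊗ c) a′ b′ c′ (toℕ t) ⟨
    entry (ι′ ⊗ a ⊕ a′) (ι′ ⊗ b ⊕ b′) (ι′ ⊗ c ⊕ c′) (toℕ t) ∎
    where
    ι′ = ι (KE.encode (s zero))
    a = proj₁ (g zero)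
    b = proj₁ (proj₂ (g zero))
    c = proj₂ (proj₂ (g zero))
    rest = Parameters.combination (λ i → KE.encode (s (suc i))) (g ∘ suc)
    a′ = proj₁ rest
    b′ = proj₁ (proj₂ rest)
    c′ = proj₂ (proj₂ rest)

  dimension : HasDimension code (3 ℕ.* m)
  dimension = (λ i → word (g i)) , record
    { contained = λ i → encodes⇒code {v = g i} (encode-word (g i))
    ; independent = λ s vanish i → KE.encode-injective (independent-g (λ i → KE.encode (s i)) (zero-parameters s vanish) i)
    ; spanning = λ {v} cv →
        let v̂ , ev = code⇒encodes cv
            s , eq = spanning-g v̂
        in (λ i → KE.decode (s i)) , λ t → KE.encode-injective (trans (ev t) (sym (trans
             (encode-linearCombination (λ i → KE.decode (s i)) g t)
             (cong (λ w → entryᵥ w (toℕ t)) (trans (Parameters.combination-cong g (λ i → KE.encode-decode (s i))) eq)))))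
    }
    where
    g = proj₁ parameterBasis
    independent-g = proj₁ (proj₂ parameterBasis)
    spanning-g = proj₂ (proj₂ parameterBasis)
    triple : ∀ {a b c} → Zero a b c → (a , b , c) ≡ (𝟘 , 𝟘 , 𝟘)
    triple (refl , refl , refl) = refl
    zero-parameters : ∀ s → linearCombination s (λ i → word (g i)) ≋ (λ _ → K₀.0#) →
                      Parameters.combination (λ i → KE.encode (s i)) g ≡ (𝟘 , 𝟘 , 𝟘)
    zero-parameters s vanish = triple (zero-word⇒zero _ _ _ λ t →
      trans (sym (encode-linearCombination s g t)) (KE.encode-cong (vanish t)))

  minimumDistance : HasMinimumDistance code (h ℕ.* P)
  minimumDistance = record
    { attained = word (𝟙 , 𝟙 , 𝟘) , word (𝟘 , 𝟘 , 𝟘) ,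
        encodes⇒code {v = 𝟙 , 𝟙 , 𝟘} (encode-word (𝟙 , 𝟙 , 𝟘)) , encodes⇒code {v = 𝟘 , 𝟘 , 𝟘} (encode-word (𝟘 , 𝟘 , 𝟘)) ,
        distinct , ℤ.+-injective attained
    ; lowerBound = λ {u} {v} cu cv u≢v →
        let (a , b , c) , eu = code⇒encodes cu
            (a′ , b′ , c′) , ev = code⇒encodes cv
        in lower {u} {v} u≢v eu ev (weight-values (a ⊕ ⊖ a′) (b ⊕ ⊖ b′) (c ⊕ ⊖ c′))
    }
    where
    minus-𝟘 : ∀ x → x ⊕ ⊖ 𝟘 ≡ x
    minus-𝟘 x = trans (cong (x ⊕_) -0#≈0#) (+-identityʳ x)
    attained : + hammingDistance (word (𝟙 , 𝟙 , 𝟘)) (word (𝟘 , 𝟘 , 𝟘)) ≡ + (h ℕ.* P)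
    attained = trans (distance (encode-word (𝟙 , 𝟙 , 𝟘)) (encode-word (𝟘 , 𝟘 , 𝟘)))
      (trans (cong₂ (λ x y → wordWeight x x y) (minus-𝟘 𝟙) (minus-𝟘 𝟘)) minimum-attained)
    distinct : ¬ (word (𝟙 , 𝟙 , 𝟘) ≋ word (𝟘 , 𝟘 , 𝟘))
    distinct same = 𝟘≢𝟙 (sym (proj₁ (zero-word⇒zero 𝟙 𝟙 𝟘 λ t →
      trans (sym (encode-word (𝟙 , 𝟙 , 𝟘) t)) (trans (KE.encode-cong (same t)) (trans (encode-word (𝟘 , 𝟘 , 𝟘) t) (entry-𝟘 (toℕ t)))))))
    lower : ∀ {u v a b c a′ b′ c′} → ¬ (u ≋ v) → Encodes u (a , b , c) → Encodes v (a′ , b′ , c′) →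
      (Zero (a ⊕ ⊖ a′) (b ⊕ ⊖ b′) (c ⊕ ⊖ c′) × wordWeight (a ⊕ ⊖ a′) (b ⊕ ⊖ b′) (c ⊕ ⊖ c′) ≡ + weightValue zero) ⊎
      (∃ λ i → wordWeight (a ⊕ ⊖ a′) (b ⊕ ⊖ b′) (c ⊕ ⊖ c′) ≡ + weightValue (suc i)) → h ℕ.* P ≤ hammingDistance u v
    lower {a = a} {b} {c} {a′} {b′} {c′} u≢v eu ev (inj₁ ((za , zb , zc) , _)) = contradiction
      (λ t → KE.encode-injective (trans (eu t) (trans (same t) (sym (ev t))))) u≢v
      where
      same : ∀ t → entry a b c (toℕ t) ≡ entry a′ b′ c′ (toℕ t)
      same t = trans (cong₂ (λ x y → entry x y c (toℕ t)) (sub≡𝟘⇒≡ za) (sub≡𝟘⇒≡ zb))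
        (cong (λ z → entry a′ b′ z (toℕ t)) (sub≡𝟘⇒≡ zc))
    lower {u} {v} u≢v eu ev (inj₂ (i , eq)) =
      subst (h ℕ.* P ≤_) (ℤ.+-injective (sym (trans (distance {u} {v} eu ev) eq))) (minimum-weight i)

  p-1≡h+h : p ℕ.∸ 1 ≡ h ℕ.+ h
  p-1≡h+h = cong (ℕ._∸ 1) p-odd

  [p-1]/2≡h : (p ℕ.∸ 1) / 2 ≡ h
  [p-1]/2≡h = trans (cong (_/ 2) p-1≡h+h) ([n+n]/2≡n h)

  S′≡S : p ^ ((r ℕ.+ r) / 2) ≡ S
  S′≡S = cong (p ^_) ([n+n]/2≡n r)

  isCyclicCode : IsCyclicCode code (3 ℕ.* m) ((p ℕ.∸ 1) / 2 ℕ.* P)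
  isCyclicCode = subst (λ d → IsCyclicCode code (3 ℕ.* m) (d ℕ.* P)) (sym [p-1]/2≡h) (record
    { isLinear = isLinear
    ; shift-closed = λ {v} → shift-closed {v}
    ; dimension = dimension
    ; minimumDistance = minimumDistance
    })

  -- The weights in the shape of `weightDistribution`, with (p - 1) / 2, p - 1 and p ^ ((m - 1) / 2)
  -- abstracted so that each can be replaced by its value h, 2 h or S.
  listed : ℕ → ℕ → ℕ → Fin 7 → ℕ
  listed h′ d S′ 0F = 0
  listed h′ d S′ 1F = h′ ℕ.* P
  listed h′ d S′ 2F = d ℕ.* (P ℕ.∸ S′)
  listed h′ d S′ 3F = h′ ℕ.* (2 ℕ.* P ℕ.∸ S′)
  listed h′ d S′ 4F = d ℕ.* P
  listed h′ d S′ 5F = h′ ℕ.* (2 ℕ.* P ℕ.+ S′)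
  listed h′ d S′ 6F = d ℕ.* (P ℕ.+ S′)

  listedWeight : Fin 7 → ℕ
  listedWeight = listed ((p ℕ.∸ 1) / 2) (p ℕ.∸ 1) (p ^ ((r ℕ.+ r) / 2))

  listedWeight≡ : ∀ i → listedWeight i ≡ weightValue i
  listedWeight≡ i = trans (cong₂ (λ h′ d → listed h′ d (p ^ ((r ℕ.+ r) / 2)) i) [p-1]/2≡h p-1≡h+h)
    (trans (cong (λ S′ → listed h (h ℕ.+ h) S′ i) S′≡S) (known i))
    where
    known : ∀ i → listed h (h ℕ.+ h) S i ≡ weightValue i
    known 0F = refl
    known 1F = refl
    known 2F = refl
    known 3F = refl
    known 4F = refl
    known 5F = refl
    known 6F = refl

  weight-listed : ∀ x y z → weight (x , y , z) ∈ map proj₁ (weightDistribution p m)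
  weight-listed x y z = listed-∈ (proj₁ value) (ℤ.+-injective (trans (weight≡ x y z)
      (trans (proj₂ value) (cong +_ (sym (listedWeight≡ (proj₁ value)))))))
    where
    value : ∃ λ i → wordWeight (FE.encode x) (FE.encode y) (FE.encode z) ≡ + weightValue i
    value = Sum.[ (λ (_ , eq) → 0F , eq) , (λ (i , eq) → suc i , eq) ]′ (weight-values _ _ _)
    -- In the increasing numbering the stated list runs through 0, 1, 3, 5, 2, 6, 4.
    listed-∈ : ∀ {w} i → w ≡ listedWeight i → w ∈ map proj₁ (weightDistribution p m)
    listed-∈ 0F eq = here eq
    listed-∈ 1F eq = there (here eq)
    listed-∈ 3F eq = there (there (here eq))
    listed-∈ 5F eq = there (there (there (here eq)))
    listed-∈ 2F eq = there (there (there (there (here eq))))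
    listed-∈ 6F eq = there (there (there (there (there (here eq)))))
    listed-∈ 4F eq = there (there (there (there (there (there (here eq))))))

  open Rationals

  frequency-listed : ∀ i → fromℕ (frequency (listedWeight i)) ≡ ψ (frequencyValue i)
  frequency-listed i = cong ψ (trans (frequency≡ (listedWeight i))
    (trans (cong (λ w → ∑ (λ a → ∑ (λ b → ∑ (λ c → 𝟏 (wordWeight a b c ℤ.≟ + w))))) (listedWeight≡ i)) (weight-frequency i)))

  frequencies : All (λ (w , f) → fromℕ (frequency w) ≡ f) (weightDistribution p m)
  frequencies =
      frequency-listed 0F
    ∷ trans (frequency-listed 1F) value₁
    ∷ trans (frequency-listed 3F) (trans value₃ (cong (λ s → (ψ (+ q) ℚ.- ℚ.1ℚ) ℚ.* (ψ (+ q) ℚ.- ψ (+ P)) ℚ.* (ψ (+ P) ℚ.+ ψ (+ s))) (sym S′≡S)))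
    ∷ trans (frequency-listed 5F) (trans value₅ (cong (λ s → (ψ (+ q) ℚ.- ℚ.1ℚ) ℚ.* (ψ (+ q) ℚ.- ψ (+ P)) ℚ.* (ψ (+ P) ℚ.- ψ (+ s))) (sym S′≡S)))
    ∷ trans (frequency-listed 2F) (trans value₂ (cong (λ s → (+ 1 ℚ./ 4) ℚ.* (ψ (+ q) ℚ.- ℚ.1ℚ) ℚ.* ((ψ (+ P) ℚ.+ ψ (+ s)) ℚ.* (ψ (+ P) ℚ.+ ψ (+ s)))) (sym S′≡S)))
    ∷ trans (frequency-listed 6F) (trans value₆ (cong (λ s → (+ 1 ℚ./ 4) ℚ.* (ψ (+ q) ℚ.- ℚ.1ℚ) ℚ.* ((ψ (+ P) ℚ.- ψ (+ s)) ℚ.* (ψ (+ P) ℚ.- ψ (+ s)))) (sym S′≡S)))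
    ∷ trans (frequency-listed 4F) (trans value₄ (powers (power m m 2m≡) (power (r ℕ.+ r) (r ℕ.+ r) (double (r ℕ.+ r))) (power m (r ℕ.+ r) 2m-1≡)))
    ∷ []
    where
    open Frequency (+ q) (+ P) (+ S) n₊ n₋ (trans (cong +_ P≡S²) (ℤ.pos-* S S)) 2n₊ 2n₋
    double : ∀ n → n ℕ.+ n ≡ 2 ℕ.* n
    double n = cong (n ℕ.+_) (sym (ℕ.+-identityʳ n))
    2m≡ : m ℕ.+ m ≡ 2 ℕ.* m
    2m≡ = double m
    2m-1≡ : m ℕ.+ (r ℕ.+ r) ≡ 2 ℕ.* m ℕ.∸ 1
    2m-1≡ = cong (ℕ._∸ 1) (trans (sym (ℕ.+-suc m (r ℕ.+ r))) 2m≡)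
    power : ∀ i j {n} → i ℕ.+ j ≡ n → + (p ^ i) ℤ.* + (p ^ j) ≡ + (p ^ n)
    power i j refl = trans (sym (ℤ.pos-* (p ^ i) (p ^ j))) (cong +_ (sym (ℕ.^-distribˡ-+-* p i j)))
    powers : ∀ {x x′ y y′ z z′ : ℤ} → x ≡ x′ → y ≡ y′ → z ≡ z′ →
      (ψ (+ q) ℚ.- ℚ.1ℚ) ℚ.* (ψ x ℚ.+ (+ 3 ℚ./ 2) ℚ.* ψ y ℚ.- two ℚ.* ψ z ℚ.+ ψ (+ q) ℚ.- ℚ.½ ℚ.* ψ (+ P) ℚ.- ℚ.1ℚ) ≡
      (ψ (+ q) ℚ.- ℚ.1ℚ) ℚ.* (ψ x′ ℚ.+ (+ 3 ℚ./ 2) ℚ.* ψ y′ ℚ.- two ℚ.* ψ z′ ℚ.+ ψ (+ q) ℚ.- ℚ.½ ℚ.* ψ (+ P) ℚ.- ℚ.1ℚ)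
    powers refl refl refl = refl

open import Data.Nat.Base using (_*_; _∸_)

-- The equation m = 2 r + 1 is a hypothesis so that matching on it rewrites the type of F.
theorem-odd : ∀ {a b ℓ₁ ℓ₂ : Level} (p m k h : ℕ) →
    Prime p → p ≡ suc (h ℕ.+ h) →
    3 ≤ m → (∃ λ r → m ≡ suc (r ℕ.+ r)) → gcd m k ≡ 1 →
    (K : FiniteField a ℓ₁ p) (F : FiniteField b ℓ₂ (p ^ m))
    (ι : FiniteField.Carrier K → FiniteField.Carrier F) → IsEmbedding K F ι →
    (Tr : FiniteField.Carrier F → FiniteField.Carrier K) → IsTrace K F m ι Tr →
    (π : FiniteField.Carrier F) → FiniteField.IsPrimitive F π →
    let open CyclicCode p m k K F Tr π in
    Coding.IsCyclicCode K code (3 * m) ((p ∸ 1) / 2 * p ^ (m ∸ 1))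
    × (∀ x y z → weight (x , y , z) ∈ map proj₁ (weightDistribution p m))
    × All (λ (w , f) → fromℕ (frequency w) ≡ f) (weightDistribution p m)
theorem-odd p _ k h p-prime p≡1+2h 3≤m (r , refl) coprime K F ι embedding Tr trace π primitive-π =
    Main.isCyclicCode p h r k p-prime p≡1+2h (1≤r r 3≤m) coprime K F ι embedding Tr trace π primitive-π
  , Main.weight-listed p h r k p-prime p≡1+2h (1≤r r 3≤m) coprime K F ι embedding Tr trace π primitive-π
  , Main.frequencies p h r k p-prime p≡1+2h (1≤r r 3≤m) coprime K F ι embedding Tr trace π primitive-π
  where
  1≤r : ∀ r → 3 ≤ suc (r ℕ.+ r) → 1 ≤ r
  1≤r zero (s≤s ())
  1≤r (suc _) _ = s≤s z≤n

theorem3p6 : ∀ {a b ℓ₁ ℓ₂ : Level} (p m k : ℕ) →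
    Prime p → ¬ (2 ∣ p) →
    3 ≤ m → ¬ (2 ∣ m) →
    1 ≤ k → gcd m k ≡ 1 →
    (K : FiniteField a ℓ₁ p) (F : FiniteField b ℓ₂ (p ^ m))
    (ι : FiniteField.Carrier K → FiniteField.Carrier F) → IsEmbedding K F ι →
    (Tr : FiniteField.Carrier F → FiniteField.Carrier K) → IsTrace K F m ι Tr →
    (π : FiniteField.Carrier F) → FiniteField.IsPrimitive F π →
    let open CyclicCode p m k K F Tr π in
    Coding.IsCyclicCode K code (3 * m) ((p ∸ 1) / 2 * p ^ (m ∸ 1))
    × (∀ x y z → weight (x , y , z) ∈ map proj₁ (weightDistribution p m))
    × All (λ (w , f) → fromℕ (frequency w) ≡ f) (weightDistribution p m)
theorem3p6 p m k p-prime p-odd 3≤m m-odd 1≤k coprime =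
  theorem-odd p m k (proj₁ (odd-form p p-odd)) p-prime (proj₂ (odd-form p p-odd)) 3≤m (odd-form m m-odd) coprime
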